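{- For all $r$-tuples of partitions $(\mu^{(1)}|\cdots|\mu^{(r)})$ and $(\lambda^{(1)}|\cdots|\lambda^{(r)})$, $$K^{(\lambda^{(1)}|\cdots|\lambda^{(r)})}_{(\mu^{(1)}|\cdots|\mu^{(r)})}=\left|\mathcal{L}_{(\mu^{(1)}|\cdots|\mu^{(r)})}(\lambda^{(1)}|\cdots|\lambda^{(r)})\right|.$$
   Context: Key polynomials $\mathcal{K}_\alpha$ ($\alpha\in\mathbb{Z}_{\ge0}^n$): the unique polynomials with $\mathcal{K}_\alpha=x^\alpha$ if $\alpha$ is weakly decreasing and $\mathcal{K}_{s_i\alpha}=\xi_i\mathcal{K}_\alpha$ whenever $\alpha_i>\alpha_{i+1}$, where $\xi_i f=\frac{x_if-x_{i+1}s_if}{x_i-x_{i+1}}$ and $s_i$ swaps positions/variables $i,i+1$. For a partition $\lambda$, $\mathrm{rev}(\lambda)=(\lambda_{\ell(\lambda)},\dots,\lambda_1)$; $*$ is concatenation, $0^m$ is $m$ zeros. The multi-symmetric Schur function $\mathcal{S}_{(\lambda^{(1)}|\cdots|\lambda^{(r)})}(X_1|\cdots|X_r)$ is the coefficientwise limit as $n_1,\dots,n_r\to\infty$ of $\mathcal{K}_\gamma(x_{1,1},\dots,x_{1,n_1},\dots,x_{r,1},\dots,x_{r,n_r})$, $\gamma=(0^{n_1-\ell(\lambda^{(1)})}*\mathrm{rev}(\lambda^{(1)}))*\cdots*(0^{n_r-\ell(\lambda^{(r)})}*\mathrm{rev}(\lambda^{(r)}))$; it lies in $\Lambda(X_1|\cdots|X_r)=\Lambda(X_1)\otimes\cdots\otimes\Lambda(X_r)$.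 The multi-symmetric Kostka coefficients are defined by $\mathcal{S}_{(\lambda)}=\sum_{(\mu)}K^{(\lambda)}_{(\mu)}m_{\mu^{(1)}}(X_1)\cdots m_{\mu^{(r)}}(X_r)$. Diagrams and fillings: for a composition $\mu$, $dg'(\mu)=\{(i,j):1\le j\le\mu_i\}$, $\widehat{dg}(\mu)=dg'(\mu)\cup\{(i,0)\}$. Distinct boxes attack if in the same row, or in consecutive rows with the lower box strictly to the right of the upper one. A co-inversion triple for a labeling $\tau$ of $\widehat{dg}(\mu)$ is $(u,v,w)$ with $u=(i,j)$, $j\ge1$, $w=(i,j-1)$, and either $v=(i',j-1)$, $i'>i$, $\mu_{i'}<\mu_i$, or $v=(i',j)$, $i'<i$, $\mu_{i'}\le\mu_i$, with $\tau(u)<\tau(v)<\tau(w)$ or $\tau(v)<\tau(w)<\tau(u)$ or $\tau(w)<\tau(u)<\tau(v)$. Alphabet: $k_j$ ($k\ge1$, $1\le j\le r$) and $\omega_j+k$ ($k\ge0$), ordered by: within index $j$, $a_j<b_j$ iff $a<b$, all $a_j<\omega_j+k$, $\omega_j+k<\omega_j+k'$ iff $k<k'$; all elements of index $j$ precede all of index $j'>j$. $\mathcal{L}(\lambda^{(1)}|\cdots|\lambda^{(r)})$ is the set of maps $\sigma:dg'(\mathrm{rev}(\lambda^{(1)})*\cdots*\mathrm{rev}(\lambda^{(r)}))\to\{k_j\}$ whose extension $\sigma^\star$ with basement labels $\sigma^\star(\ell(\lambda^{(1)})+\cdots+\ell(\lambda^{(i-1)})+j,0)=\omega_i+j-1$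 is non-attacking, weakly decreasing upwards in columns, and has no co-inversion triples. $\mathcal{L}_{(\mu^{(1)}|\cdots|\mu^{(r)})}(\lambda^{(1)}|\cdots|\lambda^{(r)})$ is the subset of those $\sigma$ with $|\sigma^{ -1}(k_j)|=\mu^{(j)}_k$ for all $1\le j\le r$ and all $k\ge1$ (with $\mu^{(j)}_k=0$ for $k>\ell(\mu^{(j)})$). -}

module Defs where

open import Data.Nat using (ℕ; zero; suc; _+_; _≤_; _<_; _≥_)
open import Data.Integer using (ℤ; +_; _-_)
open import Data.Fin using (Fin; toℕ; inject₁)
  renaming (zero to fzero; suc to fsuc)
open import Data.Vec using (Vec; []; _∷_; lookup; _[_]≔_; toList; sum; allFin; zipWith; reverse; _++_)
open import Data.List using (List; []; _∷_; length; map; concat; upTo; filter)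
  renaming (_++_ to _++ˡ_)
open import Data.List.Relation.Unary.All using (All)
open import Data.List.Relation.Unary.Linked using (Linked)
open import Data.Product using (_×_; _,_; Σ; ∃)
open import Data.Sum using (_⊎_)
open import Data.Maybe using (Maybe; just; nothing)
open import Relation.Binary.PropositionalEquality using (_≡_; _≢_)
open import Relation.Nullary using (¬_)
open import Data.Fin.Properties using () renaming (_≟_ to _≟F_)
open import Data.Nat.Properties using () renaming (_≟_ to _≟ℕ_)
open import Data.Product.Properties using (≡-dec)

nth : {A : Set} → List A → ℕ → Maybe A
nth [] _ = nothing
nth (x ∷ xs) zero = just x
nth (x ∷ xs) (suc i) = nth xs i

nth0 : List ℕ → ℕ → ℕ
nth0 [] _ = 0
nth0 (x ∷ xs) zero = x
nth0 (x ∷ xs) (suc i) = nth0 xs i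

Partition : List ℕ → Set
Partition l = Linked _≥_ l × All (1 ≤_) l

-- Polynomials in n variables x_1..x_n with integer coefficients,
-- represented by their coefficient function on exponent vectors
-- (p e = coefficient of x^e).

Poly : ℕ → Set
Poly n = Vec ℕ n → ℤ

mulX : {n : ℕ} → Fin n → Poly n → Poly n
mulX i f e with lookup e i
... | zero = + 0
... | suc k = f (e [ i ]≔ k)

swapV : {m : ℕ} → Fin m → Vec ℕ (suc m) → Vec ℕ (suc m)
swapV i e = (e [ inject₁ i ]≔ lookup e (fsuc i)) [ fsuc i ]≔ lookup e (inject₁ i)

swapP : {m : ℕ} → Fin m → Poly (suc m) → Poly (suc m)
swapP i f e = f (swapV i e)

IsXi : {m : ℕ} → Fin m → Poly (suc m) → Poly (suc m) → Set
IsXi i f g = ∀ e →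
  mulX (inject₁ i) g e - mulX (fsuc i) g e
    ≡ mulX (inject₁ i) f e - mulX (fsuc i) (swapP i f) e

DecreasingV : {n : ℕ} → Vec ℕ n → Set
DecreasingV α = Linked _≥_ (toList α)

KeyFamily : Set
KeyFamily = (n : ℕ) → Vec ℕ n → Poly n

IsKeyFamily : KeyFamily → Set
IsKeyFamily K =
  (∀ n (α : Vec ℕ n) → DecreasingV α →
     (K n α α ≡ + 1) × (∀ e → e ≢ α → K n α e ≡ + 0))
  × (∀ m (α : Vec ℕ (suc m)) (i : Fin m) →
       lookup α (fsuc i) < lookup α (inject₁ i) →
       IsXi i (K (suc m) α) (K (suc m) (swapV i α)))

leftAlign : (n : ℕ) → List ℕ → Vec ℕ n
leftAlign zero _ = []
leftAlign (suc n) [] = 0 ∷ leftAlign n []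
leftAlign (suc n) (x ∷ xs) = x ∷ leftAlign n xs

gammaV : {r : ℕ} (ns : Vec ℕ r) → Vec (List ℕ) r → Vec ℕ (sum ns)
gammaV [] [] = []
gammaV (n ∷ ns) (l ∷ ls) = reverse (leftAlign n l) ++ gammaV ns ls

-- exponent vector of the leading monomial x_{1,1}^{μ1_1} x_{1,2}^{μ1_2} ...
-- of m_{μ1}(X_1) ... m_{μr}(X_r), in the variables x_{1,1..n_1},...,x_{r,1..n_r}
monoV : {r : ℕ} (ns : Vec ℕ r) → Vec (List ℕ) r → Vec ℕ (sum ns)
monoV [] [] = []
monoV (n ∷ ns) (l ∷ ls) = leftAlign n l ++ monoV ns ls

-- letter k j = k_j ;  omega j k = ω_j + k
data Label (r : ℕ) : Set where
  letter : ℕ → Fin r → Label r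
  omega  : Fin r → ℕ → Label r

_<L_ : {r : ℕ} → Label r → Label r → Set
letter k j <L letter k' j' = toℕ j < toℕ j' ⊎ (j ≡ j' × k < k')
letter k j <L omega j' k' = toℕ j ≤ toℕ j'
omega j k <L letter k' j' = toℕ j < toℕ j'
omega j k <L omega j' k'  = toℕ j < toℕ j' ⊎ (j ≡ j' × k < k')

_≤L_ : {r : ℕ} → Label r → Label r → Set
a ≤L b = a <L b ⊎ a ≡ b

-- a filling σ of dg'(β): list of columns (0-based column index i, i.e.
-- the paper's i+1); column i lists σ(i+1,1), σ(i+1,2), ..., σ(i+1,β_{i+1});
-- an entry (k , j) stands for the letter k_j.
Filling : ℕ → Set
Filling r = List (List (ℕ × Fin r))

shapeβ : {r : ℕ} → Vec (List ℕ) r → List ℕ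
shapeβ λs = concat (map Data.List.reverse (toList λs))

basement : {r : ℕ} → Vec (List ℕ) r → List (Label r)
basement {r} λs =
  concat (toList (zipWith (λ b l → map (omega b) (upTo (length l))) (allFin r) λs))

toLabel : {r : ℕ} → ℕ × Fin r → Label r
toLabel (k , j) = letter k j

-- σ⋆ (i , j) : the label of the cell in column i (0-based) and row j
-- (row 0 = basement), or nothing if the cell is not in the diagram
starLab : {r : ℕ} → Vec (List ℕ) r → Filling r → ℕ → ℕ → Maybe (Label r)
starLab λs σ i zero = nth (basement λs) i
starLab λs σ i (suc j) with nth σ i
... | nothing = nothing
... | just col with nth col j
...   | nothing = nothing
...   | just x = just (toLabel x)

Cyclic : {r : ℕ} → Label r → Label r → Label r → Set
Cyclic a b c = (a <L b × b <L c) ⊎ (b <L c × c <L a) ⊎ (c <L a × a <L b)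

InL : {r : ℕ} → Vec (List ℕ) r → Filling r → Set
InL {r} λs σ =
  let β = shapeβ λs
      lab = starLab λs σ in
  (map length σ ≡ β)
  × All (All (λ x → 1 ≤ Data.Product.proj₁ x)) σ
  × (∀ i i' j a b → i ≢ i' → lab i j ≡ just a → lab i' j ≡ just b → a ≢ b)
  × (∀ i i' j a b → i < i' → lab i (suc j) ≡ just a → lab i' j ≡ just b → a ≢ b)
  × (∀ i j a b → lab i (suc j) ≡ just a → lab i j ≡ just b → a ≤L b)
  -- no co-inversion triples (u , v , w), u = (i, j+1), w = (i, j)
  × (∀ i i' j a b c → lab i (suc j) ≡ just a → lab i j ≡ just c →
       ((i < i' × nth0 β i' < nth0 β i × lab i' j ≡ just b)
        ⊎ (i' < i × nth0 β i' ≤ nth0 β i × lab i' (suc j) ≡ just b)) →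
       ¬ Cyclic a b c)

countL : {r : ℕ} → Filling r → ℕ → Fin r → ℕ
countL σ k j = length (filter (λ x → ≡-dec _≟ℕ_ _≟F_ x (k , j)) (concat σ))

InLμ : {r : ℕ} → Vec (List ℕ) r → Vec (List ℕ) r → Filling r → Set
InLμ {r} λs μs σ =
  InL λs σ × (∀ (j : Fin r) (k : ℕ) → countL σ (suc k) j ≡ nth0 (lookup μs j) k)

{-# OPTIONS --safe #-}
module Submission where

-- The coefficient of x^e in the generating function of the fillings of dg'(α) over
-- the basement 1, …, n, built up row by row, equals that of the key polynomial of α.
-- Suppose that of two adjacent columns the left one is higher and has the smaller
-- basement label.  Then the two columns may exchange their places without changing
-- the number of fillings with given rows of letters, so the columns may be sorted by
-- height.  After that a row is determined by its set of letters (every column, from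
-- the highest on, takes the largest letter left), and collecting the fillings that
-- differ by exchanging letters i and i + 1 yields K_{s_i α} = ξ_i K_α.  For α weakly
-- decreasing there is only one filling, and ξ_i f is determined by f because
-- x_i - x_{i+1} is not a zero divisor.
-- For α = γ the columns of height 0 impose no condition, and once the n_j are large
-- the letters of the monomial and the basement labels ω_j + k are ordered like their
-- positions in the finite alphabet, so the coefficient counts the fillings in L_μ(λ).

open import Defs
open import Data.Nat using (ℕ; _≤_)
open import Data.Integer using (+_)
open import Data.Vec using (Vec; sum)
open import Data.Vec.Relation.Unary.All using () renaming (All to AllV)
open import Data.List using (List; length)
open import Data.List.Relation.Unary.Unique.Propositional using (Unique)
open import Data.List.Membership.Propositional using (_∈_)
open import Data.Product using (Σ; ∃; _×_)
open import Relation.Binary.PropositionalEquality using (_≡_)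
open import Data.Bool using (Bool; _xor_; _∧_; _∨_; false; if_then_else_; not; true)
open import Data.Bool.ListAction using (all)
open import Data.Bool.Properties using (T-≡; ∧-comm; ∧-identityʳ; ∧-zeroʳ; ∨-comm)
open import Data.Bool.Solver using (module ∨-∧-Solver)
open import Data.Empty using (⊥; ⊥-elim)
open import Data.Fin using (Fin; inject₁; toℕ) renaming (suc to fsuc; zero to fzero)
open import Data.Fin.Patterns
open import Data.Fin.Properties using (toℕ-injective; toℕ-inject₁; toℕ<n) renaming (_≟_ to _≟F_)
open import Data.Integer using (-_; 0ℤ; 1ℤ; _*_; _+_; _-_; ℤ)
open import Data.Integer.Properties using (*-cancelˡ-≡; +-comm; +-identityʳ; +-identityˡ)
open import Data.Integer.Tactic.RingSolver using (solve-∀)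
open import Data.List as List using ([]; _++_; _∷_; allFin; applyUpTo; cartesianProduct; concat;
  filter; foldr; map; replicate; reverse; upTo; zip)
open import Data.List.Membership.Propositional using (_∉_)
open import Data.List.Membership.Propositional.Properties using (∈-allFin; ∈-applyUpTo⁺;
  ∈-applyUpTo⁻; ∈-cartesianProduct⁺; ∈-cartesianProduct⁻; ∈-concat⁺′; ∈-filter⁺; ∈-filter⁻;
  ∈-map⁺; ∈-map⁻)
open import Data.List.Properties using (++-assoc; ++-identityʳ; concat-map; filter-accept;
  filter-reject; length-++; length-applyUpTo; length-map; length-reverse; map-++; map-applyUpTo;
  map-cong; map-∘; reverse-++; reverse-involutive; unfold-reverse; ∷-injective; ∷-injectiveʳ)
open import Data.List.Relation.Binary.Permutation.Propositional using (_↭_; prep; refl; swap;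
  ↭-refl; ↭-reflexive; ↭-sym) renaming (trans to ↭-trans)
open import Data.List.Relation.Binary.Permutation.Propositional.Properties using (All-resp-↭;
  shift; shifts; ↭-reverse) renaming (++-comm to ↭-++-comm; ++⁺ʳ to ↭-++⁺ʳ; ++⁺ˡ to ↭-++⁺ˡ)
open import Data.List.Relation.Unary.All as All using (All; []; _∷_)
open import Data.List.Relation.Unary.All.Properties using () renaming (++⁺ to All-++⁺; ++⁻ʳ to
  All-++⁻ʳ; ++⁻ˡ to All-++⁻ˡ; concat⁺ to All-concat⁺; map⁺ to All-map⁺; map⁻ to All-map⁻)
open import Data.List.Relation.Unary.AllPairs as AllPairs using (AllPairs; []; _∷_)
open import Data.List.Relation.Unary.AllPairs.Properties using () renaming (++⁺ to AllPairs-++⁺;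
  map⁺ to AllPairs-map⁺; map⁻ to AllPairs-map⁻)
open import Data.List.Relation.Unary.Any as Any using (Any; here; there)
open import Data.List.Relation.Unary.Any.Properties using () renaming (++⁺ʳ to Any-++⁺ʳ; ++⁺ˡ to
  Any-++⁺ˡ; map⁺ to Any-map⁺; map⁻ to Any-map⁻)
open import Data.List.Relation.Unary.Linked as Linked using (Linked; [-]; []; _∷_)
open import Data.List.Relation.Unary.Unique.Propositional.Properties using (allFin⁺; applyUpTo⁺₁;
  cartesianProduct⁺; filter⁺) renaming (map⁺ to Unique-map⁺)
open import Data.Maybe using (Maybe; _>>=_; just; maybe; nothing) renaming (map to mapᴹ)
open import Data.Nat using (_<_; _<ᵇ_; _∸_; _≟_; _≡ᵇ_; _≥_; pred; suc; s≤s; zero; z≤n) renaming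
  (_*_ to _*ℕ_; _+_ to _+ℕ_)
open import Data.Nat.Induction using (<-wellFounded)
open import Data.Nat.Properties using (+-mono-≤; +-mono-≤-<; +-monoʳ-<; +-monoʳ-≤; +-monoˡ-<;
  +-suc; 0≢1+n; 1+n≢0; 1+n≢n; <-cmp; <-irrefl; <-trans; <-≤-trans; <ᵇ⇒<; <⇒<ᵇ; <⇒≢; <⇒≤; <⇒≯; <⇒≱;
  _<?_; _≟_; _≤?_; m+[n∸m]≡n; m+n≤o⇒m≤o∸n; m<n⇒m<1+n; m∸n+n≡m; m≤m+n; m≤n+m; m≤n⇒m<n∨m≡n;
  m≤n⇒m≤1+n; n<1+n; n≤1+n; suc-injective; ≡ᵇ⇒≡; ≡⇒≡ᵇ; ≤-antisym; ≤-pred; ≤-refl; ≤-reflexive;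
  ≤-trans; ≤∧≢⇒<; ≮⇒≥; ≰⇒>) renaming (+-assoc to +-assocℕ; +-comm to +-commℕ; +-identityʳ to
  +-identityʳℕ)
open import Data.Nat.Tactic.RingSolver using () renaming (solve-∀ to ℕ-solve-∀)
open import Data.Product using (_,_; proj₁; proj₂; uncurry; ∃₂)
open import Data.Product.Properties using (≡-dec)
open import Data.Sum using (_⊎_; inj₁; inj₂)
open import Data.Vec as Vec using ([]; _∷_; lookup; tabulate; toList; zipWith) renaming (_++_ to
  _++ᵛ_; map to mapᵛ; reverse to reverseᵛ)
open import Data.Vec.Membership.Propositional using () renaming (_∈_ to _∈ᵛ_)
open import Data.Vec.Properties using (length-toList; toList-++; toList-reverse) renaming
  (map-cong to mapᵛ-cong; map-∘ to mapᵛ-∘; ≡-dec to ≡-decᵛ)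
open import Data.Vec.Relation.Unary.All as AllV using ([]; _∷_)
open import Data.Vec.Relation.Unary.Any using (here; there)
open import Function using (Equivalence; _∘_; flip; id)
open import Induction.WellFounded using (Acc; acc)
open import Relation.Binary.Definitions using (tri<; tri>; tri≈)
open import Relation.Binary.PropositionalEquality using (_≢_; cong; cong₂; module ≡-Reasoning;
  refl; subst; subst₂; sym; trans)
open import Relation.Nullary using (Dec; no; yes; ¬_)
open import Data.List.Membership.DecPropositional _≟_ using (_∈?_)
import Data.Integer.Properties as ℤₚ

-- The exchange of two columns does not survive an induction on the rows by itself: one step can
-- turn the smaller of the two labels into the larger one, and then the two generating functions
-- differ. Their difference is again of the same kind, with the labels of the two columns
-- interchanged, unless a third column lies between the two in height and in label; in that case the
-- difference vanishes. Hence three laws are proved together, and the wanted exchange is the first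
-- of them. The case analysis behind them compares at most six labels at a time, so most of it is
-- left to finite evaluation. The Demazure recursion is strengthened in a similar way: besides the
-- relation g = ξ f, the symmetry of g in the two variables is carried along, since a row with just
-- one of the letters i, i + 1 contributes x_{i+1} h₁ + x_i h₂ with h₁ = ξ h₂, and this is handled
-- through the symmetry of h₁.

∧-elim : ∀ {a b} → a ∧ b ≡ true → a ≡ true × b ≡ true
∧-elim {true} {true} _ = refl , refl

∧-intro : ∀ {a b} → a ≡ true → b ≡ true → a ∧ b ≡ true
∧-intro refl refl = refl

<ᵇ-true : ∀ {m n} → m < n → (m <ᵇ n) ≡ true
<ᵇ-true m<n = Equivalence.to T-≡ (<⇒<ᵇ m<n)

<ᵇ-true⁻ : ∀ {m n} → (m <ᵇ n) ≡ true → m < n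
<ᵇ-true⁻ {m} {n} eq = <ᵇ⇒< m n (Equivalence.from T-≡ eq)

<ᵇ-false : ∀ {m n} → n ≤ m → (m <ᵇ n) ≡ false
<ᵇ-false {m} {n} n≤m with m <ᵇ n in eq
... | false = refl
... | true  = ⊥-elim (<⇒≱ (<ᵇ-true⁻ eq) n≤m)

<ᵇ-false⁻ : ∀ {m n} → (m <ᵇ n) ≡ false → n ≤ m
<ᵇ-false⁻ {m} {n} eq = ≮⇒≥ λ m<n → case-false (trans (sym eq) (<ᵇ-true m<n))
  where
  case-false : ¬ (false ≡ true)
  case-false ()

-- Formulas in order relations

-- Only the relative order of the entries of v matters below, so an order
-- formula in k variables is valid as soon as it holds for all v ∈ {0,…,k-1}^k.

Comparisons : ℕ → Set
Comparisons k = Vec (Vec Bool k) k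

comparisons : ∀ {k} → Vec ℕ k → Comparisons k
comparisons v = mapᵛ (λ x → mapᵛ (λ y → x <ᵇ y) v) v

all< : ℕ → (ℕ → Bool) → Bool
all< zero    f = true
all< (suc b) f = f b ∧ all< b f

allVec< : ∀ k → ℕ → (Vec ℕ k → Bool) → Bool
allVec< zero    b φ = φ []
allVec< (suc k) b φ = all< b (λ x → allVec< k b (φ ∘ (x ∷_)))

all<-sound : ∀ b f → all< b f ≡ true → ∀ {x} → x < b → f x ≡ true
all<-sound (suc b) f h {x} (s≤s x≤b) with x ≟ b
... | yes refl = proj₁ (∧-elim h)
... | no  x≢b  = all<-sound b f (proj₂ (∧-elim {f b} h)) (≤∧≢⇒< x≤b x≢b)

allVec<-sound : ∀ k b φ → allVec< k b φ ≡ true → ∀ {v} → AllV (_< b) v → φ v ≡ true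
allVec<-sound zero    b φ h []       = h
allVec<-sound (suc k) b φ h (x<b ∷ v<b) =
  allVec<-sound k b _ (all<-sound b _ h x<b) v<b

-- The number of entries below `x`. It preserves the comparisons of entries and sends them below
-- `k`, which reduces arbitrary labels to a finite cube.
rank : ∀ {k} → Vec ℕ k → ℕ → ℕ
rank []      x = 0
rank (y ∷ v) x = (if y <ᵇ x then 1 else 0) +ℕ rank v x

private
  step-mono : ∀ {x x'} y → x ≤ x' → (if y <ᵇ x then 1 else 0) ≤ (if y <ᵇ x' then 1 else 0)
  step-mono {x} {x'} y x≤x' with y <ᵇ x in eq
  ... | false = z≤n
  ... | true rewrite <ᵇ-true (<-≤-trans (<ᵇ-true⁻ eq) x≤x') = ≤-refl

rank-mono : ∀ {k} (v : Vec ℕ k) {x x'} → x ≤ x' → rank v x ≤ rank v x'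
rank-mono []      x≤x' = z≤n
rank-mono (y ∷ v) x≤x' = +-mono-≤ (step-mono y x≤x') (rank-mono v x≤x')

rank-mono-< : ∀ {k} {v : Vec ℕ k} {x x'} → x ∈ᵛ v → x < x' → rank v x < rank v x'
rank-mono-< {v = y ∷ v} {x} {x'} (here refl) x<x'
  rewrite <ᵇ-false (≤-refl {x}) | <ᵇ-true x<x' = s≤s (rank-mono v (<⇒≤ x<x'))
rank-mono-< {v = y ∷ v} (there x∈v) x<x' =
  +-mono-≤-< (step-mono y (<⇒≤ x<x')) (rank-mono-< x∈v x<x')

rank≤ : ∀ {k} (v : Vec ℕ k) x → rank v x ≤ k
rank≤ []      x = z≤n
rank≤ (y ∷ v) x with y <ᵇ x
... | true  = s≤s (rank≤ v x)
... | false = m≤n⇒m≤1+n (rank≤ v x)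

rank< : ∀ {k} {v : Vec ℕ k} {x} → x ∈ᵛ v → rank v x < k
rank< {v = y ∷ v} {x} (here refl) rewrite <ᵇ-false (≤-refl {x}) = s≤s (rank≤ v x)
rank< {v = y ∷ v} {x} (there x∈v) with y <ᵇ x
... | true  = s≤s (rank< x∈v)
... | false = m<n⇒m<1+n (rank< x∈v)

rank-<ᵇ : ∀ {k} {v : Vec ℕ k} {x y} → x ∈ᵛ v → (rank v x <ᵇ rank v y) ≡ (x <ᵇ y)
rank-<ᵇ {v = v} {x} {y} x∈v with x <ᵇ y in eq
... | true  = <ᵇ-true (rank-mono-< x∈v (<ᵇ-true⁻ eq))
... | false = <ᵇ-false (rank-mono v (<ᵇ-false⁻ eq))

private
  map-local : ∀ {A B : Set} {k} {f g : A → B} {v : Vec A k} → AllV (λ x → f x ≡ g x) v → mapᵛ f v ≡ mapᵛ g v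
  map-local []       = refl
  map-local (p ∷ ps) = cong₂ _∷_ p (map-local ps)

  all∈ : ∀ {A : Set} {k} (v : Vec A k) → AllV (_∈ᵛ v) v
  all∈ []      = []
  all∈ (x ∷ v) = here refl ∷ AllV.map there (all∈ v)

comparisons-rank : ∀ {k} (v : Vec ℕ k) → comparisons (mapᵛ (rank v) v) ≡ comparisons v
comparisons-rank v =
  trans (sym (mapᵛ-∘ _ (rank v) v))
        (map-local (AllV.map (λ {x} x∈v →
           trans (sym (mapᵛ-∘ _ (rank v) v)) (mapᵛ-cong (λ y → rank-<ᵇ x∈v) v)) (all∈ v)))

-- Since `φ` sees only the comparison matrix, passing from `v` to its ranks changes nothing. For a
-- concrete `φ` the hypothesis is a closed Boolean, so every use discharges it by `refl`.
order-tautology : ∀ k (φ : Comparisons k → Bool) →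
  allVec< k k (φ ∘ comparisons) ≡ true → ∀ v → φ (comparisons v) ≡ true
order-tautology k φ h v =
  trans (cong φ (sym (comparisons-rank v)))
        (allVec<-sound k k (φ ∘ comparisons) h (ranks< (all∈ v)))
  where
  ranks< : ∀ {j} {w : Vec ℕ j} → AllV (_∈ᵛ v) w → AllV (_< k) (mapᵛ (rank v) w)
  ranks< []       = []
  ranks< (p ∷ ps) = rank< p ∷ ranks< ps

-- Sums and coefficient functions

sumL : {A : Set} → List A → (A → ℤ) → ℤ
sumL []       f = 0ℤ
sumL (a ∷ as) f = f a + sumL as f

sumL-cong : ∀ {A : Set} (as : List A) {f g} → (∀ a → f a ≡ g a) → sumL as f ≡ sumL as g
sumL-cong []       h = refl
sumL-cong (a ∷ as) h = cong₂ _+_ (h a) (sumL-cong as h)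

sumL-0 : ∀ {A : Set} (as : List A) → sumL as (λ _ → 0ℤ) ≡ 0ℤ
sumL-0 []       = refl
sumL-0 (a ∷ as) = trans (+-identityˡ _) (sumL-0 as)

private
  interchange : ∀ a b c d → (a + b) + (c + d) ≡ (a + c) + (b + d)
  interchange = solve-∀

sumL-+ : ∀ {A : Set} (as : List A) f g → sumL as (λ a → f a + g a) ≡ sumL as f + sumL as g
sumL-+ []       f g = refl
sumL-+ (a ∷ as) f g =
  trans (cong (_+_ (f a + g a)) (sumL-+ as f g)) (interchange (f a) (g a) (sumL as f) (sumL as g))

sumL-swap : ∀ {A B : Set} (as : List A) (bs : List B) (f : A → B → ℤ) →
  sumL as (λ a → sumL bs (f a)) ≡ sumL bs (λ b → sumL as (λ a → f a b))
sumL-swap []       bs f = sym (sumL-0 bs)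
sumL-swap (a ∷ as) bs f =
  trans (cong (_+_ (sumL bs (f a))) (sumL-swap as bs f))
        (sym (sumL-+ bs (f a) (λ b → sumL as (λ a → f a b))))

double-cancel : ∀ {x y : ℤ} → x + x ≡ y + y → x ≡ y
double-cancel {x} {y} h = *-cancelˡ-≡ (+ 2) x y (trans (sym (twice x)) (trans h (twice y)))
  where
  twice : ∀ z → z + z ≡ + 2 * z
  twice = solve-∀

-- Twice the double sum is the sum of the symmetrized terms, and 2 cancels in ℤ. This form is needed
-- because the exchange laws hold only after adding the two ways of giving two letters to two
-- columns.
sumL-double : ∀ {A : Set} (as : List A) (f g : A → A → ℤ) → (∀ c d → f c d + f d c ≡ g c d + g d c) →
  sumL as (λ c → sumL as (f c)) ≡ sumL as (λ c → sumL as (g c))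
sumL-double as f g h = double-cancel (trans (sym (both f)) (trans (sumL-cong as λ c → sumL-cong as (h c)) (both g)))
  where
  both : ∀ k → sumL as (λ c → sumL as (λ d → k c d + k d c)) ≡
               sumL as (λ c → sumL as (k c)) + sumL as (λ c → sumL as (k c))
  both k = trans (sumL-cong as λ c → sumL-+ as (k c) (λ d → k d c))
          (trans (sumL-+ as (λ c → sumL as (k c)) (λ c → sumL as (λ d → k d c)))
                 (cong (_+_ (sumL as (λ c → sumL as (k c)))) (sumL-swap as as (λ c d → k d c))))

infix 5 _▹_
_▹_ : Bool → ℤ → ℤ
true  ▹ z = z
false ▹ z = 0ℤ

▹-∧ : ∀ a b {z} → ((a ∧ b) ▹ z) ≡ (a ▹ (b ▹ z))
▹-∧ true  b = refl
▹-∧ false b = refl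

▹-+ : ∀ a {z w} → (a ▹ z + w) ≡ (a ▹ z) + (a ▹ w)
▹-+ true  = refl
▹-+ false = refl

▹-0 : ∀ a → (a ▹ 0ℤ) ≡ 0ℤ
▹-0 true  = refl
▹-0 false = refl

infix 4 _≐_
_≐_ : ∀ {n} → Poly n → Poly n → Set
f ≐ g = ∀ e → f e ≡ g e

dec : ∀ {n} → ℕ → Vec ℕ n → Maybe (Vec ℕ n)
dec a       []          = nothing
dec zero    (zero ∷ e)  = nothing
dec zero    (suc x ∷ e) = just (x ∷ e)
dec (suc a) (x ∷ e)     = mapᴹ (x ∷_) (dec a e)

-- Multiplication by the variable x_a on coefficient functions. An index outside the `n` variables
-- yields 0.
X : ∀ {n} → ℕ → Poly n → Poly n
X a f e = maybe f 0ℤ (dec a e)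

X* : ∀ {n} → List ℕ → Poly n → Poly n
X* []       f = f
X* (a ∷ as) f = X a (X* as f)

X-cong : ∀ {n} a {f g : Poly n} → f ≐ g → X a f ≐ X a g
X-cong a h e with dec a e
... | just e' = h e'
... | nothing = refl

X-suc : ∀ {n} a (f : Poly (suc n)) y e → X (suc a) f (y ∷ e) ≡ X a (λ e → f (y ∷ e)) e
X-suc a f y e with dec a e
... | just _  = refl
... | nothing = refl

X-0 : ∀ {n} a → X {n} a (λ _ → 0ℤ) ≐ λ _ → 0ℤ
X-0 a e with dec a e
... | just _  = refl
... | nothing = refl

X-+ : ∀ {n} a (f g : Poly n) → X a (λ e → f e + g e) ≐ λ e → X a f e + X a g e
X-+ a f g e with dec a e
... | just _  = refl
... | nothing = refl

X-- : ∀ {n} a (f g : Poly n) → X a (λ e → f e - g e) ≐ λ e → X a f e - X a g e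
X-- a f g e with dec a e
... | just _  = refl
... | nothing = refl

dec-comm : ∀ {n} a b (e : Vec ℕ n) → (dec a e >>= dec b) ≡ (dec b e >>= dec a)
dec-comm a       b       []          = refl
dec-comm zero    zero    (x ∷ e)     = refl
dec-comm zero    (suc b) (zero ∷ e) with dec b e
... | just _  = refl
... | nothing = refl
dec-comm zero    (suc b) (suc x ∷ e) with dec b e
... | just _  = refl
... | nothing = refl
dec-comm (suc a) zero    (zero ∷ e) with dec a e
... | just _  = refl
... | nothing = refl
dec-comm (suc a) zero    (suc x ∷ e) with dec a e
... | just _  = refl
... | nothing = refl
dec-comm (suc a) (suc b) (x ∷ e) =
  trans (lift a b) (trans (cong (mapᴹ (x ∷_)) (dec-comm a b e)) (sym (lift b a)))
  where
  lift : ∀ a b → (mapᴹ (x ∷_) (dec a e) >>= dec (suc b)) ≡ mapᴹ (x ∷_) (dec a e >>= dec b)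
  lift a b with dec a e
  ... | just _  = refl
  ... | nothing = refl

X-comm : ∀ {n} a b (f : Poly n) → X a (X b f) ≐ X b (X a f)
X-comm a b f e = trans (bind a b) (trans (cong (maybe f 0ℤ) (dec-comm a b e)) (sym (bind b a)))
  where
  bind : ∀ a b → X a (X b f) e ≡ maybe f 0ℤ (dec a e >>= dec b)
  bind a b with dec a e
  ... | just _  = refl
  ... | nothing = refl

X*-cong : ∀ {n} as {f g : Poly n} → f ≐ g → X* as f ≐ X* as g
X*-cong []       h = h
X*-cong (a ∷ as) h = X-cong a (X*-cong as h)

X*-0 : ∀ {n} as → X* {n} as (λ _ → 0ℤ) ≐ λ _ → 0ℤ
X*-0 []       e = refl
X*-0 (a ∷ as) e = trans (X-cong a (X*-0 as) e) (X-0 a e)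

X*-+ : ∀ {n} as (f g : Poly n) → X* as (λ e → f e + g e) ≐ λ e → X* as f e + X* as g e
X*-+ []       f g e = refl
X*-+ (a ∷ as) f g e = trans (X-cong a (X*-+ as f g) e) (X-+ a (X* as f) (X* as g) e)

X*-- : ∀ {n} as (f g : Poly n) → X* as (λ e → f e - g e) ≐ λ e → X* as f e - X* as g e
X*-- []       f g e = refl
X*-- (a ∷ as) f g e = trans (X-cong a (X*-- as f g) e) (X-- a (X* as f) (X* as g) e)

X*-++ : ∀ {n} as bs (f : Poly n) → X* (as ++ bs) f ≐ X* as (X* bs f)
X*-++ []       bs f e = refl
X*-++ (a ∷ as) bs f e = X-cong a (X*-++ as bs f) e

X*-↭ : ∀ {n as bs} (f : Poly n) → as ↭ bs → X* as f ≐ X* bs f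
X*-↭ f refl         e = refl
X*-↭ f (prep a p)   e = X-cong a (X*-↭ f p) e
X*-↭ f (swap {xs = as} a b p) e =
  trans (X-comm a b (X* as f) e) (X-cong b (X-cong a (X*-↭ f p)) e)
X*-↭ f (↭-trans p q)  e = trans (X*-↭ f p e) (X*-↭ f q e)

-- The constant polynomial 1, the weight of the empty filling.
δ : ∀ {n} → Poly n
δ []          = 1ℤ
δ (zero ∷ e)  = δ e
δ (suc _ ∷ e) = 0ℤ

-- Boolean tests on lists

infixr 3 _⇛_
_⇛_ : Bool → Bool → Bool
true  ⇛ b = b
false ⇛ b = true

infix 4 _⇔ᵇ_
_⇔ᵇ_ : Bool → Bool → Bool
true  ⇔ᵇ b = b
false ⇔ᵇ b = not b

⇛-elim : ∀ {a b} → (a ⇛ b) ≡ true → a ≡ true → b ≡ true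
⇛-elim h refl = h

⇔ᵇ-elim : ∀ {a b} → (a ⇔ᵇ b) ≡ true → a ≡ b
⇔ᵇ-elim {true}  {true}  h = refl
⇔ᵇ-elim {false} {false} h = refl

not-elim : ∀ {a} → not a ≡ true → a ≡ false
not-elim {false} h = refl

not-intro : ∀ {a} → a ≡ false → not a ≡ true
not-intro refl = refl

all-++ : ∀ {A : Set} (p : A → Bool) xs ys → all p (xs ++ ys) ≡ all p xs ∧ all p ys
all-++ p []       ys = refl
all-++ p (x ∷ xs) ys with p x
... | true  = all-++ p xs ys
... | false = refl

all-map : ∀ {A B : Set} (p : B → Bool) (f : A → B) xs → all p (map f xs) ≡ all (p ∘ f) xs
all-map p f []       = refl
all-map p f (x ∷ xs) = cong (p (f x) ∧_) (all-map p f xs)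

all-∧ : ∀ {A : Set} (p q : A → Bool) xs → all p xs ∧ all q xs ≡ all (λ x → p x ∧ q x) xs
all-∧ p q []       = refl
all-∧ p q (x ∷ xs) = trans (solve 4 (λ a b c d → (a :* b) :* (c :* d) := (a :* c) :* (b :* d)) refl (p x) (all p xs) (q x) (all q xs))
                           (cong ((p x ∧ q x) ∧_) (all-∧ p q xs))
  where open ∨-∧-Solver

all-cong : ∀ {A : Set} {p q : A → Bool} {xs} → All (λ x → p x ≡ q x) xs → all p xs ≡ all q xs
all-cong []       = refl
all-cong (h ∷ hs) = cong₂ _∧_ h (all-cong hs)

all-false : ∀ {A : Set} {p : A → Bool} {xs} → Any (λ x → p x ≡ false) xs → all p xs ≡ false
all-false {p = p} (here h) rewrite h = refl
all-false {p = p} {x ∷ xs} (there h) with p x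
... | true  = all-false h
... | false = refl

all-true⁻ : ∀ {A : Set} {p : A → Bool} xs → all p xs ≡ true → All (λ x → p x ≡ true) xs
all-true⁻ []       h = []
all-true⁻ {p = p} (x ∷ xs) h = proj₁ (∧-elim {p x} h) ∷ all-true⁻ xs (proj₂ (∧-elim {p x} h))

all-true : ∀ {A : Set} {p : A → Bool} {xs} → All (λ x → p x ≡ true) xs → all p xs ≡ true
all-true []       = refl
all-true (h ∷ hs) = ∧-intro h (all-true hs)

search : ∀ {A : Set} (p : A → Bool) xs → Any (λ x → p x ≡ true) xs ⊎ All (λ x → p x ≡ false) xs
search p [] = inj₂ []
search p (x ∷ xs) with p x in eq | search p xs
... | true  | _      = inj₁ (here eq)
... | false | inj₁ h = inj₁ (there h)
... | false | inj₂ h = inj₂ (eq ∷ h)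

-- Rows of fillings

-- A column is a pair (number of boxes still to be filled, label of the box
-- below them).  Lists of columns are read from right to left.

Col : Set
Col = ℕ × ℕ

-- An idle column has its top box, labelled `b`, in the row just below. It is kept for one row
-- because that box still restricts the boxes above it to the left; `next` then drops it.
data Cell : Set where
  idle : (b : ℕ) → Cell
  move : (h b a : ℕ) → Cell

apart : {A : Set} → (A → A → Bool) → A → A → Bool
apart lt x y = lt x y ∨ lt y x

-- A half-open interval merges two conditions: its closed end forbids equal labels on attacking
-- boxes, its interior forbids a co-inversion triple. One interval per pair of columns suffices,
-- because columns weakly decrease upwards and so only one of the three cyclic orders of a triple
-- can occur.
openClosed closedOpen : {A : Set} → (A → A → Bool) → A → A → A → Bool
openClosed lt p x q = lt p x ∧ not (lt q x)
closedOpen lt p x q = not (lt x p) ∧ lt x q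

-- The condition on a column stepping from bq to aq and a column further left
-- stepping from bp to ap; the flag says whether the left one is strictly higher.
pair : {A : Set} → (A → A → Bool) → Bool → A → A → A → A → Bool
pair lt t bq aq bp ap =
  apart lt aq ap ∧ (if t then not (closedOpen lt ap bq bp) else not (openClosed lt aq ap bq))

fit : Cell → Bool
fit (idle b)     = true
fit (move h b a) = not (b <ᵇ a)

-- The right cell comes first. Remaining heights compare as full heights do, since equally many
-- boxes have been filled in both columns. If the left column has no box in this row, nothing is
-- imposed: an attack or a triple of the two columns would involve the missing box.
ok : Cell → Cell → Bool
ok (move hq bq aq) (move hp bp ap) = pair _<ᵇ_ (hq <ᵇ hp) bq aq bp ap
ok (idle bq)       (move hp bp ap) = not (closedOpen _<ᵇ_ ap bq bp)
ok _               (idle bp)       = true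

okRow : List Cell → Bool
okRow []      = true
okRow (x ∷ r) = fit x ∧ (all (ok x) r ∧ okRow r)

next : List Cell → List Col
next []               = []
next (idle b ∷ r)     = next r
next (move h b a ∷ r) = (h , a) ∷ next r

letters : List Cell → List ℕ
letters []               = []
letters (idle b ∷ r)     = letters r
letters (move h b a ∷ r) = a ∷ letters r

rowSum : List ℕ → List Col → (List Cell → ℤ) → ℤ
rowSum A []                 F = F []
rowSum A ((zero  , b) ∷ cs) F = rowSum A cs (F ∘ (idle b ∷_))
rowSum A ((suc h , b) ∷ cs) F = sumL A (λ a → rowSum A cs (F ∘ (move h b a ∷_)))

-- A is the alphabet and k a bound on the number of rows.
G : ∀ {n} → List ℕ → ℕ → List Col → Poly n
G A zero    cs = δ
G A (suc k) cs = λ e → rowSum A cs (λ r → okRow r ▹ X* (letters r) (G A k (next r)) e)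

col : Cell → Col
col (idle b)     = zero , b
col (move h b a) = suc h , b

rowSum-cong : ∀ A cs {F F'} → (∀ r → map col r ≡ cs → F r ≡ F' r) → rowSum A cs F ≡ rowSum A cs F'
rowSum-cong A []                 h = h [] refl
rowSum-cong A ((zero  , b) ∷ cs) h = rowSum-cong A cs (λ r eq → h _ (cong (_ ∷_) eq))
rowSum-cong A ((suc _ , b) ∷ cs) h = sumL-cong A λ a → rowSum-cong A cs (λ r eq → h _ (cong (_ ∷_) eq))

rowSum-+ : ∀ A cs F F' → rowSum A cs (λ r → F r + F' r) ≡ rowSum A cs F + rowSum A cs F'
rowSum-+ A []                 F F' = refl
rowSum-+ A ((zero  , b) ∷ cs) F F' = rowSum-+ A cs (F ∘ (idle b ∷_)) (F' ∘ (idle b ∷_))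
rowSum-+ A ((suc h , b) ∷ cs) F F' =
  trans (sumL-cong A λ a → rowSum-+ A cs (F ∘ (move h b a ∷_)) (F' ∘ (move h b a ∷_)))
        (sumL-+ A _ _)

rowSum-++ : ∀ A cs ds F → rowSum A (cs ++ ds) F ≡ rowSum A cs (λ r → rowSum A ds (λ s → F (r ++ s)))
rowSum-++ A []                 ds F = refl
rowSum-++ A ((zero  , b) ∷ cs) ds F = rowSum-++ A cs ds (F ∘ (idle b ∷_))
rowSum-++ A ((suc h , b) ∷ cs) ds F = sumL-cong A λ a → rowSum-++ A cs ds (F ∘ (move h b a ∷_))

next-++ : ∀ r s → next (r ++ s) ≡ next r ++ next s
next-++ []               s = refl
next-++ (idle b ∷ r)     s = next-++ r s
next-++ (move h b a ∷ r) s = cong ((h , a) ∷_) (next-++ r s)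

letters-++ : ∀ r s → letters (r ++ s) ≡ letters r ++ letters s
letters-++ []               s = refl
letters-++ (idle b ∷ r)     s = letters-++ r s
letters-++ (move h b a ∷ r) s = cong (a ∷_) (letters-++ r s)

data Side : Set where
  right left : Side

tag : {A : Set} → List A → List A → List (Side × A)
tag rs ls = map (right ,_) rs ++ map (left ,_) ls

okAt : Cell → Side × Cell → Bool
okAt x (right , e) = ok e x
okAt x (left  , e) = ok x e

-- the conditions imposed on the cell x by the cells r to its right and l to its left
side : List Cell → List Cell → Cell → Bool
side r l x = fit x ∧ all (okAt x) (tag r l)

-- Isolates two neighbouring cells from the row. Of the factors only `ok x y` depends on which of
-- the two stands on the right.
okRow-split : ∀ r x y l →
  okRow (r ++ x ∷ y ∷ l) ≡ okRow (r ++ l) ∧ ((side r l x ∧ side r l y) ∧ ok x y)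
okRow-split [] x y l
  rewrite all-map (okAt x) (left ,_) l | all-map (okAt y) (left ,_) l =
  solve 6 (λ fx o ax fy ay w → fx :* ((o :* ax) :* (fy :* (ay :* w))) := w :* (((fx :* ax) :* (fy :* ay)) :* o))
    refl (fit x) (ok x y) (all (ok x) l) (fit y) (all (ok y) l) (okRow l)
  where open ∨-∧-Solver
okRow-split (z ∷ r) x y l
  rewrite all-++ (ok z) r (x ∷ y ∷ l) | all-++ (ok z) r l | okRow-split r x y l =
  solve 11 (λ fz a zx zy b w fx cx fy cy o →
      fz :* ((a :* (zx :* (zy :* b))) :* (w :* (((fx :* cx) :* (fy :* cy)) :* o))) :=
      (fz :* ((a :* b) :* w)) :* (((fx :* (zx :* cx)) :* (fy :* (zy :* cy))) :* o))
    refl (fit z) (all (ok z) r) (ok z x) (ok z y) (all (ok z) l) (okRow (r ++ l))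
         (fit x) (all (okAt x) (tag r l)) (fit y) (all (okAt y) (tag r l)) (ok x y)
  where open ∨-∧-Solver

-- Exchanging two adjacent columns

-- Two columns A (higher) and B are to exchange places.  In the tests below,
-- A u z and B v z are the conditions imposed by a third column on the steps
-- u → z of A and v → z of B, and m < M and y < x are the labels before and
-- after the step.  The third column separates A and B if its strength and its
-- label both lie between theirs (sep before the step, sep' after it).
exchange : {S : Set} → (S → S → Bool) → (A B : S → S → Bool) → (sep sep' : Bool) → (m M x y : S) → Bool
exchange lt A B sep sep' m M x y =
    (not (lt m x) ⇛ ((sep' ⇛ not (A m y ∧ B M x)) ∧ (not sep' ⇛ A m y ∧ B M x ⇔ᵇ A m x ∧ B M y)))
  ∧ ((not (lt m x) ⇛ not sep ⇛ (A M x ∧ B m y ⇔ᵇ A m x ∧ B M y))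
  ∧ ((not (lt m y) ⇛ lt m x ⇛ not (lt M x) ⇛ not sep ⇛
        ((sep' ⇛ not (A m y ∧ B M x)) ∧ (not sep' ⇛ A M x ∧ B m y ⇔ᵇ A m y ∧ B M x)))
  ∧ ((not (lt m x) ⇛ sep ⇛ not (A M x ∧ B m y))
  ∧ (lt m x ⇛ not (lt m y) ⇛ not (lt M x) ⇛ sep ⇛ A M x ∧ B m y ⇛ sep'))))

-- The same for a step u → z of A in a row that B does not reach.
exchangeTop : {S : Set} → (S → S → Bool) → (A : S → S → Bool) → (B : S → Bool) → Bool → (m M z : S) → Bool
exchangeTop lt A B sep m M z =
  not (lt m z) ⇛ ((not sep ⇛ A M z ∧ B m ⇔ᵇ A m z ∧ B M) ∧ (sep ⇛ not (A M z ∧ B m)))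

pairAt : {S : Set} → (S → S → Bool) → Side → Bool → S → S → S → S → Bool
pairAt lt right t u x b a = pair lt t b a u x
pairAt lt left  t u x b a = pair lt t u x b a

between : {S : Set} → (S → S → Bool) → S → S → S → Bool
between lt p x q = lt p x ∧ lt x q

-- tA and tB are the flags of the pairs formed with A and with B
exchangeMove : {S : Set} → (S → S → Bool) → Side → Bool → Bool → (m M x y b a : S) → Bool
exchangeMove lt s tA tB m M x y b a =
  not (lt b a) ⇛ apart lt b m ⇛ apart lt b M ⇛ lt m M ⇛ lt y x ⇛
    exchange lt (λ u z → pairAt lt s tA u z b a) (λ v z → pairAt lt s tB v z b a)
      ((tA xor tB) ∧ between lt m b M) ((tA xor tB) ∧ between lt y a x) m M x y

exchangeIdle : {S : Set} → (S → S → Bool) → (m M x y b : S) → Bool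
exchangeIdle lt m M x y b =
  apart lt b m ⇛ apart lt b M ⇛ lt m M ⇛ lt y x ⇛
    exchange lt (λ u z → not (closedOpen lt z b u)) (λ v z → not (closedOpen lt z b v)) false false m M x y

exchangeTrivial : {S : Set} → (S → S → Bool) → (m M x y : S) → Bool
exchangeTrivial lt m M x y = exchange lt (λ _ _ → true) (λ _ _ → true) false false m M x y

exchangeTopMove : {S : Set} → (S → S → Bool) → Side → Bool → (m M z b a : S) → Bool
exchangeTopMove lt right t m M z b a =
  not (lt b a) ⇛ apart lt b m ⇛ apart lt b M ⇛ lt m M ⇛
    exchangeTop lt (λ u z → pair lt t b a u z) (λ _ → true) (t ∧ between lt m b M) m M z
exchangeTopMove lt left  t m M z b a =
  not (lt b a) ⇛ apart lt b m ⇛ apart lt b M ⇛ lt m M ⇛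
    exchangeTop lt (λ u z → pair lt t u z b a) (λ v → not (closedOpen lt a v b)) (not t ∧ between lt m b M) m M z

exchangeTopIdle : {S : Set} → (S → S → Bool) → (m M z b : S) → Bool
exchangeTopIdle lt m M z b =
  apart lt b m ⇛ apart lt b M ⇛ lt m M ⇛
    exchangeTop lt (λ u z → not (closedOpen lt z b u)) (λ _ → true) (between lt m b M) m M z

private
  look : ∀ {k} → Comparisons k → Fin k → Fin k → Bool
  look c i j = lookup (lookup c i) j

-- As in `pair`, it says that the left one of two columns is strictly higher. Between equal heights
-- the right column thus counts as the stronger, and the xor of the flags formed with A and with B
-- says that the strength of the third column lies between theirs.
flag : Side → ℕ → ℕ → Bool
flag right h h' = h <ᵇ h'
flag left  h h' = h' <ᵇ h

-- the flags are those of columns A and B of which A is higher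
consistent : Side → Bool → Bool → Bool
consistent right tA tB = tB ⇛ tA
consistent left  tA tB = tA ⇛ tB

flags-consistent : ∀ s h {hA hB} → hB < hA → consistent s (flag s h hA) (flag s h hB) ≡ true
flags-consistent right h {hA} {hB} p with h <ᵇ hB in eq
... | true  = <ᵇ-true (<-trans (<ᵇ-true⁻ {h} {hB} eq) p)
... | false = refl
flags-consistent left  h {hA} {hB} p with hA <ᵇ h in eq
... | true  = <ᵇ-true (<-trans p (<ᵇ-true⁻ {hA} {h} eq))
... | false = refl

-- On each side one of the four combinations of flags is impossible for A higher than B. Each of the
-- others is a finite check over the relative orders of six labels.
exchangeMove-valid : ∀ s tA tB m M x y b a → consistent s tA tB ≡ true →
  exchangeMove _<ᵇ_ s tA tB m M x y b a ≡ true
exchangeMove-valid right true true m M x y b a h = order-tautology 6 (λ c →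
  exchangeMove (look c) right true true 0F 1F 2F 3F 4F 5F) refl (m ∷ M ∷ x ∷ y ∷ b ∷ a ∷ [])
exchangeMove-valid right true false m M x y b a h = order-tautology 6 (λ c →
  exchangeMove (look c) right true false 0F 1F 2F 3F 4F 5F) refl (m ∷ M ∷ x ∷ y ∷ b ∷ a ∷ [])
exchangeMove-valid right false false m M x y b a h = order-tautology 6 (λ c →
  exchangeMove (look c) right false false 0F 1F 2F 3F 4F 5F) refl (m ∷ M ∷ x ∷ y ∷ b ∷ a ∷ [])
exchangeMove-valid left true true m M x y b a h = order-tautology 6 (λ c →
  exchangeMove (look c) left true true 0F 1F 2F 3F 4F 5F) refl (m ∷ M ∷ x ∷ y ∷ b ∷ a ∷ [])
exchangeMove-valid left false true m M x y b a h = order-tautology 6 (λ c →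
  exchangeMove (look c) left false true 0F 1F 2F 3F 4F 5F) refl (m ∷ M ∷ x ∷ y ∷ b ∷ a ∷ [])
exchangeMove-valid left false false m M x y b a h = order-tautology 6 (λ c →
  exchangeMove (look c) left false false 0F 1F 2F 3F 4F 5F) refl (m ∷ M ∷ x ∷ y ∷ b ∷ a ∷ [])

exchangeIdle-valid : ∀ m M x y b → exchangeIdle _<ᵇ_ m M x y b ≡ true
exchangeIdle-valid m M x y b = order-tautology 5 (λ c →
  exchangeIdle (look c) 0F 1F 2F 3F 4F) refl (m ∷ M ∷ x ∷ y ∷ b ∷ [])

exchangeTrivial-valid : ∀ m M x y → exchangeTrivial _<ᵇ_ m M x y ≡ true
exchangeTrivial-valid m M x y = order-tautology 4 (λ c →
  exchangeTrivial (look c) 0F 1F 2F 3F) refl (m ∷ M ∷ x ∷ y ∷ [])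

exchangeTopMove-valid : ∀ s t m M z b a → exchangeTopMove _<ᵇ_ s t m M z b a ≡ true
exchangeTopMove-valid right true m M z b a = order-tautology 5 (λ c →
  exchangeTopMove (look c) right true 0F 1F 2F 3F 4F) refl (m ∷ M ∷ z ∷ b ∷ a ∷ [])
exchangeTopMove-valid right false m M z b a = order-tautology 5 (λ c →
  exchangeTopMove (look c) right false 0F 1F 2F 3F 4F) refl (m ∷ M ∷ z ∷ b ∷ a ∷ [])
exchangeTopMove-valid left true m M z b a = order-tautology 5 (λ c →
  exchangeTopMove (look c) left true 0F 1F 2F 3F 4F) refl (m ∷ M ∷ z ∷ b ∷ a ∷ [])
exchangeTopMove-valid left false m M z b a = order-tautology 5 (λ c →
  exchangeTopMove (look c) left false 0F 1F 2F 3F 4F) refl (m ∷ M ∷ z ∷ b ∷ a ∷ [])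

exchangeTopIdle-valid : ∀ m M z b → exchangeTopIdle _<ᵇ_ m M z b ≡ true
exchangeTopIdle-valid m M z b = order-tautology 4 (λ c →
  exchangeTopIdle (look c) 0F 1F 2F 3F) refl (m ∷ M ∷ z ∷ b ∷ [])

sepCol : ℕ → ℕ → ℕ → ℕ → Side × Col → Bool
sepCol hA hB v u (s , h , b) = (flag s h hA xor flag s h hB) ∧ between _<ᵇ_ v b u

sepNext : ℕ → ℕ → ℕ → ℕ → Side × Cell → Bool
sepNext hA hB v u (s , idle b)     = false
sepNext hA hB v u (s , move h b a) = sepCol hA hB v u (s , h , a)

exchangeAt : ∀ s e {hA hB m M x y} → hB < hA → fit e ≡ true →
  apart _<ᵇ_ (proj₂ (col e)) m ≡ true → apart _<ᵇ_ (proj₂ (col e)) M ≡ true → (m <ᵇ M) ≡ true → (y <ᵇ x) ≡ true →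
  exchange _<ᵇ_ (λ u z → okAt (move hA u z) (s , e)) (λ v z → okAt (move hB v z) (s , e))
    (sepCol (suc hA) (suc hB) m M (s , col e)) (sepNext hA hB y x (s , e)) m M x y ≡ true
exchangeAt right (move h b a) {hA} {hB} {m} {M} {x} {y} p f am aM l l' =
  ⇛-elim (⇛-elim (⇛-elim (⇛-elim (⇛-elim
    (exchangeMove-valid right (h <ᵇ hA) (h <ᵇ hB) m M x y b a (flags-consistent right h p)) f) am) aM) l) l'
exchangeAt left  (move h b a) {hA} {hB} {m} {M} {x} {y} p f am aM l l' =
  ⇛-elim (⇛-elim (⇛-elim (⇛-elim (⇛-elim
    (exchangeMove-valid left (hA <ᵇ h) (hB <ᵇ h) m M x y b a (flags-consistent left h p)) f) am) aM) l) l'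
exchangeAt right (idle b) {hA} {hB} {m} {M} {x} {y} p f am aM l l' =
  ⇛-elim (⇛-elim (⇛-elim (⇛-elim (exchangeIdle-valid m M x y b) am) aM) l) l'
exchangeAt left  (idle b) {hA} {hB} {m} {M} {x} {y} p f am aM l l' = exchangeTrivial-valid m M x y

exchangeTopAt : ∀ s e {hA m M z} → fit e ≡ true →
  apart _<ᵇ_ (proj₂ (col e)) m ≡ true → apart _<ᵇ_ (proj₂ (col e)) M ≡ true → (m <ᵇ M) ≡ true →
  exchangeTop _<ᵇ_ (λ u z → okAt (move hA u z) (s , e)) (λ v → okAt (idle v) (s , e))
    (sepCol (suc hA) 0 m M (s , col e)) m M z ≡ true
exchangeTopAt right (move h b a) {hA} {m} {M} {z} f am aM l
  with h <ᵇ hA | exchangeTopMove-valid right (h <ᵇ hA) m M z b a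
... | true  | v = ⇛-elim (⇛-elim (⇛-elim (⇛-elim v f) am) aM) l
... | false | v = ⇛-elim (⇛-elim (⇛-elim (⇛-elim v f) am) aM) l
exchangeTopAt left  (move h b a) {hA} {m} {M} {z} f am aM l
  with hA <ᵇ h | exchangeTopMove-valid left (hA <ᵇ h) m M z b a
... | true  | v = ⇛-elim (⇛-elim (⇛-elim (⇛-elim v f) am) aM) l
... | false | v = ⇛-elim (⇛-elim (⇛-elim (⇛-elim v f) am) aM) l
exchangeTopAt right (idle b) {hA} {m} {M} {z} f am aM l =
  ⇛-elim (⇛-elim (⇛-elim (exchangeTopIdle-valid m M z b) am) aM) l
exchangeTopAt left  (idle b) {hA} {m} {M} {z} f am aM l with M <ᵇ z | m <ᵇ z
... | _ | true  = refl
... | _ | false = refl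

-- The conjuncts of `exchange` as rules. In the `low` rules x ≤ m, so descent allows either letter
-- in either column; in the `mid` rules y ≤ m < x ≤ M, so only the column labelled M can take x.
record Exchange (A B : ℕ → ℕ → Bool) (sep sep' : Bool) (m M x y : ℕ) : Set where
  constructor mkExchange
  field
    valid : exchange _<ᵇ_ A B sep sep' m M x y ≡ true

  private
    lt = _<ᵇ_
    E  = valid
    E₂ = proj₂ (∧-elim {not (lt m x) ⇛ ((sep' ⇛ not (A m y ∧ B M x)) ∧ (not sep' ⇛ A m y ∧ B M x ⇔ᵇ A m x ∧ B M y))} E)
    E₃ = proj₂ (∧-elim {not (lt m x) ⇛ not sep ⇛ (A M x ∧ B m y ⇔ᵇ A m x ∧ B M y)} E₂)
    E₄ = proj₂ (∧-elim {not (lt m y) ⇛ lt m x ⇛ not (lt M x) ⇛ not sep ⇛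
        ((sep' ⇛ not (A m y ∧ B M x)) ∧ (not sep' ⇛ A M x ∧ B m y ⇔ᵇ A m y ∧ B M x))} E₃)

  low-sep' : (m <ᵇ x) ≡ false → sep' ≡ true → A m y ∧ B M x ≡ false
  low-sep' p s = not-elim (⇛-elim (proj₁ (∧-elim (⇛-elim (proj₁ (∧-elim E)) (not-intro p)))) s)

  low-nosep' : (m <ᵇ x) ≡ false → sep' ≡ false → A m y ∧ B M x ≡ A m x ∧ B M y
  low-nosep' p s = ⇔ᵇ-elim (⇛-elim (proj₂ (∧-elim {sep' ⇛ not (A m y ∧ B M x)} (⇛-elim (proj₁ (∧-elim E)) (not-intro p)))) (not-intro s))

  low-nosep : (m <ᵇ x) ≡ false → sep ≡ false → A M x ∧ B m y ≡ A m x ∧ B M y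
  low-nosep p s = ⇔ᵇ-elim (⇛-elim (⇛-elim (proj₁ (∧-elim E₂)) (not-intro p)) (not-intro s))

  mid-sep' : (m <ᵇ y) ≡ false → (m <ᵇ x) ≡ true → (M <ᵇ x) ≡ false → sep ≡ false → sep' ≡ true → A m y ∧ B M x ≡ false
  mid-sep' p q r s s' = not-elim (⇛-elim (proj₁ (∧-elim (⇛-elim (⇛-elim (⇛-elim (⇛-elim (proj₁ (∧-elim E₃)) (not-intro p)) q) (not-intro r)) (not-intro s)))) s')

  mid-nosep' : (m <ᵇ y) ≡ false → (m <ᵇ x) ≡ true → (M <ᵇ x) ≡ false → sep ≡ false → sep' ≡ false → A M x ∧ B m y ≡ A m y ∧ B M x
  mid-nosep' p q r s s' = ⇔ᵇ-elim (⇛-elim (proj₂ (∧-elim {sep' ⇛ not (A m y ∧ B M x)} (⇛-elim (⇛-elim (⇛-elim (⇛-elim (proj₁ (∧-elim E₃)) (not-intro p)) q) (not-intro r)) (not-intro s)))) (not-intro s'))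

  low-sep : (m <ᵇ x) ≡ false → sep ≡ true → A M x ∧ B m y ≡ false
  low-sep p s = not-elim (⇛-elim (⇛-elim (proj₁ (∧-elim E₄)) (not-intro p)) s)

  mid-sep : (m <ᵇ y) ≡ false → (m <ᵇ x) ≡ true → (M <ᵇ x) ≡ false → sep ≡ true → A M x ∧ B m y ≡ true → sep' ≡ true
  mid-sep p q r s t = ⇛-elim (⇛-elim (⇛-elim (⇛-elim (⇛-elim (proj₂ (∧-elim {not (lt m x) ⇛ sep ⇛ not (A M x ∧ B m y)} E₄)) q) (not-intro p)) (not-intro r)) s) t

record ExchangeTop (A : ℕ → ℕ → Bool) (B : ℕ → Bool) (sep : Bool) (m M z : ℕ) : Set where
  constructor mkExchangeTop
  field
    valid : exchangeTop _<ᵇ_ A B sep m M z ≡ true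

  top-nosep : (m <ᵇ z) ≡ false → sep ≡ false → A M z ∧ B m ≡ A m z ∧ B M
  top-nosep p s = ⇔ᵇ-elim (⇛-elim (proj₁ (∧-elim (⇛-elim valid (not-intro p)))) (not-intro s))

  top-sep : (m <ᵇ z) ≡ false → sep ≡ true → A M z ∧ B m ≡ false
  top-sep p s = not-elim (⇛-elim (proj₂ (∧-elim {not sep ⇛ A M z ∧ B m ⇔ᵇ A m z ∧ B M} (⇛-elim valid (not-intro p)))) s)

any-all : ∀ {S : Set} {P Q R : S → Set} {xs} → (∀ {x} → P x → Q x → R x) → All P xs → Any Q xs → Any R xs
any-all f (p ∷ ps) (here q)  = here (f p q)
any-all f (p ∷ ps) (there q) = there (any-all f ps q)

all-all : ∀ {S : Set} {P Q R : S → Set} {xs} → (∀ {x} → P x → Q x → R x) → All P xs → All Q xs → All R xs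
all-all f ps qs = All.zipWith (λ (p , q) → f p q) (ps , qs)

Apart : ℕ → Side × Col → Set
Apart u (s , h , b) = apart _<ᵇ_ b u ≡ true

okRow-fit : ∀ r → okRow r ≡ true → All (λ e → fit e ≡ true) r
okRow-fit []      h = []
okRow-fit (x ∷ r) h = proj₁ (∧-elim h) ∷ okRow-fit r (proj₂ (∧-elim {all (ok x) r} (proj₂ (∧-elim {fit x} h))))

All-tag : ∀ {S : Set} {P : S → Set} r {l} → All P (r ++ l) → All (λ (s , e) → P e) (tag r l)
All-tag []      h       = All-map⁺ h
All-tag (x ∷ r) (p ∷ h) = p ∷ All-tag r h

tag-map : ∀ {S T : Set} (f : S → T) r l → map (λ (s , e) → s , f e) (tag r l) ≡ tag (map f r) (map f l)
tag-map f []      []      = refl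
tag-map f []      (x ∷ l) = cong (_ ∷_) (tag-map f [] l)
tag-map f (x ∷ r) l       = cong (_ ∷_) (tag-map f r l)

All-next : ∀ (P : Side × Col → Set) {Q : Side × Cell → Set} → (∀ {s h b a} → Q (s , move h b a) → P (s , h , a)) →
  ∀ r l → All Q (tag r l) → All P (tag (next r) (next l))
All-next P f [] []                     q       = []
All-next P f [] (idle b ∷ l)           (q ∷ h) = All-next P f [] l h
All-next P f [] (move _ _ _ ∷ l)       (q ∷ h) = f q ∷ All-next P f [] l h
All-next P f (idle b ∷ r) l            (q ∷ h) = All-next P f r l h
All-next P f (move _ _ _ ∷ r) l        (q ∷ h) = f q ∷ All-next P f r l h

Any-next : ∀ (P : Side × Col → Set) {Q : Side × Cell → Set} → (∀ {s h b a} → Q (s , move h b a) → P (s , h , a)) →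
  (∀ {s b} → Q (s , idle b) → Any P []) →
  ∀ r l → Any Q (tag r l) → Any P (tag (next r) (next l))
Any-next P f g [] (idle b ∷ l)     (here q) with () ← g q
Any-next P f g [] (idle b ∷ l)     (there h) = Any-next P f g [] l h
Any-next P f g [] (move _ _ _ ∷ l) (here q)  = here (f q)
Any-next P f g [] (move _ _ _ ∷ l) (there h) = there (Any-next P f g [] l h)
Any-next P f g (idle b ∷ r) l      (here q) with () ← g q
Any-next P f g (idle b ∷ r) l      (there h) = Any-next P f g r l h
Any-next P f g (move _ _ _ ∷ r) l  (here q)  = here (f q)
Any-next P f g (move _ _ _ ∷ r) l  (there h) = there (Any-next P f g r l h)

-- Letters in one row are distinct, which supplies the apartness that the laws for the next row ask
-- of A, of B and of every third column.
side-apart : ∀ r l {h u a} → side r l (move h u a) ≡ true → All (Apart a) (tag (next r) (next l))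
side-apart r l {h} {u} {a} p =
  All-next (Apart a) {λ se → okAt (move h u a) se ≡ true} (λ {s} → from s) r l
    (all-true⁻ (tag r l) (proj₂ (∧-elim {fit (move h u a)} p)))
  where
  from : ∀ s {h' b a'} → okAt (move h u a) (s , move h' b a') ≡ true → apart _<ᵇ_ a' a ≡ true
  from right q = proj₁ (∧-elim q)
  from left {a' = a'} q = trans (∨-comm (a' <ᵇ a) (a <ᵇ a')) (proj₁ (∧-elim q))

≤⇒≮ᵇ : ∀ {x m n} → (m <ᵇ x) ≡ false → m ≤ n → (n <ᵇ x) ≡ false
≤⇒≮ᵇ {x} {m} {n} p q = <ᵇ-false (≤-trans (<ᵇ-false⁻ {m} {x} p) q)

<ᵇ-≮ᵇ : ∀ {m x y} → (m <ᵇ x) ≡ false → (y <ᵇ x) ≡ true → (m <ᵇ y) ≡ false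
<ᵇ-≮ᵇ {m} {x} {y} p q = <ᵇ-false (≤-trans (<⇒≤ (<ᵇ-true⁻ {y} {x} q)) (<ᵇ-false⁻ {m} {x} p))

sides : ℕ → ℕ → List Cell → List Cell → (u a v b : ℕ) → Bool
sides hA hB r l u a v b = side r l (move hA u a) ∧ side r l (move hB v b)

-- A and B have labels m < M (in either order) before and y < x after the step.
module _ {hA hB m M x y : ℕ} (r l : List Cell)
         (E : All (λ se → Exchange (λ u z → okAt (move hA u z) se) (λ v z → okAt (move hB v z) se)
                    (sepCol (suc hA) (suc hB) m M (proj₁ se , col (proj₂ se))) (sepNext hA hB y x se) m M x y)
                  (tag r l))
         (m<M : (m <ᵇ M) ≡ true) (y<x : (y <ᵇ x) ≡ true) where

  private
    ctx = tag r l

    one : Side × Cell → (u a v b : ℕ) → Bool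
    one se u a v b = okAt (move hA u a) se ∧ okAt (move hB v b) se

    split : ∀ u a v b → sides hA hB r l u a v b ≡
      (not (u <ᵇ a) ∧ not (v <ᵇ b)) ∧ all (λ se → one se u a v b) ctx
    split u a v b = trans
      (solve 4 (λ a b c d → (a :* b) :* (c :* d) := (a :* c) :* (b :* d)) refl
        (not (u <ᵇ a)) (all (okAt (move hA u a)) ctx) (not (v <ᵇ b)) (all (okAt (move hB v b)) ctx))
      (cong ((not (u <ᵇ a) ∧ not (v <ᵇ b)) ∧_) (all-∧ (okAt (move hA u a)) (okAt (move hB v b)) ctx))
      where open ∨-∧-Solver

    same : ∀ u a v b u' a' v' b' → not (u <ᵇ a) ∧ not (v <ᵇ b) ≡ not (u' <ᵇ a') ∧ not (v' <ᵇ b') →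
      All (λ se → one se u a v b ≡ one se u' a' v' b') ctx → sides hA hB r l u a v b ≡ sides hA hB r l u' a' v' b'
    same u a v b u' a' v' b' p h = trans (split u a v b) (trans (cong₂ _∧_ p (all-cong h)) (sym (split u' a' v' b')))

    none : ∀ u a v b → Any (λ se → one se u a v b ≡ false) ctx → sides hA hB r l u a v b ≡ false
    none u a v b h = trans (split u a v b) (trans (cong ((not (u <ᵇ a) ∧ not (v <ᵇ b)) ∧_) (all-false h)) (∧-zeroʳ _))

    m≤M = <⇒≤ (<ᵇ-true⁻ {m} {M} m<M)

    fits : (m <ᵇ x) ≡ false → ((m <ᵇ y) ≡ false) × ((M <ᵇ x) ≡ false) × ((M <ᵇ y) ≡ false)
    fits p = <ᵇ-≮ᵇ {m} {x} {y} p y<x , ≤⇒≮ᵇ {x} {m} {M} p m≤M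
           , <ᵇ-≮ᵇ {M} {x} {y} (≤⇒≮ᵇ {x} {m} {M} p m≤M) y<x

    K = sides hA hB r l
    open Exchange

  -- A product of conditions vanishes as soon as one third column violates its own, whereas two
  -- products agree if they agree at each third column. This is why separation is an `Any` and its
  -- absence an `All`.
  Sep Sep' NoSep NoSep' : Set
  Sep    = Any (λ se → sepCol (suc hA) (suc hB) m M (proj₁ se , col (proj₂ se)) ≡ true) ctx
  NoSep  = All (λ se → sepCol (suc hA) (suc hB) m M (proj₁ se , col (proj₂ se)) ≡ false) ctx
  Sep'   = Any (λ se → sepNext hA hB y x se ≡ true) ctx
  NoSep' = All (λ se → sepNext hA hB y x se ≡ false) ctx

  sides-low-sep' : (m <ᵇ x) ≡ false → Sep' → K m y M x ≡ false
  sides-low-sep' p s = none m y M x (any-all (λ e → low-sep' e p) E s)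

  sides-low-nosep' : (m <ᵇ x) ≡ false → NoSep' → K m y M x ≡ K m x M y
  sides-low-nosep' p s = same m y M x m x M y fitted (all-all (λ e → low-nosep' e p) E s)
    where
    fitted : not (m <ᵇ y) ∧ not (M <ᵇ x) ≡ not (m <ᵇ x) ∧ not (M <ᵇ y)
    fitted with q , s , t ← fits p rewrite p | q | s | t = refl

  sides-low-nosep : (m <ᵇ x) ≡ false → NoSep → K M x m y ≡ K m x M y
  sides-low-nosep p s = same M x m y m x M y fitted (all-all (λ e → low-nosep e p) E s)
    where
    fitted : not (M <ᵇ x) ∧ not (m <ᵇ y) ≡ not (m <ᵇ x) ∧ not (M <ᵇ y)
    fitted with q , s , t ← fits p rewrite p | q | s | t = refl

  sides-low-sep : (m <ᵇ x) ≡ false → Sep → K M x m y ≡ false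
  sides-low-sep p s = none M x m y (any-all (λ e → low-sep e p) E s)

  sides-mid-sep' : (m <ᵇ x) ≡ true → NoSep → Sep' → K m y M x ≡ false
  sides-mid-sep' q s s' = trans (split m y M x) main
    where
    main : (not (m <ᵇ y) ∧ not (M <ᵇ x)) ∧ all (λ se → one se m y M x) ctx ≡ false
    main with m <ᵇ y in p | M <ᵇ x in t
    ... | true  | _     = refl
    ... | false | true  = refl
    ... | false | false = all-false (any-all (λ f s' → f s') (all-all (λ e s → mid-sep' e p q t s) E s) s')

  sides-mid-nosep' : (m <ᵇ x) ≡ true → NoSep → NoSep' → K M x m y ≡ K m y M x
  sides-mid-nosep' q s s' = trans (split M x m y) (trans main (sym (split m y M x)))
    where
    main : (not (M <ᵇ x) ∧ not (m <ᵇ y)) ∧ all (λ se → one se M x m y) ctx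
         ≡ (not (m <ᵇ y) ∧ not (M <ᵇ x)) ∧ all (λ se → one se m y M x) ctx
    main with m <ᵇ y in p | M <ᵇ x in t
    ... | true  | true  = refl
    ... | true  | false = refl
    ... | false | true  = refl
    ... | false | false = all-cong (all-all (λ f s' → f s') (all-all (λ e s → mid-nosep' e p q t s) E s) s')

  -- A separator that tolerates the steps M → x and m → y has its new label between y and x again,
  -- so separation is inherited by the next row.
  sides-mid-sep : (m <ᵇ x) ≡ true → Sep → K M x m y ≡ true → Sep'
  sides-mid-sep q s h with ∧-elim {not (M <ᵇ x) ∧ not (m <ᵇ y)} (trans (sym (split M x m y)) h)
  ... | f , g with ∧-elim {not (M <ᵇ x)} f
  ... | t , p = any-all (λ f s → f s)
    (all-all (λ e t' s → mid-sep e (not-elim p) q (not-elim t) s t') E (all-true⁻ ctx g)) s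

  sides-low⁻ : (m <ᵇ x) ≡ true → K m x M y ≡ false
  sides-low⁻ q rewrite q = refl

-- The three exchange laws.

truth : ∀ b → b ≡ true ⊎ b ≡ false
truth true  = inj₁ refl
truth false = inj₂ refl

-- P₁ has A (height hA, label u) to the right of B (height hB, label v), P₂ to the left.
P₁ P₂ : ∀ {n} → List ℕ → ℕ → List Col → List Col → (hA hB u v : ℕ) → Poly n
P₁ A k R L hA hB u v = G A k (R ++ (hA , u) ∷ (hB , v) ∷ L)
P₂ A k R L hA hB u v = G A k (R ++ (hB , v) ∷ (hA , u) ∷ L)

-- Given the letters of all rows, a filling of P₁ is determined by the rows of
-- {A , B}, whereas in P₂ the columns A and B may still choose their last crossing.
-- This choice is what the sum in the third law accounts for; a column that
-- separates A from B does so in all higher rows and makes it disappear.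
record SwapLaws (n : ℕ) (A : List ℕ) (k : ℕ) (R L : List Col) (hA hB u v : ℕ) : Set where
  field
    ordered     : (u <ᵇ v) ≡ true → P₂ {n} A k R L hA hB u v ≐ P₁ A k R L hA hB u v
    separated   : (v <ᵇ u) ≡ true → Any (λ c → sepCol hA hB v u c ≡ true) (tag R L) →
                  P₂ {n} A k R L hA hB u v ≐ P₁ A k R L hA hB u v
    unseparated : (v <ᵇ u) ≡ true → All (λ c → sepCol hA hB v u c ≡ false) (tag R L) →
                  ∀ (e : Vec ℕ n) → P₂ A k R L hA hB u v e + P₁ A k R L hA hB v u e ≡ P₁ A k R L hA hB u v e

open SwapLaws

module _ {hA hB : ℕ} (m M x y : ℕ) (hB<hA : hB < hA) (m<M : (m <ᵇ M) ≡ true) (y<x : (y <ᵇ x) ≡ true) where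
  private
    fB : (hB <ᵇ hA) ≡ true
    fB = <ᵇ-true hB<hA

    fA : (hA <ᵇ hB) ≡ false
    fA = <ᵇ-false (<⇒≤ hB<hA)

    v : Vec ℕ 4
    v = m ∷ M ∷ x ∷ y ∷ []

  -- In these names the subscript is that of `P₁` or `P₂`, followed by label and letter of A and
  -- then label and letter of B. The value is the test that A and B impose on each other, as a
  -- comparison of one label with one letter.
  ok₂-mxMy : ok (move hB M y) (move hA m x) ≡ true
  ok₂-mxMy rewrite fB = ⇛-elim (⇛-elim (order-tautology 4 (λ c → look c 0F 1F ⇛ look c 3F 2F ⇛ pair (look c) true 1F 3F 0F 2F) refl v) m<M) y<x

  ok₂-myMx : ok (move hB M x) (move hA m y) ≡ true
  ok₂-myMx rewrite fB = ⇛-elim (⇛-elim (order-tautology 4 (λ c → look c 0F 1F ⇛ look c 3F 2F ⇛ pair (look c) true 1F 2F 0F 3F) refl v) m<M) y<x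

  ok₁-mxMy : ok (move hA m x) (move hB M y) ≡ true
  ok₁-mxMy rewrite fA = ⇛-elim (⇛-elim (order-tautology 4 (λ c → look c 0F 1F ⇛ look c 3F 2F ⇛ pair (look c) false 0F 2F 1F 3F) refl v) m<M) y<x

  ok₁-myMx : ok (move hA m y) (move hB M x) ≡ (m <ᵇ x)
  ok₁-myMx rewrite fA = ⇔ᵇ-elim (⇛-elim (⇛-elim (order-tautology 4 (λ c → look c 0F 1F ⇛ look c 3F 2F ⇛ (pair (look c) false 0F 3F 1F 2F ⇔ᵇ look c 0F 2F)) refl v) m<M) y<x)

  ok₂-Mxmy : ok (move hB m y) (move hA M x) ≡ (m <ᵇ x)
  ok₂-Mxmy rewrite fB = ⇔ᵇ-elim (⇛-elim (⇛-elim (order-tautology 4 (λ c → look c 0F 1F ⇛ look c 3F 2F ⇛ (pair (look c) true 0F 3F 1F 2F ⇔ᵇ look c 0F 2F)) refl v) m<M) y<x)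

  ok₂-Mymx : ok (move hB m x) (move hA M y) ≡ (m <ᵇ y)
  ok₂-Mymx rewrite fB = ⇔ᵇ-elim (⇛-elim (⇛-elim (order-tautology 4 (λ c → look c 0F 1F ⇛ look c 3F 2F ⇛ (pair (look c) true 0F 2F 1F 3F ⇔ᵇ look c 0F 3F)) refl v) m<M) y<x)

  ok₁-Mxmy : ok (move hA M x) (move hB m y) ≡ true
  ok₁-Mxmy rewrite fA = ⇛-elim (⇛-elim (order-tautology 4 (λ c → look c 0F 1F ⇛ look c 3F 2F ⇛ pair (look c) false 1F 2F 0F 3F) refl v) m<M) y<x

  ok₁-Mymx : ok (move hA M y) (move hB m x) ≡ (M <ᵇ x)
  ok₁-Mymx rewrite fA = ⇔ᵇ-elim (⇛-elim (⇛-elim (order-tautology 4 (λ c → look c 0F 1F ⇛ look c 3F 2F ⇛ (pair (look c) false 1F 3F 0F 2F ⇔ᵇ look c 1F 2F)) refl v) m<M) y<x)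

module _ {n : ℕ} (A : List ℕ) (k hA hB : ℕ) (r l : List Cell) (e : Vec ℕ n) where
  Y : ℕ → ℕ → Poly n → ℤ
  Y a b f = X* (letters r ++ a ∷ b ∷ letters l) f e

  y₁ y₂ : ℕ → ℕ → ℤ
  y₁ a b = Y a b (P₁ A k (next r) (next l) hA hB a b)
  y₂ a b = Y a b (P₂ A k (next r) (next l) hA hB a b)

  Y-swap : ∀ a b f → Y b a f ≡ Y a b f
  Y-swap a b f = X*-↭ f (↭-++⁺ˡ (letters r) (swap b a refl)) e

  t₁ t₂ : (u v a b : ℕ) → ℤ
  t₁ u v a b = sides hA hB r l u a v b ∧ ok (move hA u a) (move hB v b) ▹ y₁ a b
  t₂ u v a b = sides hA hB r l u a v b ∧ ok (move hB v b) (move hA u a) ▹ y₂ a b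

module _ {n : ℕ} (A : List ℕ) (k hA hB : ℕ) (r l : List Cell) (e : Vec ℕ n)
         (hB<hA : hB < hA) (base : okRow (r ++ l) ≡ true)
         (ih : ∀ a b → All (Apart a) (tag (next r) (next l)) → All (Apart b) (tag (next r) (next l)) →
               SwapLaws n A k (next r) (next l) hA hB a b)
         {m M : ℕ} (m<M : (m <ᵇ M) ≡ true)
         (am : All (Apart m) (tag (map col r) (map col l))) (aM : All (Apart M) (tag (map col r) (map col l))) where

  private
    K  = sides hA hB r l
    Z₁ = y₁ A k hA hB r l e
    Z₂ = y₂ A k hA hB r l e

    apart-cells : ∀ {u} → All (Apart u) (tag (map col r) (map col l)) →
      All (λ se → Apart u (proj₁ se , col (proj₂ se))) (tag r l)
    apart-cells {u} h = All-map⁻ (subst (All (Apart u)) (sym (tag-map col r l)) h)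

    E : ∀ x y → (y <ᵇ x) ≡ true →
        All (λ se → Exchange (λ u z → okAt (move hA u z) se) (λ v z → okAt (move hB v z) se)
                    (sepCol (suc hA) (suc hB) m M (proj₁ se , col (proj₂ se))) (sepNext hA hB y x se) m M x y)
            (tag r l)
    E x y y<x = all-all (λ {se} f (a , b) → mkExchange (exchangeAt (proj₁ se) (proj₂ se) {hA} {hB} {m} {M} {x} {y} hB<hA f a b m<M y<x))
              (All-tag r (okRow-fit (r ++ l) base)) (All.zip (apart-cells am , apart-cells aM))

    law : ∀ u v {a b} → K u a v b ≡ true → SwapLaws n A k (next r) (next l) hA hB a b
    law u v {a} {b} h with ∧-elim {side r l (move hA u a)} h
    ... | p , q = ih a b (side-apart r l p) (side-apart r l q)

    sep-next : ∀ {y x} → Any (λ se → sepNext hA hB y x se ≡ true) (tag r l) →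
      Any (λ c → sepCol hA hB y x c ≡ true) (tag (next r) (next l))
    sep-next {y} {x} = Any-next (λ c → sepCol hA hB y x c ≡ true) (λ q → q) (λ ()) r l

    nosep-next : ∀ {y x} → All (λ se → sepNext hA hB y x se ≡ false) (tag r l) →
      All (λ c → sepCol hA hB y x c ≡ false) (tag (next r) (next l))
    nosep-next {y} {x} = All-next (λ c → sepCol hA hB y x c ≡ false) (λ q → q) r l

    ordered-Y : ∀ u v {x y} → (y <ᵇ x) ≡ true → (K u y v x ▹ Z₂ y x) ≡ (K u y v x ▹ Z₁ y x)
    ordered-Y u v {x} {y} p with K u y v x in eq
    ... | false = refl
    ... | true  = X*-cong (letters r ++ y ∷ x ∷ letters l) (ordered (law u v eq) p) e

    separated-Y : ∀ u v {x y} → (y <ᵇ x) ≡ true → Any (λ se → sepNext hA hB y x se ≡ true) (tag r l) →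
      (K u x v y ▹ Z₂ x y) ≡ (K u x v y ▹ Z₁ x y)
    separated-Y u v {x} {y} p s with K u x v y in eq
    ... | false = refl
    ... | true  = X*-cong (letters r ++ x ∷ y ∷ letters l) (separated (law u v eq) p (sep-next {y} {x} s)) e

    unseparated-Y : ∀ u v {x y} → (y <ᵇ x) ≡ true → All (λ se → sepNext hA hB y x se ≡ false) (tag r l) →
      (K u x v y ▹ Z₂ x y) + (K u x v y ▹ Z₁ y x) ≡ (K u x v y ▹ Z₁ x y)
    unseparated-Y u v {x} {y} p s with K u x v y in eq
    ... | false = refl
    ... | true  = begin
      Z₂ x y + Z₁ y x ≡⟨ cong (_+_ (Z₂ x y)) (Y-swap A k hA hB r l e x y (P₁ A k (next r) (next l) hA hB y x)) ⟩
      Z₂ x y + X* (letters r ++ x ∷ y ∷ letters l) (P₁ A k (next r) (next l) hA hB y x) e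
        ≡⟨ sym (X*-+ (letters r ++ x ∷ y ∷ letters l) _ _ e) ⟩
      X* (letters r ++ x ∷ y ∷ letters l) (λ e → P₂ A k (next r) (next l) hA hB x y e + P₁ A k (next r) (next l) hA hB y x e) e
        ≡⟨ X*-cong (letters r ++ x ∷ y ∷ letters l) (unseparated (law u v eq) p (nosep-next {y} {x} s)) e ⟩
      Z₁ x y ∎
      where open ≡-Reasoning

    T₁ = t₁ A k hA hB r l e
    T₂ = t₂ A k hA hB r l e

    drop₁ : ∀ u v a b → ok (move hA u a) (move hB v b) ≡ true → T₁ u v a b ≡ (K u a v b ▹ Z₁ a b)
    drop₁ u v a b h = cong (_▹ Z₁ a b) (trans (cong (K u a v b ∧_) h) (∧-identityʳ (K u a v b)))

    drop₂ : ∀ u v a b → ok (move hB v b) (move hA u a) ≡ true → T₂ u v a b ≡ (K u a v b ▹ Z₂ a b)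
    drop₂ u v a b h = cong (_▹ Z₂ a b) (trans (cong (K u a v b ∧_) h) (∧-identityʳ (K u a v b)))

    kill₁ : ∀ u v a b → ok (move hA u a) (move hB v b) ≡ false → T₁ u v a b ≡ 0ℤ
    kill₁ u v a b h = cong (_▹ Z₁ a b) (trans (cong (K u a v b ∧_) h) (∧-zeroʳ (K u a v b)))

    kill₂ : ∀ u v a b → ok (move hB v b) (move hA u a) ≡ false → T₂ u v a b ≡ 0ℤ
    kill₂ u v a b h = cong (_▹ Z₂ a b) (trans (cong (K u a v b ∧_) h) (∧-zeroʳ (K u a v b)))

  -- If m < x, only B can take x, in either order of the columns, and the new labels y < x of A and
  -- B are ordered again. If x ≤ m, A on the left admits both distributions of x and y, while A on
  -- the right admits only the one with x in A. The extra distribution is killed by a separator;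
  -- without one it is absorbed by the third law.
  core-ordered : ∀ {x y} → (y <ᵇ x) ≡ true → T₂ m M x y + T₂ m M y x ≡ T₁ m M x y + T₁ m M y x
  core-ordered {x} {y} y<x with truth (m <ᵇ x)
  ... | inj₁ p = cong₂ _+_
        (trans (cong (λ b → b ∧ ok (move hB M y) (move hA m x) ▹ Z₂ x y) K₂) (sym (cong (λ b → b ∧ ok (move hA m x) (move hB M y) ▹ Z₁ x y) K₂)))
        (trans (drop₂ m M y x (ok₂-myMx m M x y hB<hA m<M y<x)) (trans (ordered-Y m M {x} {y} y<x)
               (sym (drop₁ m M y x (trans (ok₁-myMx m M x y hB<hA m<M y<x) p)))))
    where K₂ = sides-low⁻ r l (E x y y<x) m<M y<x p
  ... | inj₂ p = trans (cong₂ _+_ (drop₂ m M x y (ok₂-mxMy m M x y hB<hA m<M y<x)) (drop₂ m M y x (ok₂-myMx m M x y hB<hA m<M y<x)))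
               (trans (main (search (sepNext hA hB y x) (tag r l)))
               (sym (cong₂ _+_ (drop₁ m M x y (ok₁-mxMy m M x y hB<hA m<M y<x)) (kill₁ m M y x (trans (ok₁-myMx m M x y hB<hA m<M y<x) p)))))
    where
    main : _ → (K m x M y ▹ Z₂ x y) + (K m y M x ▹ Z₂ y x) ≡ (K m x M y ▹ Z₁ x y) + 0ℤ
    main (inj₁ s) = cong₂ _+_ (separated-Y m M {x} {y} y<x s)
                      (cong (_▹ Z₂ y x) (sides-low-sep' r l (E x y y<x) m<M y<x p s))
    -- In the extra distribution the new labels are ordered, so there `P₂` becomes `P₁` by the first
    -- law; this is the summand that the third law asks for.
    main (inj₂ s) = begin
      (K m x M y ▹ Z₂ x y) + (K m y M x ▹ Z₂ y x) ≡⟨ cong (_+_ (K m x M y ▹ Z₂ x y)) (ordered-Y m M {x} {y} y<x) ⟩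
      (K m x M y ▹ Z₂ x y) + (K m y M x ▹ Z₁ y x)
        ≡⟨ cong (λ b → (K m x M y ▹ Z₂ x y) + (b ▹ Z₁ y x)) (sides-low-nosep' r l (E x y y<x) m<M y<x p s) ⟩
      (K m x M y ▹ Z₂ x y) + (K m x M y ▹ Z₁ y x) ≡⟨ unseparated-Y m M {x} {y} y<x s ⟩
      (K m x M y ▹ Z₁ x y)                        ≡⟨ sym (+-identityʳ _) ⟩
      (K m x M y ▹ Z₁ x y) + 0ℤ ∎
      where open ≡-Reasoning

  private
    other₂ : ∀ {x y} → (y <ᵇ x) ≡ true → T₂ M m y x ≡ 0ℤ
    other₂ {x} {y} y<x with truth (m <ᵇ x)
    ... | inj₁ p = cong (λ b → b ∧ ok (move hB m x) (move hA M y) ▹ Z₂ y x)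
                    (trans (cong (λ b → side r l (move hA M y) ∧ (not b ∧ all (okAt (move hB m x)) (tag r l))) p) (∧-zeroʳ (side r l (move hA M y))))
    ... | inj₂ p = kill₂ M m y x (trans (ok₂-Mymx m M x y hB<hA m<M y<x) (<ᵇ-≮ᵇ {m} {x} {y} p y<x))

    other₁ : ∀ {x y} → (y <ᵇ x) ≡ true → T₁ M m y x ≡ 0ℤ
    other₁ {x} {y} y<x with truth (m <ᵇ x)
    ... | inj₁ p = cong (λ b → b ∧ ok (move hA M y) (move hB m x) ▹ Z₁ y x)
                    (trans (cong (λ b → side r l (move hA M y) ∧ (not b ∧ all (okAt (move hB m x)) (tag r l))) p) (∧-zeroʳ (side r l (move hA M y))))
    ... | inj₂ p = kill₁ M m y x (trans (ok₁-Mymx m M x y hB<hA m<M y<x) (≤⇒≮ᵇ {x} {m} {M} p (<⇒≤ (<ᵇ-true⁻ {m} {M} m<M))))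

  -- With the larger label on A, the letter x must go to A in both orders: B cannot take it for m <
  -- x, and the pair test excludes it for x ≤ m. When A has taken x, for x ≤ m both sides vanish,
  -- `P₂` by the pair test and `P₁` by the separator; for m < x the separator survives and the
  -- second law applies above.
  core-separated : ∀ {x y} → (y <ᵇ x) ≡ true →
    Any (λ c → sepCol (suc hA) (suc hB) m M c ≡ true) (tag (map col r) (map col l)) →
    T₂ M m x y + T₂ M m y x ≡ T₁ M m x y + T₁ M m y x
  core-separated {x} {y} y<x s₀ = cong₂ _+_ main (trans (other₂ {x} {y} y<x) (sym (other₁ {x} {y} y<x)))
    where
    s : Any (λ se → sepCol (suc hA) (suc hB) m M (proj₁ se , col (proj₂ se)) ≡ true) (tag r l)
    s = Any-map⁻ (subst (Any _) (sym (tag-map col r l)) s₀)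
    main : T₂ M m x y ≡ T₁ M m x y
    main with truth (m <ᵇ x)
    ... | inj₂ p = trans (kill₂ M m x y (trans (ok₂-Mxmy m M x y hB<hA m<M y<x) p))
                        (sym (cong (λ b → b ∧ ok (move hA M x) (move hB m y) ▹ Z₁ x y) (sides-low-sep r l (E x y y<x) m<M y<x p s)))
    ... | inj₁ p = trans (drop₂ M m x y (trans (ok₂-Mxmy m M x y hB<hA m<M y<x) p))
                 (trans eq (sym (drop₁ M m x y (ok₁-Mxmy m M x y hB<hA m<M y<x))))
      where
      eq : (K M x m y ▹ Z₂ x y) ≡ (K M x m y ▹ Z₁ x y)
      eq with K M x m y in h
      ... | false = refl
      ... | true  = X*-cong (letters r ++ x ∷ y ∷ letters l)
                      (separated (law M m h) y<x (sep-next {y} {x} (sides-mid-sep r l (E x y y<x) m<M y<x p s h))) e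

  -- For x ≤ m the term of `P₂` vanishes, and the third columns do not notice whether A or B carries
  -- M. For m < x the interchanged term of `P₁` must go m → y and M → x: if a separator arises in
  -- the row, this term dies and the second law gives the rest; if none arises, its conditions equal
  -- those of the other terms and the third law applies again.
  core-unseparated : ∀ {x y} → (y <ᵇ x) ≡ true →
    All (λ c → sepCol (suc hA) (suc hB) m M c ≡ false) (tag (map col r) (map col l)) →
    (T₂ M m x y + T₁ m M x y) + (T₂ M m y x + T₁ m M y x) ≡ T₁ M m x y + T₁ M m y x
  core-unseparated {x} {y} y<x s₀ =
    trans (cong₂ _+_ (cong (_+_ (T₂ M m x y)) (drop₁ m M x y (ok₁-mxMy m M x y hB<hA m<M y<x)))
                     (trans (cong (_+ T₁ m M y x) (other₂ {x} {y} y<x)) (+-identityˡ _)))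
          (trans main (sym (trans (cong₂ _+_ (drop₁ M m x y (ok₁-Mxmy m M x y hB<hA m<M y<x)) (other₁ {x} {y} y<x)) (+-identityʳ _))))
    where
    s : All (λ se → sepCol (suc hA) (suc hB) m M (proj₁ se , col (proj₂ se)) ≡ false) (tag r l)
    s = All-map⁻ (subst (All _) (sym (tag-map col r l)) s₀)
    main : (T₂ M m x y + (K m x M y ▹ Z₁ x y)) + T₁ m M y x ≡ (K M x m y ▹ Z₁ x y)
    main with truth (m <ᵇ x)
    ... | inj₂ p = begin
      (T₂ M m x y + (K m x M y ▹ Z₁ x y)) + T₁ m M y x
        ≡⟨ cong₂ (λ a b → (a + (K m x M y ▹ Z₁ x y)) + b) (kill₂ M m x y (trans (ok₂-Mxmy m M x y hB<hA m<M y<x) p)) (kill₁ m M y x (trans (ok₁-myMx m M x y hB<hA m<M y<x) p)) ⟩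
      (0ℤ + (K m x M y ▹ Z₁ x y)) + 0ℤ ≡⟨ trans (+-identityʳ _) (+-identityˡ _) ⟩
      (K m x M y ▹ Z₁ x y) ≡⟨ cong (_▹ Z₁ x y) (sym (sides-low-nosep r l (E x y y<x) m<M y<x p s)) ⟩
      (K M x m y ▹ Z₁ x y) ∎
      where open ≡-Reasoning
    ... | inj₁ p = begin
      (T₂ M m x y + (K m x M y ▹ Z₁ x y)) + T₁ m M y x
        ≡⟨ cong₂ (λ a b → (a + (K m x M y ▹ Z₁ x y)) + b) (drop₂ M m x y (trans (ok₂-Mxmy m M x y hB<hA m<M y<x) p)) (drop₁ m M y x (trans (ok₁-myMx m M x y hB<hA m<M y<x) p)) ⟩
      ((K M x m y ▹ Z₂ x y) + (K m x M y ▹ Z₁ x y)) + (K m y M x ▹ Z₁ y x)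
        ≡⟨ cong (λ b → ((K M x m y ▹ Z₂ x y) + (b ▹ Z₁ x y)) + (K m y M x ▹ Z₁ y x)) (sides-low⁻ r l (E x y y<x) m<M y<x p) ⟩
      ((K M x m y ▹ Z₂ x y) + 0ℤ) + (K m y M x ▹ Z₁ y x)
        ≡⟨ cong (_+ (K m y M x ▹ Z₁ y x)) (+-identityʳ (K M x m y ▹ Z₂ x y)) ⟩
      (K M x m y ▹ Z₂ x y) + (K m y M x ▹ Z₁ y x) ≡⟨ last (search (sepNext hA hB y x) (tag r l)) ⟩
      (K M x m y ▹ Z₁ x y) ∎
      where
      open ≡-Reasoning
      last : _ → (K M x m y ▹ Z₂ x y) + (K m y M x ▹ Z₁ y x) ≡ (K M x m y ▹ Z₁ x y)
      last (inj₁ s') = trans (cong₂ _+_ (separated-Y M m {x} {y} y<x s') (cong (_▹ Z₁ y x) (sides-mid-sep' r l (E x y y<x) m<M y<x p s s'))) (+-identityʳ _)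
      last (inj₂ s') = trans (cong (λ b → (K M x m y ▹ Z₂ x y) + (b ▹ Z₁ y x)) (sym (sides-mid-nosep' r l (E x y y<x) m<M y<x p s s')))
                             (unseparated-Y M m {x} {y} y<x s')

▹-cong : ∀ β {z w : ℤ} → (β ≡ true → z ≡ w) → (β ▹ z) ≡ (β ▹ w)
▹-cong true  h = h refl
▹-cong false h = refl

pairs : ∀ (f g : ℕ → ℕ → ℤ) → (∀ {x y} → (y <ᵇ x) ≡ true → f x y + f y x ≡ g x y + g y x) →
  (∀ x → f x x ≡ g x x) → ∀ a b → f a b + f b a ≡ g a b + g b a
pairs f g h d a b with <-cmp a b
... | tri< a<b _ _  = trans (+-comm (f a b) (f b a)) (trans (h (<ᵇ-true a<b)) (+-comm (g b a) (g a b)))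
... | tri≈ _ refl _ = cong₂ _+_ (d a) (d a)
... | tri> _ _ b<a  = h (<ᵇ-true b<a)

module _ (A : List ℕ) (R L : List Col) where
  S₂ : (List Cell → List Cell → ℕ → ℕ → ℤ) → ℤ
  S₂ T = rowSum A R (λ r → sumL A (λ a → sumL A (λ b → rowSum A L (λ l → T r l a b))))

  S₂-+ : ∀ T T' → S₂ (λ r l a b → T r l a b + T' r l a b) ≡ S₂ T + S₂ T'
  S₂-+ T T' = trans (rowSum-cong A R λ r _ → trans (sumL-cong A λ a → trans (sumL-cong A λ b → rowSum-+ A L _ _)
                (sumL-+ A _ _)) (sumL-+ A _ _)) (rowSum-+ A R _ _)

  S₂-cong : ∀ {T T'} → (∀ r l → map col r ≡ R → map col l ≡ L →
              ∀ a b → T r l a b + T r l b a ≡ T' r l a b + T' r l b a) → S₂ T ≡ S₂ T'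
  S₂-cong {T} {T'} h = rowSum-cong A R λ r eq → sumL-double A _ _ λ a b →
    trans (sym (rowSum-+ A L (λ l → T r l a b) (λ l → T r l b a)))
   (trans (rowSum-cong A L λ l eq' → h r l eq eq' a b)
          (rowSum-+ A L (λ l → T' r l a b) (λ l → T' r l b a)))

  S₁ : (List Cell → List Cell → ℕ → ℤ) → ℤ
  S₁ T = rowSum A R (λ r → sumL A (λ a → rowSum A L (λ l → T r l a)))

  S₁-+ : ∀ T T' → S₁ (λ r l a → T r l a + T' r l a) ≡ S₁ T + S₁ T'
  S₁-+ T T' = trans (rowSum-cong A R λ r _ → trans (sumL-cong A λ a → rowSum-+ A L _ _)
                (sumL-+ A _ _)) (rowSum-+ A R _ _)

  S₁-cong : ∀ {T T'} → (∀ r l → map col r ≡ R → map col l ≡ L → ∀ a → T r l a ≡ T' r l a) → S₁ T ≡ S₁ T'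
  S₁-cong h = rowSum-cong A R λ r eq → sumL-cong A λ a → rowSum-cong A L λ l eq' → h r l eq eq' a

expand : ∀ {n} A k r l x y (e : Vec ℕ n) →
  (okRow (r ++ x ∷ y ∷ l) ▹ X* (letters (r ++ x ∷ y ∷ l)) (G A k (next (r ++ x ∷ y ∷ l))) e) ≡
  (okRow (r ++ l) ▹ ((side r l x ∧ side r l y) ∧ ok x y ▹
     X* (letters r ++ letters (x ∷ y ∷ l)) (G A k (next r ++ next (x ∷ y ∷ l))) e))
expand A k r l x y e
  rewrite okRow-split r x y l | letters-++ r (x ∷ y ∷ l) | next-++ r (x ∷ y ∷ l) = ▹-∧ (okRow (r ++ l)) _

module _ {n : ℕ} (A : List ℕ) (k : ℕ) (R L : List Col) (hA hB u v : ℕ) (e : Vec ℕ n) where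

  expand₁ : P₁ A (suc k) R L (suc hA) (suc hB) u v e ≡
            S₂ A R L (λ r l a b → okRow (r ++ l) ▹ t₁ A k hA hB r l e u v a b)
  expand₁ = trans (rowSum-++ A R _ _) (rowSum-cong A R λ r _ → sumL-cong A λ a → sumL-cong A λ b →
    rowSum-cong A L λ l _ → expand A k r l (move hA u a) (move hB v b) e)

  expand₂ : P₂ A (suc k) R L (suc hA) (suc hB) u v e ≡
            S₂ A R L (λ r l a b → okRow (r ++ l) ▹ t₂ A k hA hB r l e u v a b)
  expand₂ = trans (rowSum-++ A R _ _) (rowSum-cong A R λ r _ → trans (sumL-swap A A _)
    (sumL-cong A λ a → sumL-cong A λ b → rowSum-cong A L λ l _ →
      trans (expand A k r l (move hB v b) (move hA u a) e)
            (cong (okRow (r ++ l) ▹_) (cong₂ _▹_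
              (cong (_∧ ok (move hB v b) (move hA u a)) (∧-comm (side r l (move hB v b)) (side r l (move hA u a))))
              (Y-swap A k hA hB r l e a b _)))))

module _ {n : ℕ} (A : List ℕ) (k hA : ℕ) (r l : List Cell) (e : Vec ℕ n) where
  w : ℕ → ℤ
  w a = X* (letters r ++ a ∷ letters l) (G A k (next r ++ (hA , a) ∷ next l)) e

  s₁ s₂ : (u v a : ℕ) → ℤ
  s₁ u v a = (side r l (move hA u a) ∧ side r l (idle v)) ∧ true ▹ w a
  s₂ u v a = (side r l (move hA u a) ∧ side r l (idle v)) ∧ ok (idle v) (move hA u a) ▹ w a

module _ {n : ℕ} (A : List ℕ) (k : ℕ) (R L : List Col) (hA u v : ℕ) (e : Vec ℕ n) where
  expandTop₁ : P₁ A (suc k) R L (suc hA) 0 u v e ≡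
               S₁ A R L (λ r l a → okRow (r ++ l) ▹ s₁ A k hA r l e u v a)
  expandTop₁ = trans (rowSum-++ A R _ _) (rowSum-cong A R λ r _ → sumL-cong A λ a →
    rowSum-cong A L λ l _ → expand A k r l (move hA u a) (idle v) e)

  expandTop₂ : P₂ A (suc k) R L (suc hA) 0 u v e ≡
               S₁ A R L (λ r l a → okRow (r ++ l) ▹ s₂ A k hA r l e u v a)
  expandTop₂ = trans (rowSum-++ A R _ _) (rowSum-cong A R λ r _ → sumL-cong A λ a →
    rowSum-cong A L λ l _ → trans (expand A k r l (idle v) (move hA u a) e)
      (cong (λ β → okRow (r ++ l) ▹ (β ∧ ok (idle v) (move hA u a) ▹ w A k hA r l e a))
        (∧-comm (side r l (idle v)) (side r l (move hA u a)))))

module _ {n : ℕ} (A : List ℕ) (k hA : ℕ) (r l : List Cell) (e : Vec ℕ n)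
         (base : okRow (r ++ l) ≡ true) {m M : ℕ} (m<M : (m <ᵇ M) ≡ true)
         (am : All (Apart m) (tag (map col r) (map col l))) (aM : All (Apart M) (tag (map col r) (map col l))) where
  private
    ctx = tag r l

    one : Side × Cell → (u v a : ℕ) → Bool
    one se u v a = okAt (move hA u a) se ∧ okAt (idle v) se

    K : (u v a : ℕ) → Bool
    K u v a = side r l (move hA u a) ∧ side r l (idle v)

    split : ∀ u v a → K u v a ≡ not (u <ᵇ a) ∧ all (λ se → one se u v a) ctx
    split u v a = trans
      (solve 3 (λ a b c → (a :* b) :* c := a :* (b :* c)) refl
        (not (u <ᵇ a)) (all (okAt (move hA u a)) ctx) (all (okAt (idle v)) ctx))
      (cong (not (u <ᵇ a) ∧_) (all-∧ (okAt (move hA u a)) (okAt (idle v)) ctx))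
      where open ∨-∧-Solver

    apart-cells : ∀ {u} → All (Apart u) (tag (map col r) (map col l)) →
      All (λ se → Apart u (proj₁ se , col (proj₂ se))) (tag r l)
    apart-cells {u} h = All-map⁻ (subst (All (Apart u)) (sym (tag-map col r l)) h)

    E : ∀ z → All (λ se → ExchangeTop (λ u z → okAt (move hA u z) se) (λ v → okAt (idle v) se)
                            (sepCol (suc hA) 0 m M (proj₁ se , col (proj₂ se))) m M z) ctx
    E z = all-all (λ {se} f (a , b) → mkExchangeTop (exchangeTopAt (proj₁ se) (proj₂ se) {hA} {m} {M} {z} f a b m<M))
            (All-tag r (okRow-fit (r ++ l) base)) (All.zip (apart-cells am , apart-cells aM))

    open ExchangeTop
    W  = w A k hA r l e
    T₁ = s₁ A k hA r l e
    T₂ = s₂ A k hA r l e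

  coreTop-ordered : ∀ a → T₂ m M a ≡ T₁ m M a
  coreTop-ordered a = cong (λ b → K m M a ∧ b ▹ W a)
    (cong not (trans (cong (not (M <ᵇ a) ∧_) (<ᵇ-false (<⇒≤ (<ᵇ-true⁻ {m} {M} m<M)))) (∧-zeroʳ _)))

  coreTop-separated : Any (λ c → sepCol (suc hA) 0 m M c ≡ true) (tag (map col r) (map col l)) →
    ∀ a → T₂ M m a ≡ T₁ M m a
  coreTop-separated s₀ a with truth (m <ᵇ a)
  ... | inj₁ p = cong (λ b → K M m a ∧ not (not b ∧ (m <ᵇ M)) ▹ W a) p
  ... | inj₂ p = trans (cong (λ b → b ∧ ok (idle m) (move hA M a) ▹ W a) none)
                       (sym (cong (λ b → b ∧ true ▹ W a) none))
    where
    s = Any-map⁻ (subst (Any _) (sym (tag-map col r l)) s₀)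
    none : K M m a ≡ false
    none = trans (split M m a) (trans (cong (not (M <ᵇ a) ∧_)
             (all-false (any-all (λ e → top-sep e p) (E a) s))) (∧-zeroʳ _))

  -- A letter a > m cannot stand on the label m of A, while a letter a ≤ m on M is forbidden by the
  -- top label m of B to its right. So at most one summand on the left survives, and it has the same
  -- conditions as the right-hand side.
  coreTop-unseparated : All (λ c → sepCol (suc hA) 0 m M c ≡ false) (tag (map col r) (map col l)) →
    ∀ a → T₂ M m a + T₁ m M a ≡ T₁ M m a
  coreTop-unseparated s₀ a with truth (m <ᵇ a)
  ... | inj₁ p = trans (cong₂ _+_ (cong (λ b → K M m a ∧ not (not b ∧ (m <ᵇ M)) ▹ W a) p)
                          (cong (λ b → ((not b ∧ all (okAt (move hA m a)) ctx) ∧ side r l (idle M)) ∧ true ▹ W a) p))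
                       (+-identityʳ _)
  ... | inj₂ p = trans (cong₂ _+_
      (trans (cong (λ b → K M m a ∧ not b ▹ W a) (cong₂ (λ b c → not b ∧ c) p m<M)) (cong (_▹ W a) (∧-zeroʳ (K M m a))))
      (cong (λ b → b ∧ true ▹ W a) (sym same))) (+-identityˡ _)
    where
    s : All (λ se → sepCol (suc hA) 0 m M (proj₁ se , col (proj₂ se)) ≡ false) (tag r l)
    s = All-map⁻ (subst (All _) (sym (tag-map col r l)) s₀)
    same : K M m a ≡ K m M a
    same = trans (split M m a) (trans (cong₂ _∧_
        (cong not (trans (≤⇒≮ᵇ {a} {m} {M} p (<⇒≤ (<ᵇ-true⁻ {m} {M} m<M))) (sym p)))
        (all-cong (all-all (λ e → top-nosep e p) (E a) s))) (sym (split m M a)))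

private
  diagonal : ∀ h h' u v a → ok (move h u a) (move h' v a) ≡ false
  diagonal h h' u v a rewrite <ᵇ-false (≤-refl {a}) = refl

-- Induction on the number of rows, with the three laws together because a row can lead from one law
-- to another. If B is already exhausted, the rows above the present one are the same on both sides,
-- and only the conditions of the present row have to be compared.
swap-laws : ∀ n A k R L {hA hB u v} → hB < hA → hA ≤ k →
  All (Apart u) (tag R L) → All (Apart v) (tag R L) → SwapLaws n A k R L hA hB u v
swap-laws n A (suc k) R L {suc hA} {zero} {u} {v} hB<hA (s≤s hA≤k) au av = record
  { ordered = λ u<v e → trans (expandTop₂ A k R L hA u v e)
      (trans (S₁-cong A R L (λ { r l refl refl a → ▹-cong (okRow (r ++ l)) λ base →
                coreTop-ordered A k hA r l e base u<v au av a }))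
             (sym (expandTop₁ A k R L hA u v e)))
  ; separated = λ v<u s e → trans (expandTop₂ A k R L hA u v e)
      (trans (S₁-cong A R L (λ { r l refl refl a → ▹-cong (okRow (r ++ l)) λ base →
                coreTop-separated A k hA r l e base v<u av au s a }))
             (sym (expandTop₁ A k R L hA u v e)))
  ; unseparated = λ v<u s e → trans (cong₂ _+_ (expandTop₂ A k R L hA u v e) (expandTop₁ A k R L hA v u e))
      (trans (sym (S₁-+ A R L _ _))
      (trans (S₁-cong A R L (λ { r l refl refl a → trans (sym (▹-+ (okRow (r ++ l)))) (▹-cong (okRow (r ++ l)) λ base →
                coreTop-unseparated A k hA r l e base v<u av au s a) }))
             (sym (expandTop₁ A k R L hA u v e))))
  }
swap-laws n A (suc k) R L {suc hA} {suc hB} {u} {v} (s≤s hB<hA) (s≤s hA≤k) au av = record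
  { ordered = λ u<v e → trans (expand₂ A k R L hA hB u v e)
      (trans (S₂-cong A R L (λ { r l refl refl → pairs (T₂ r l e u v) (T₁ r l e u v)
                (λ {x} {y} y<x → joined (okRow (r ++ l)) λ base →
                   core-ordered A k hA hB r l e hB<hA base (ih r l) u<v au av {x} {y} y<x)
                (λ x → trans (diag₂ r l e u v x) (sym (diag₁ r l e u v x))) }))
             (sym (expand₁ A k R L hA hB u v e)))
  ; separated = λ v<u s e → trans (expand₂ A k R L hA hB u v e)
      (trans (S₂-cong A R L (λ { r l refl refl → pairs (T₂ r l e u v) (T₁ r l e u v)
                (λ {x} {y} y<x → joined (okRow (r ++ l)) λ base →
                   core-separated A k hA hB r l e hB<hA base (ih r l) v<u av au {x} {y} y<x s)
                (λ x → trans (diag₂ r l e u v x) (sym (diag₁ r l e u v x))) }))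
             (sym (expand₁ A k R L hA hB u v e)))
  ; unseparated = λ v<u s e → trans (cong₂ _+_ (expand₂ A k R L hA hB u v e) (expand₁ A k R L hA hB v u e))
      (trans (sym (S₂-+ A R L _ _))
      (trans (S₂-cong A R L (λ { r l refl refl → pairs (λ a b → T₂ r l e u v a b + T₁ r l e v u a b) (T₁ r l e u v)
                (λ {x} {y} y<x → joined₂ (okRow (r ++ l)) λ base →
                   core-unseparated A k hA hB r l e hB<hA base (ih r l) v<u av au {x} {y} y<x s)
                (λ x → trans (cong₂ _+_ (diag₂ r l e u v x) (diag₁ r l e v u x)) (sym (diag₁ r l e u v x))) }))
             (sym (expand₁ A k R L hA hB u v e))))
  }
  where
  ih : ∀ r l a b → All (Apart a) (tag (next r) (next l)) → All (Apart b) (tag (next r) (next l)) →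
       SwapLaws n A k (next r) (next l) hA hB a b
  ih r l a b = swap-laws n A k (next r) (next l) hB<hA hA≤k

  T₁ T₂ : (r l : List Cell) (e : Vec ℕ n) (u v a b : ℕ) → ℤ
  T₁ r l e u v a b = okRow (r ++ l) ▹ t₁ A k hA hB r l e u v a b
  T₂ r l e u v a b = okRow (r ++ l) ▹ t₂ A k hA hB r l e u v a b

  diag₁ : ∀ r l (e : Vec ℕ n) u v x → (okRow (r ++ l) ▹ t₁ A k hA hB r l e u v x x) ≡ 0ℤ
  diag₁ r l e u v x = trans (▹-cong (okRow (r ++ l)) (λ _ → cong (_▹ y₁ A k hA hB r l e x x)
      (trans (cong (sides hA hB r l u x v x ∧_) (diagonal hA hB u v x)) (∧-zeroʳ _)))) (▹-0 (okRow (r ++ l)))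

  diag₂ : ∀ r l (e : Vec ℕ n) u v x → (okRow (r ++ l) ▹ t₂ A k hA hB r l e u v x x) ≡ 0ℤ
  diag₂ r l e u v x = trans (▹-cong (okRow (r ++ l)) (λ _ → cong (_▹ y₂ A k hA hB r l e x x)
      (trans (cong (sides hA hB r l u x v x ∧_) (diagonal hB hA v u x)) (∧-zeroʳ _)))) (▹-0 (okRow (r ++ l)))

  joined : ∀ β {a b c d : ℤ} → (β ≡ true → a + b ≡ c + d) → (β ▹ a) + (β ▹ b) ≡ (β ▹ c) + (β ▹ d)
  joined true  h = h refl
  joined false h = refl

  joined₂ : ∀ β {a a' b b' c d : ℤ} → (β ≡ true → (a + a') + (b + b') ≡ c + d) →
    ((β ▹ a) + (β ▹ a')) + ((β ▹ b) + (β ▹ b')) ≡ (β ▹ c) + (β ▹ d)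
  joined₂ true  h = h refl
  joined₂ false h = refl

-- Columns of decreasing height and the Demazure recursion

s : ℕ → ℕ → ℕ
s zero    zero          = 1
s zero    (suc zero)    = 0
s zero    (suc (suc a)) = suc (suc a)
s (suc i) zero          = zero
s (suc i) (suc a)       = suc (s i a)

s* : ℕ → List ℕ → List ℕ
s* i = map (s i)

s-i : ∀ i → s i i ≡ suc i
s-i zero    = refl
s-i (suc i) = cong suc (s-i i)

s-1+i : ∀ i → s i (suc i) ≡ i
s-1+i zero    = refl
s-1+i (suc i) = cong suc (s-1+i i)

s-involutive : ∀ i a → s i (s i a) ≡ a
s-involutive zero    zero          = refl
s-involutive zero    (suc zero)    = refl
s-involutive zero    (suc (suc a)) = refl
s-involutive (suc i) zero          = refl
s-involutive (suc i) (suc a)       = cong suc (s-involutive i a)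

s*-involutive : ∀ i as → s* i (s* i as) ≡ as
s*-involutive i []       = refl
s*-involutive i (a ∷ as) = cong₂ _∷_ (s-involutive i a) (s*-involutive i as)

Out : ℕ → ℕ → Set
Out i a = a ≢ i × a ≢ suc i

s-out : ∀ {i a} → Out i a → s i a ≡ a
s-out {zero}  {zero}        (p , q) = ⊥-elim (p refl)
s-out {zero}  {suc zero}    (p , q) = ⊥-elim (q refl)
s-out {zero}  {suc (suc a)} o       = refl
s-out {suc i} {zero}        o       = refl
s-out {suc i} {suc a}       (p , q) = cong suc (s-out ((λ e → p (cong suc e)) , (λ e → q (cong suc e))))

-- s_i moves `b` only within the set of i and i + 1, and its two elements compare alike with every
-- other letter.
<ᵇ-sˡ : ∀ {i c} → Out i c → ∀ b → (s i b <ᵇ c) ≡ (b <ᵇ c)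
<ᵇ-sˡ {zero}  {zero}        (p , q) b             = ⊥-elim (p refl)
<ᵇ-sˡ {zero}  {suc zero}    (p , q) b             = ⊥-elim (q refl)
<ᵇ-sˡ {zero}  {suc (suc c)} o       zero          = refl
<ᵇ-sˡ {zero}  {suc (suc c)} o       (suc zero)    = refl
<ᵇ-sˡ {zero}  {suc (suc c)} o       (suc (suc b)) = refl
<ᵇ-sˡ {suc i} {zero}        o       zero          = refl
<ᵇ-sˡ {suc i} {zero}        o       (suc b)       = refl
<ᵇ-sˡ {suc i} {suc c}       o       zero          = refl
<ᵇ-sˡ {suc i} {suc c}       (p , q) (suc b)       = <ᵇ-sˡ ((λ e → p (cong suc e)) , (λ e → q (cong suc e))) b

<ᵇ-sʳ : ∀ {i c} → Out i c → ∀ b → (c <ᵇ s i b) ≡ (c <ᵇ b)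
<ᵇ-sʳ {zero}  {zero}        (p , q) b             = ⊥-elim (p refl)
<ᵇ-sʳ {zero}  {suc zero}    (p , q) b             = ⊥-elim (q refl)
<ᵇ-sʳ {zero}  {suc (suc c)} o       zero          = refl
<ᵇ-sʳ {zero}  {suc (suc c)} o       (suc zero)    = refl
<ᵇ-sʳ {zero}  {suc (suc c)} o       (suc (suc b)) = refl
<ᵇ-sʳ {suc i} {zero}        o       zero          = refl
<ᵇ-sʳ {suc i} {zero}        o       (suc b)       = refl
<ᵇ-sʳ {suc i} {suc c}       o       zero          = refl
<ᵇ-sʳ {suc i} {suc c}       (p , q) (suc b)       = <ᵇ-sʳ ((λ e → p (cong suc e)) , (λ e → q (cong suc e))) b

outside : ℕ → ℕ → ℕ → Bool
outside a b c = not (not (c <ᵇ a) ∧ not (b <ᵇ c))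

-- The rows above a row labelled w, for columns ordered by decreasing strength:
-- every column takes the largest letter still available.
valid : List ℕ → List ℕ → Bool
valid w       []       = true
valid []      (a ∷ as) = false
valid (b ∷ w) (a ∷ as) = not (b <ᵇ a) ∧ (all (outside a b) as ∧ valid w as)

module _ {i : ℕ} where

  -- In `One` the letter i + 1 occurs once and i does not occur; in `Two` each occurs once and i + 1
  -- comes earlier. Words with the letters in the opposite roles are written as images under `s* i`.
  data One : List ℕ → Set where
    here  : ∀ {as} → All (Out i) as → One (suc i ∷ as)
    there : ∀ {a as} → Out i a → One as → One (a ∷ as)

  data Two : List ℕ → Set where
    here  : ∀ {as} → One as → Two (suc i ∷ s* i as)
    there : ∀ {a as} → Out i a → Two as → Two (a ∷ as)

  -- The position of labels from which ξ goes out: the first label among i, i + 1, if there is one,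
  -- is i + 1, and i + 1 is not repeated. For sorted columns it means that the higher of the two
  -- carries i + 1.
  data High : List ℕ → Set where
    []    : High []
    here  : ∀ {w} → All (_≢ suc i) w → High (suc i ∷ w)
    there : ∀ {b w} → Out i b → High w → High (b ∷ w)

data Repeated : List ℕ → Set where
  here  : ∀ {a as} → a ∈ as → Repeated (a ∷ as)
  there : ∀ {a as} → Repeated as → Repeated (a ∷ as)

data Kind (i : ℕ) (as : List ℕ) : Set where
  none-kind : All (Out i) as → Kind i as
  one-kind  : One {i} as → Kind i as
  one'-kind : One {i} (s* i as) → Kind i as
  two-kind  : Two {i} as → Kind i as
  two'-kind : Two {i} (s* i as) → Kind i as
  bad-kind  : Repeated as → Kind i as

module _ {i : ℕ} where
  s*-none : ∀ {as} → All (Out i) as → s* i as ≡ as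
  s*-none []       = refl
  s*-none (o ∷ os) = cong₂ _∷_ (s-out o) (s*-none os)

  one-∈ : ∀ {as} → One {i} as → suc i ∈ as
  one-∈ (here _)    = here refl
  one-∈ (there _ o) = there (one-∈ o)

  ∈-s* : ∀ {a as} → a ∈ s* i as → s i a ∈ as
  ∈-s* {a} {as} p = subst (s i a ∈_) (s*-involutive i as) (Any-map⁺ (Any.map (cong (s i)) p))

  one-∈' : ∀ {as} → One {i} as → i ∈ s* i as
  one-∈' {as} o = Any-map⁺ (Any.map (λ { refl → sym (s-1+i i) }) (one-∈ o))

  two-∈ : ∀ {as} → Two {i} as → suc i ∈ as × i ∈ as
  two-∈ (here o)    = here refl , there (one-∈' o)
  two-∈ (there _ t) with two-∈ t
  ... | p , q = there p , there q

  kind : ∀ as → Kind i as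
  kind [] = none-kind []
  kind (a ∷ as) with a ≟ i | a ≟ suc i
  kind (a ∷ as) | no p | no q with kind as
  ... | none-kind h = none-kind ((p , q) ∷ h)
  ... | one-kind  h = one-kind  (there (p , q) h)
  ... | one'-kind h = one'-kind (subst (λ b → One (b ∷ s* i as)) (sym (s-out (p , q))) (there (p , q) h))
  ... | two-kind  h = two-kind  (there (p , q) h)
  ... | two'-kind h = two'-kind (subst (λ b → Two (b ∷ s* i as)) (sym (s-out (p , q))) (there (p , q) h))
  ... | bad-kind  h = bad-kind  (there h)
  kind (a ∷ as) | yes refl | _ with kind as
  ... | none-kind h = one'-kind (subst One (cong₂ _∷_ (sym (s-i i)) (sym (s*-none h))) (here h))
  ... | one-kind  h = two'-kind (subst (λ b → Two {i} (b ∷ s* i as)) (sym (s-i i)) (here h))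
  ... | one'-kind h = bad-kind  (here (subst (_∈ as) (s-1+i i) (∈-s* (one-∈ h))))
  ... | two-kind  h = bad-kind  (here (proj₂ (two-∈ h)))
  ... | two'-kind h = bad-kind  (here (subst (_∈ as) (s-1+i i) (∈-s* (proj₁ (two-∈ h)))))
  ... | bad-kind  h = bad-kind  (there h)
  kind (a ∷ as) | no _ | yes refl with kind as
  ... | none-kind h = one-kind (here h)
  ... | one-kind  h = bad-kind (here (one-∈ h))
  ... | one'-kind h = two-kind (subst (λ bs → Two (suc i ∷ bs)) (s*-involutive i as) (here h))
  ... | two-kind  h = bad-kind (here (proj₁ (two-∈ h)))
  ... | two'-kind h = bad-kind (here (subst (_∈ as) (s-i i) (∈-s* (proj₂ (two-∈ h)))))
  ... | bad-kind  h = bad-kind (there h)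

outside-false : ∀ {a b c} → a ≤ c → c ≤ b → outside a b c ≡ false
outside-false {a} {b} {c} p q = cong₂ (λ x y → not (not x ∧ not y)) (<ᵇ-false p) (<ᵇ-false q)

all-outside-false : ∀ a b {c as} → c ∈ as → a ≤ c → c ≤ b → all (outside a b) as ≡ false
all-outside-false a b c∈as p q = all-false (Any.map (λ { refl → outside-false p q }) c∈as)

head-false : ∀ a b w as → (a ≤ b → all (outside a b) as ≡ false) → valid (b ∷ w) (a ∷ as) ≡ false
head-false a b w as h with b <ᵇ a in eq
... | true  = refl
... | false = cong (_∧ valid w as) (h (<ᵇ-false⁻ {b} {a} eq))

valid-repeated : ∀ {as} → Repeated as → ∀ w → valid w as ≡ false
valid-repeated (here p)  []      = refl
valid-repeated {a ∷ as} (here p) (b ∷ w) = head-false a b w as (λ a≤b → all-outside-false a b p ≤-refl a≤b)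
valid-repeated (there r) []      = refl
valid-repeated {a ∷ as} (there r) (b ∷ w) rewrite valid-repeated r w =
  trans (cong (not (b <ᵇ a) ∧_) (∧-zeroʳ _)) (∧-zeroʳ _)

repeated-s* : ∀ {i as} → Repeated as → Repeated (s* i as)
repeated-s* {i} (here p)  = here (Any-map⁺ (Any.map (cong (s i)) p))
repeated-s* (there r) = there (repeated-s* r)

module _ {i : ℕ} where

  outside-s₁ : ∀ a b {c} → Out i c → outside (s i a) b c ≡ outside a b c
  outside-s₁ a b {c} o = cong (λ x → not (not x ∧ not (b <ᵇ c))) (<ᵇ-sʳ o a)

  outside-s₂ : ∀ a b {c} → Out i c → outside a (s i b) c ≡ outside a b c
  outside-s₂ a b {c} o = cong (λ x → not (not (c <ᵇ a) ∧ not x)) (<ᵇ-sˡ o b)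

  outside-s₃ : ∀ {a b} c → Out i a → Out i b → outside a b (s i c) ≡ outside a b c
  outside-s₃ c oa ob = cong₂ (λ x y → not (not x ∧ not y)) (<ᵇ-sˡ oa c) (<ᵇ-sʳ ob c)

  all-s₁ : ∀ a b {as} → All (Out i) as → all (outside (s i a) b) as ≡ all (outside a b) as
  all-s₁ a b h = all-cong (All.map (outside-s₁ a b) h)

  all-s₂ : ∀ a b {as} → All (Out i) as → all (outside a (s i b)) as ≡ all (outside a b) as
  all-s₂ a b h = all-cong (All.map (outside-s₂ a b) h)

  all-s₃ : ∀ {a b} → Out i a → Out i b → ∀ as → all (outside a b) (s* i as) ≡ all (outside a b) as
  all-s₃ oa ob []       = refl
  all-s₃ oa ob (c ∷ as) = cong₂ _∧_ (outside-s₃ c oa ob) (all-s₃ oa ob as)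

  valid-none : ∀ w {as} → All (Out i) as → valid (s* i w) as ≡ valid w as
  valid-none w       []       = refl
  valid-none []      (o ∷ os) = refl
  valid-none (b ∷ w) (_∷_ {a} o os) =
    cong₂ (λ x y → not x ∧ y) (<ᵇ-sˡ o b) (cong₂ _∧_ (all-s₂ a b os) (valid-none w os))

  private
    below : ∀ {a} → Out i a → a ≤ suc i → a ≤ i
    below (p , q) a≤ = ≤-pred (≤∧≢⇒< a≤ q)

  -- Labels and letters other than i, i + 1 do not tell these two apart, so only the column labelled
  -- i + 1 matters. If it takes a foreign letter while the single i or i + 1 is still to come, that
  -- letter lies in its forbidden interval and all three rows are invalid.
  valid-one : ∀ {w as} → High {i} w → One {i} as →
    valid w (s* i as) ≡ valid w as × valid (s* i w) (s* i as) ≡ valid w as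
  valid-one [] (here h)    = refl , refl
  valid-one [] (there _ _) = refl , refl
  valid-one {b ∷ w} {a ∷ as} (there ob hw) (here h)
    rewrite s*-none h | s-out ob | valid-none w h | <ᵇ-sʳ ob a | all-s₁ a b h = refl , refl
  valid-one {b ∷ w} {a ∷ as} (here nw) (here h)
    rewrite s*-none h | all-s₁ a b h | all-s₂ (s i a) b h | all-s₁ a b h | valid-none w h
          | s-1+i i | <ᵇ-false (n≤1+n i) | <ᵇ-false (≤-refl {i}) = refl , refl
  valid-one {b ∷ w} {a ∷ as} (there ob hw) (there oa h)
    rewrite s-out ob | s-out oa | all-s₃ oa ob as | proj₁ (valid-one hw h) | proj₂ (valid-one hw h) = refl , refl
  valid-one {b ∷ w} {a ∷ as} (here nw) (there oa h) rewrite s-out oa | s-1+i i =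
    trans f₂ (sym f₁) , trans f₃ (sym f₁)
    where
    f₁ : valid (suc i ∷ w) (a ∷ as) ≡ false
    f₁ = head-false a (suc i) w as λ a≤ → all-outside-false a (suc i) (one-∈ h) a≤ ≤-refl
    f₂ : valid (suc i ∷ w) (a ∷ s* i as) ≡ false
    f₂ = head-false a (suc i) w (s* i as) λ a≤ → all-outside-false a (suc i) (one-∈' h) (below oa a≤) (n≤1+n i)
    f₃ : valid (i ∷ s* i w) (a ∷ s* i as) ≡ false
    f₃ = head-false a i (s* i w) (s* i as) λ a≤ → all-outside-false a i (one-∈' h) a≤ ≤-refl

  -- Covers the columns after the one labelled i + 1, where the label i may still occur. Raising
  -- that label to i + 1 has the same effect as lowering the letter i + 1 to i.
  valid-absent : ∀ {w as} → All (_≢ suc i) w → One {i} as → valid (s* i w) as ≡ valid w (s* i as)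
  valid-absent [] (here _)    = refl
  valid-absent [] (there _ _) = refl
  valid-absent {b ∷ w} {a ∷ as} (nb ∷ nw) o with b ≟ i
  valid-absent {b ∷ w} {a ∷ as} (nb ∷ nw) (here h) | no p
    rewrite s*-none h | s-out (p , nb) | valid-none w h | all-s₁ a b h | <ᵇ-sʳ (p , nb) a = refl
  valid-absent {b ∷ w} {a ∷ as} (nb ∷ nw) (there oa h) | no p
    rewrite s-out oa | s-out (p , nb) | all-s₃ oa (p , nb) as | valid-absent nw h = refl
  valid-absent {b ∷ w} {a ∷ as} (nb ∷ nw) (here h) | yes refl
    rewrite s*-none h | valid-none w h | all-s₂ a b h | all-s₁ a b h
          | s-i i | s-1+i i | <ᵇ-false (≤-refl {i}) = refl
  valid-absent {b ∷ w} {a ∷ as} (nb ∷ nw) (there oa h) | yes refl rewrite s-out oa | s-i i =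
    trans (head-false a (suc i) (s* i w) as λ a≤ → all-outside-false a (suc i) (one-∈ h) a≤ ≤-refl)
          (sym (head-false a i w (s* i as) λ a≤ → all-outside-false a i (one-∈' h) a≤ ≤-refl))

  -- `flipped` arises when the column labelled i + 1 itself receives the letter i + 1: with its
  -- label lowered to i it can take only i, and the other letter passes to a later column. In the
  -- remaining cases the row is `kept`.
  data TwoCase (w as : List ℕ) : Set where
    kept    : valid (s* i w) as ≡ valid w as → valid (s* i w) (s* i as) ≡ false → TwoCase w as
    flipped : valid (s* i w) as ≡ false → valid (s* i w) (s* i as) ≡ valid w as → TwoCase w as

  valid-two : ∀ {w as} → High {i} w → Two {i} as → valid w (s* i as) ≡ false × TwoCase w as
  valid-two [] (here o)    = refl , kept refl refl
  valid-two [] (there o t) = refl , kept refl refl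
  valid-two {b ∷ w} (there ob hw) (here {as} o) =
      trans (cong (valid (b ∷ w)) back) (head-false i b w as f)
    , kept (trans (cong (λ x → not (x <ᵇ suc i) ∧ (all (outside (suc i) x) (s* i as) ∧ valid (s* i w) (s* i as))) (s-out ob))
                  (cong (λ x → not (b <ᵇ suc i) ∧ (all (outside (suc i) b) (s* i as) ∧ x))
                    (trans (proj₂ (valid-one hw o)) (sym (proj₁ (valid-one hw o))))))
           (trans (cong₂ (λ x y → valid (x ∷ s* i w) y) (s-out ob) back) (head-false i b (s* i w) as f))
    where
    back : s i (suc i) ∷ s* i (s* i as) ≡ i ∷ as
    back = cong₂ _∷_ (s-1+i i) (s*-involutive i as)
    f : i ≤ b → all (outside i b) as ≡ false
    f i≤b = all-outside-false i b (one-∈ o) (n≤1+n i) (≤∧≢⇒< i≤b (λ e → proj₁ ob (sym e)))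
  valid-two {b ∷ w} (here nw) (here {as} o) =
      trans (cong (valid (suc i ∷ w)) back)
            (head-false i (suc i) w as λ _ → all-outside-false i (suc i) (one-∈ o) (n≤1+n i) ≤-refl)
    , flipped (trans (cong (λ x → valid (x ∷ s* i w) (suc i ∷ s* i as)) (s-1+i i))
                     (cong (λ x → not x ∧ (all (outside (suc i) i) (s* i as) ∧ valid (s* i w) (s* i as))) (<ᵇ-true (≤-refl {suc i}))))
              (trans (cong₂ (λ x y → valid (x ∷ s* i w) y) (s-1+i i) back)
                     (cong (not (i <ᵇ i) ∧_) (cong₂ _∧_ (all-outside-s as) (valid-absent nw o))))
    where
    back : s i (suc i) ∷ s* i (s* i as) ≡ i ∷ as
    back = cong₂ _∷_ (s-1+i i) (s*-involutive i as)
    outside-s : ∀ c → outside i i c ≡ outside (suc i) (suc i) (s i c)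
    outside-s c with c ≟ i | c ≟ suc i
    ... | yes refl | _        rewrite s-i i = refl
    ... | no _     | yes refl rewrite s-1+i i | <ᵇ-false (n≤1+n i) | <ᵇ-true (≤-refl {suc i}) = refl
    ... | no p     | no q     rewrite s-out (p , q) =
      trans (cong (λ x → outside x x c) (sym (s-1+i i)))
            (trans (outside-s₁ (suc i) (s i (suc i)) (p , q)) (outside-s₂ (suc i) (suc i) (p , q)))
    all-outside-s : ∀ as → all (outside i i) as ≡ all (outside (suc i) (suc i)) (s* i as)
    all-outside-s []       = refl
    all-outside-s (c ∷ as) = cong₂ _∧_ (outside-s c) (all-outside-s as)
  valid-two {b ∷ w} {a ∷ as} (there ob hw) (there oa t) with valid-two hw t
  ... | p , c rewrite s-out oa | all-s₃ oa ob as | p =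
    trans (cong (not (b <ᵇ a) ∧_) (∧-zeroʳ (all (outside a b) as))) (∧-zeroʳ (not (b <ᵇ a))) , go c
    where
    go : TwoCase w as → TwoCase (b ∷ w) (a ∷ as)
    go (kept q r) = kept
      (trans (cong (λ x → not (x <ᵇ a) ∧ (all (outside a x) as ∧ valid (s* i w) as)) (s-out ob))
             (cong (λ x → not (b <ᵇ a) ∧ (all (outside a b) as ∧ x)) q))
      (trans (cong (λ x → not (s i b <ᵇ s i a) ∧ (all (outside (s i a) (s i b)) (s* i as) ∧ x)) r)
             (trans (cong (not (s i b <ᵇ s i a) ∧_) (∧-zeroʳ _)) (∧-zeroʳ _)))
    go (flipped q r) = flipped
      (trans (cong (λ x → not (s i b <ᵇ a) ∧ (all (outside a (s i b)) as ∧ x)) q)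
             (trans (cong (not (s i b <ᵇ a) ∧_) (∧-zeroʳ _)) (∧-zeroʳ _)))
      (trans (cong₂ (λ x y → not (x <ᵇ y) ∧ (all (outside y x) (s* i as) ∧ valid (s* i w) (s* i as))) (s-out ob) (s-out oa))
             (cong₂ (λ x y → not (b <ᵇ a) ∧ (x ∧ y)) (all-s₃ oa ob as) r))
  valid-two {b ∷ w} {a ∷ as} (here nw) (there oa t) rewrite s-out oa =
    f₂ , same₀
    where
    in-s : i ∈ s* i as
    in-s = Any-map⁺ (Any.map (λ { refl → sym (s-1+i i) }) (proj₁ (two-∈ t)))
    f₁ : valid (suc i ∷ w) (a ∷ as) ≡ false
    f₁ = head-false a (suc i) w as λ a≤ → all-outside-false a (suc i) (proj₁ (two-∈ t)) a≤ ≤-refl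
    f₂ : valid (suc i ∷ w) (a ∷ s* i as) ≡ false
    f₂ = head-false a (suc i) w (s* i as) λ a≤ → all-outside-false a (suc i) in-s (below oa a≤) (n≤1+n i)
    same₀ : TwoCase (suc i ∷ w) (a ∷ as)
    same₀ = kept
      (trans (cong (λ x → valid (x ∷ s* i w) (a ∷ as)) (s-1+i i))
        (trans (head-false a i (s* i w) as λ a≤ → all-outside-false a i (proj₂ (two-∈ t)) a≤ ≤-refl) (sym f₁)))
      (trans (cong₂ (λ x y → valid (x ∷ s* i w) (y ∷ s* i as)) (s-1+i i) (s-out oa))
        (head-false a i (s* i w) (s* i as) λ a≤ → all-outside-false a i in-s a≤ ≤-refl))

-- The generating function of sorted columns.

wordSum : List ℕ → ℕ → (List ℕ → ℤ) → ℤ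
wordSum A zero    F = F []
wordSum A (suc k) F = sumL A (λ a → wordSum A k (F ∘ (a ∷_)))

-- ks lists the numbers of boxes in the successive rows
H : ∀ {n} → List ℕ → List ℕ → List ℕ → Poly n
H A []       w = δ
H A (k ∷ ks) w = λ e → wordSum A k (λ as → valid w as ▹ X* as (H A ks as) e)

wordSum-cong : ∀ A k {F F'} → (∀ as → F as ≡ F' as) → wordSum A k F ≡ wordSum A k F'
wordSum-cong A zero    h = h []
wordSum-cong A (suc k) h = sumL-cong A λ a → wordSum-cong A k λ as → h (a ∷ as)

wordSum-+ : ∀ A k F F' → wordSum A k (λ as → F as + F' as) ≡ wordSum A k F + wordSum A k F'
wordSum-+ A zero    F F' = refl
wordSum-+ A (suc k) F F' = trans (sumL-cong A λ a → wordSum-+ A k (F ∘ (a ∷_)) (F' ∘ (a ∷_))) (sumL-+ A _ _)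

X-sumL : ∀ {n} a A (F : ℕ → Poly n) → X a (λ e → sumL A (λ b → F b e)) ≐ λ e → sumL A (λ b → X a (F b) e)
X-sumL a A F e with dec a e
... | just _  = refl
... | nothing = sym (sumL-0 A)

X-wordSum : ∀ {n} a A k (F : List ℕ → Poly n) →
  X a (λ e → wordSum A k (λ as → F as e)) ≐ λ e → wordSum A k (λ as → X a (F as) e)
X-wordSum a A zero    F e = refl
X-wordSum a A (suc k) F e =
  trans (X-sumL a A (λ b e → wordSum A k (λ as → F (b ∷ as) e)) e)
        (sumL-cong A λ b → X-wordSum a A k (F ∘ (b ∷_)) e)

sumL-applyUpTo : ∀ n f (g : ℕ → ℤ) → sumL (applyUpTo f n) g ≡ sumL (upTo n) (g ∘ f)
sumL-applyUpTo zero    f g = refl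
sumL-applyUpTo (suc n) f g = cong (_+_ (g (f 0)))
  (trans (sumL-applyUpTo n (f ∘ suc) g) (sym (sumL-applyUpTo n suc (g ∘ f))))

sumL-s : ∀ {i n} → suc i < n → (g : ℕ → ℤ) → sumL (upTo n) (g ∘ s i) ≡ sumL (upTo n) g
sumL-s {zero} {suc zero} (s≤s ()) g
sumL-s {zero} {suc (suc n)} _ g =
  trans (cong (λ z → g 1 + (g 0 + z)) (trans (sumL-applyUpTo n (suc ∘ suc) (g ∘ s 0)) (sym (sumL-applyUpTo n (suc ∘ suc) g))))
        (exchange-first (g 1) (g 0) _)
  where
  exchange-first : ∀ a b c → a + (b + c) ≡ b + (a + c)
  exchange-first = solve-∀
sumL-s {suc i} {suc n} (s≤s i<n) g = cong (_+_ (g 0))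
  (trans (sumL-applyUpTo n suc (g ∘ s (suc i))) (trans (sumL-s i<n (g ∘ suc)) (sym (sumL-applyUpTo n suc g))))

wordSum-s : ∀ {i n} → suc i < n → ∀ k (F : List ℕ → ℤ) → wordSum (upTo n) k (F ∘ s* i) ≡ wordSum (upTo n) k F
wordSum-s p zero F = refl
wordSum-s {i} {n} p (suc k) F =
  trans (sumL-cong (upTo n) λ a → wordSum-s p k (F ∘ (s i a ∷_)))
        (sumL-s p (λ a → wordSum (upTo n) k (F ∘ (a ∷_))))

swE : ∀ {n} → ℕ → Vec ℕ n → Vec ℕ n
swE zero    (x ∷ y ∷ e) = y ∷ x ∷ e
swE (suc i) (x ∷ e)     = x ∷ swE i e
swE _       e           = e

dec-swE : ∀ {n i} → suc i < n → ∀ a (e : Vec ℕ n) → dec (s i a) (swE i e) ≡ mapᴹ (swE i) (dec a e)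
dec-swE {i = zero} p zero          (zero ∷ y ∷ e)  = refl
dec-swE {i = zero} p zero          (suc x ∷ y ∷ e) = refl
dec-swE {i = zero} p (suc zero)    (x ∷ zero ∷ e)  = refl
dec-swE {i = zero} p (suc zero)    (x ∷ suc y ∷ e) = refl
dec-swE {i = zero} p (suc (suc a)) (x ∷ y ∷ e) with dec a e
... | just _  = refl
... | nothing = refl
dec-swE {i = suc i} (s≤s p) zero    (zero ∷ e)  = refl
dec-swE {i = suc i} (s≤s p) zero    (suc x ∷ e) = refl
dec-swE {i = suc i} (s≤s p) (suc a) (x ∷ e) rewrite dec-swE p a e with dec a e
... | just _  = refl
... | nothing = refl
dec-swE {zero} () a []
dec-swE {suc zero} {zero} (s≤s ()) a (x ∷ [])

-- Multiplication operators and the relation g = ξ f.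

module Operators {n i : ℕ} (i<n : suc i < n) where

  sw : Poly n → Poly n
  sw f e = f (swE i e)

  X-sw : ∀ a f → sw (X (s i a) f) ≐ X a (sw f)
  X-sw a f e rewrite dec-swE i<n a e with dec a e
  ... | just _  = refl
  ... | nothing = refl

  X*-sw : ∀ as f → sw (X* (s* i as) f) ≐ X* as (sw f)
  X*-sw []       f e = refl
  X*-sw (a ∷ as) f e = trans (X-sw a (X* (s* i as) f) e) (X-cong a (X*-sw as f) e)

  Symmetric : Poly n → Set
  Symmetric f = sw f ≐ f

  X₀ X₁ : Poly n → Poly n
  X₀ = X i
  X₁ = X (suc i)

  -- g = ξ f
  Xi : Poly n → Poly n → Set
  Xi g f = ∀ e → X₀ g e - X₁ g e ≡ X₀ f e - X₁ (sw f) e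

  X₀-sw : ∀ f → sw (X₀ f) ≐ X₁ (sw f)
  X₀-sw f e = subst (λ a → sw (X a f) e ≡ X₁ (sw f) e) (s-1+i i) (X-sw (suc i) f e)

  X₁-sw : ∀ f → sw (X₁ f) ≐ X₀ (sw f)
  X₁-sw f e = subst (λ a → sw (X a f) e ≡ X₀ (sw f) e) (s-i i) (X-sw i f e)

  Xi-cong : ∀ {g g' f f'} → g ≐ g' → f ≐ f' → Xi g f → Xi g' f'
  Xi-cong g≐ f≐ h e = trans (sym (cong₂ _-_ (X-cong i g≐ e) (X-cong (suc i) g≐ e)))
    (trans (h e) (cong₂ _-_ (X-cong i f≐ e) (X-cong (suc i) (f≐ ∘ swE i) e)))

  Xi-symmetric : ∀ {f} → Symmetric f → Xi f f
  Xi-symmetric {f} h e = cong (_-_ (X₀ f e)) (sym (X-cong (suc i) h e))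

  zeroP : Poly n
  zeroP _ = 0ℤ

  Xi-half : ∀ {g f} → Xi (λ e → g e + g e) (λ e → f e + f e) → Xi g f
  Xi-half {g} {f} h e = double-cancel (trans (sym (halves g g)) (trans (h e) (halves f (sw f))))
    where
    regroup : ∀ a b → (a + a) - (b + b) ≡ (a - b) + (a - b)
    regroup = solve-∀
    halves : ∀ p q → X₀ (λ e → p e + p e) e - X₁ (λ e → q e + q e) e ≡ (X₀ p e - X₁ q e) + (X₀ p e - X₁ q e)
    halves p q = trans (cong₂ _-_ (X-+ i p p e) (X-+ (suc i) q q e)) (regroup (X₀ p e) (X₁ q e))

  wordSum-- : ∀ A k F F' → wordSum A k (λ as → F as - F' as) ≡ wordSum A k F - wordSum A k F'
  wordSum-- A k F F' = trans (cancel _ _) (cong (_- wordSum A k F')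
      (trans (sym (wordSum-+ A k (λ as → F as - F' as) F')) (wordSum-cong A k λ as → back (F as) (F' as))))
    where
    cancel : ∀ a b → a ≡ (a + b) - b
    cancel = solve-∀
    back : ∀ a b → (a - b) + b ≡ a
    back = solve-∀

  Xi-wordSum : ∀ A k {F F' : List ℕ → Poly n} → (∀ as → Xi (F as) (F' as)) →
    Xi (λ e → wordSum A k (λ as → F as e)) (λ e → wordSum A k (λ as → F' as e))
  Xi-wordSum A k {F} {F'} h e =
    trans (cong₂ _-_ (X-wordSum i A k F e) (X-wordSum (suc i) A k F e))
   (trans (sym (wordSum-- A k (λ as → X₀ (F as) e) (λ as → X₁ (F as) e)))
   (trans (wordSum-cong A k λ as → h as e)
   (trans (wordSum-- A k (λ as → X₀ (F' as) e) (λ as → X₁ (sw (F' as)) e))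
          (sym (cong₂ _-_ (X-wordSum i A k F' e) (X-wordSum (suc i) A k (sw ∘ F') e))))))

  X*-X : ∀ as a (f : Poly n) → X a (X* as f) ≐ X* as (X a f)
  X*-X []       a f e = refl
  X*-X (b ∷ as) a f e = trans (X-comm a b (X* as f) e) (X-cong b (X*-X as a f) e)

  -- ξ commutes with multiplication by polynomials symmetric in x_i, x_{i+1}. The symmetry of the
  -- monomial is expressed by its effect on `sw f`.
  Xi-X* : ∀ as {g f} → X* (s* i as) (sw f) ≐ X* as (sw f) → Xi g f → Xi (X* as g) (X* as f)
  Xi-X* as {g} {f} p h e =
    trans (cong₂ _-_ (X*-X as i g e) (X*-X as (suc i) g e))
   (trans (sym (X*-- as (X₀ g) (X₁ g) e)) (trans (X*-cong as h e) (trans (X*-- as (X₀ f) (X₁ (sw f)) e)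
          (sym (cong₂ _-_ (X*-X as i f e) (trans (X-cong (suc i) swap-as e) (X*-X as (suc i) (sw f) e)))))))
    where
    swap-as : sw (X* as f) ≐ X* as (sw f)
    swap-as e = trans (cong (λ bs → sw (X* bs f) e) (sym (s*-involutive i as)))
                      (trans (X*-sw (s* i as) f e) (p e))

  Symmetric-X* : ∀ as {f} → X* (s* i as) (sw f) ≐ X* as (sw f) → Symmetric f → Symmetric (X* as f)
  Symmetric-X* as {f} p h e = trans (cong (λ bs → sw (X* bs f) e) (sym (s*-involutive i as)))
    (trans (X*-sw (s* i as) f e) (trans (p e) (X*-cong as h e)))

  module _ {h₁ h₂ : Poly n} (sym₁ : Symmetric h₁) (xi : Xi h₁ h₂) where

    -- `h₁` being symmetric, the two products of x_i, x_{i+1} and `h₁` in the numerator of ξ cancel.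
    Xi-zero : Xi zeroP (X₁ h₁)
    Xi-zero e = trans (cong₂ _-_ (X-0 i e) (X-0 (suc i) e)) (sym (trans (cong (_-_ (X₀ (X₁ h₁) e))
        (trans (X-cong (suc i) (λ e → trans (X₁-sw h₁ e) (X-cong i sym₁ e)) e) (sym (X-comm i (suc i) h₁ e)))) (cancel (X₀ (X₁ h₁) e))))
      where
      cancel : ∀ a → a - a ≡ 0ℤ
      cancel = solve-∀

    private
      P : Poly n
      P e = X₁ h₁ e + X₀ h₂ e

    -- Rearranged, `xi` reads x_{i+1} h₁ + x_i h₂ = x_i h₁ + x_{i+1} s(h₂), and s exchanges the two
    -- sides.
    Symmetric-pair : Symmetric P
    Symmetric-pair e = trans (cong₂ _+_ (trans (X₁-sw h₁ e) (X-cong i sym₁ e)) (X₀-sw h₂ e))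
      (rearrange (X₀ h₁ e) (X₁ h₁ e) (X₀ h₂ e) (X₁ (sw h₂) e) (xi e))
      where
      step₁ : ∀ a b c d → (a - b) + b + d ≡ a + d
      step₁ = solve-∀
      step₂ : ∀ a b c d → (c - d) + b + d ≡ b + c
      step₂ = solve-∀
      rearrange : ∀ a b c d → a - b ≡ c - d → a + d ≡ b + c
      rearrange a b c d h = trans (sym (step₁ a b c d)) (trans (cong (λ z → z + b + d) h) (step₂ a b c d))

    -- Multiply `xi` by x_{i+1} and add x_i² h₂ - x_i x_{i+1} h₂ to both sides.
    Xi-pair : Xi P (X₀ h₂)
    Xi-pair e = begin
      X₀ P e - X₁ P e ≡⟨ cong₂ _-_ (X-+ i (X₁ h₁) (X₀ h₂) e) (X-+ (suc i) (X₁ h₁) (X₀ h₂) e) ⟩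
      (X₀ (X₁ h₁) e + X₀ (X₀ h₂) e) - (X₁ (X₁ h₁) e + X₁ (X₀ h₂) e)
        ≡⟨ cong (λ z → (z + X₀ (X₀ h₂) e) - (X₁ (X₁ h₁) e + X₁ (X₀ h₂) e)) (X-comm i (suc i) h₁ e) ⟩
      (X₁ (X₀ h₁) e + X₀ (X₀ h₂) e) - (X₁ (X₁ h₁) e + X₁ (X₀ h₂) e)
        ≡⟨ rearrange (X₁ (X₀ h₁) e) (X₁ (X₁ h₁) e) (X₁ (X₀ h₂) e) (X₁ (X₁ (sw h₂)) e) (X₀ (X₀ h₂) e) shifted ⟩
      X₀ (X₀ h₂) e - X₁ (X₁ (sw h₂)) e ≡⟨ cong (_-_ (X₀ (X₀ h₂) e)) (sym (X-cong (suc i) (X₀-sw h₂) e)) ⟩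
      X₀ (X₀ h₂) e - X₁ (sw (X₀ h₂)) e ∎
      where
      open ≡-Reasoning
      shifted : X₁ (X₀ h₁) e - X₁ (X₁ h₁) e ≡ X₁ (X₀ h₂) e - X₁ (X₁ (sw h₂)) e
      shifted = trans (sym (X-- (suc i) (X₀ h₁) (X₁ h₁) e))
                (trans (X-cong (suc i) xi e) (X-- (suc i) (X₀ h₂) (X₁ (sw h₂)) e))
      step₁ : ∀ a b c d f → (a - b) + (f - c) ≡ (a + f) - (b + c)
      step₁ = solve-∀
      step₂ : ∀ a b c d f → (c - d) + (f - c) ≡ f - d
      step₂ = solve-∀
      rearrange : ∀ a b c d f → a - b ≡ c - d → (a + f) - (b + c) ≡ f - d
      rearrange a b c d f h = trans (sym (step₁ a b c d f)) (trans (cong (_+ (f - c)) h) (step₂ a b c d f))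

module _ {i : ℕ} where
  one-↭ : ∀ {as} → One {i} as → ∃ λ r → All (Out i) r × as ↭ suc i ∷ r × s* i as ↭ i ∷ r
  one-↭ (here {as} h) = as , h , ↭-refl , ↭-reflexive (cong₂ _∷_ (s-1+i i) (s*-none h))
  one-↭ (there {a} oa o) with one-↭ o
  ... | r , h , p , q = a ∷ r , oa ∷ h , ↭-trans (prep a p) (swap a (suc i) refl)
      , ↭-trans (↭-reflexive (cong (_∷ _) (s-out oa))) (↭-trans (prep a q) (swap a i refl))

  two-↭ : ∀ {as} → Two {i} as → s* i as ↭ as
  two-↭ (here {as} o) with one-↭ o
  ... | r , h , p , q = ↭-trans (↭-reflexive (cong₂ _∷_ (s-1+i i) (s*-involutive i as)))
      (↭-trans (prep i p) (↭-trans (swap i (suc i) refl) (prep (suc i) (↭-sym q))))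
  two-↭ (there {a} oa t) = ↭-trans (↭-reflexive (cong (_∷ _) (s-out oa))) (prep a (two-↭ t))

  one-high : ∀ {as} → One {i} as → High {i} as
  one-high (here h)    = here (All.map proj₂ h)
  one-high (there o h) = there o (one-high h)

  one-absent : ∀ {as} → One {i} as → All (_≢ suc i) (s* i as)
  one-absent (here h)    = (λ e → 1+n≢n (trans (sym e) (s-1+i i))) ∷ subst (All (_≢ suc i)) (sym (s*-none h)) (All.map proj₂ h)
  one-absent (there o h) = subst (_≢ suc i) (sym (s-out o)) (proj₂ o) ∷ one-absent h

  two-high : ∀ {as} → Two {i} as → High {i} as
  two-high (here o)    = here (one-absent o)
  two-high (there o t) = there o (two-high t)

  none-high : ∀ {as} → All (Out i) as → High {i} as
  none-high []      = []
  none-high (o ∷ h) = there o (none-high h)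

-- Symmetry and the operator ξ, by induction on the rows.

module _ {n i : ℕ} (i<n : suc i < n) where
  open Operators i<n

  private
    A = upTo n

  δ-sw : Symmetric δ
  δ-sw = go i
    where
    go : ∀ {m} i (e : Vec ℕ m) → δ (swE i e) ≡ δ e
    go zero    []                  = refl
    go zero    (x ∷ [])            = refl
    go zero    (zero ∷ zero ∷ e)   = refl
    go zero    (zero ∷ suc y ∷ e)  = refl
    go zero    (suc x ∷ zero ∷ e)  = refl
    go zero    (suc x ∷ suc y ∷ e) = refl
    go (suc i) []                  = refl
    go (suc i) (zero ∷ e)          = go i e
    go (suc i) (suc x ∷ e)         = refl

  module Step (ks : List ℕ) (w : List ℕ) (hw : High {i} w)
              (ih : ∀ {as} → High {i} as → Symmetric (H A ks as) × Xi (H A ks as) (H A ks (s* i as))) where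

    g : List ℕ → Poly n
    g as = X* as (H A ks as)

    L R : List ℕ → Poly n
    L as e = valid w as ▹ g as e
    R as e = valid (s* i w) as ▹ g as e

    -- The words of a row are treated together with their images under s_i. As s_i permutes all
    -- words, summing over them counts each word twice, and `result` removes the factor 2.
    Good : List ℕ → Set
    Good as = Symmetric (λ e → L as e + L (s* i as) e) ×
              Xi (λ e → L as e + L (s* i as) e) (λ e → R as e + R (s* i as) e)

    weigh : ∀ a b c d as → valid w as ≡ a → valid w (s* i as) ≡ b →
      valid (s* i w) as ≡ c → valid (s* i w) (s* i as) ≡ d →
      Symmetric (λ e → (a ▹ g as e) + (b ▹ g (s* i as) e)) ×
      Xi (λ e → (a ▹ g as e) + (b ▹ g (s* i as) e)) (λ e → (c ▹ g as e) + (d ▹ g (s* i as) e)) → Good as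
    weigh a b c d as refl refl refl refl h = h

    +-zeroʳ : ∀ (f : Poly n) → f ≐ λ e → f e + 0ℤ
    +-zeroʳ f e = sym (+-identityʳ (f e))

    +-zeroˡ : ∀ (f : Poly n) → f ≐ λ e → 0ℤ + f e
    +-zeroˡ f e = sym (+-identityˡ (f e))

    good-flip-sum : ∀ {as} → Good (s* i as) → Good as
    good-flip-sum {as} (p , q) =
        (λ e → trans (flip-sum L (swE i e)) (trans (p e) (sym (flip-sum L e))))
      , Xi-cong (λ e → sym (flip-sum L e)) (λ e → sym (flip-sum R e)) q
      where
      flip-sum : ∀ (F : List ℕ → Poly n) e → F as e + F (s* i as) e ≡ F (s* i as) e + F (s* i (s* i as)) e
      flip-sum F e = trans (+-comm (F as e) _) (cong (λ bs → F (s* i as) e + F bs e) (sym (s*-involutive i as)))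

    good-none : ∀ {as} → All (Out i) as → Good as
    good-none {as} h = weigh β β β β as refl (cong (valid w) fixed) (valid-none w h)
        (trans (cong (valid (s* i w)) fixed) (valid-none w h)) (both , Xi-symmetric both)
      where
      β = valid w as
      fixed = s*-none h
      sym-g : Symmetric (g as)
      sym-g = Symmetric-X* as (λ e → cong (λ bs → X* bs (sw (H A ks as)) e) fixed) (proj₁ (ih (none-high h)))
      sym-g' : Symmetric (g (s* i as))
      sym-g' = subst (λ bs → Symmetric (g bs)) (sym fixed) sym-g
      both : Symmetric (λ e → (β ▹ g as e) + (β ▹ g (s* i as) e))
      both e = cong₂ (λ x y → (β ▹ x) + (β ▹ y)) (sym-g e) (sym-g' e)

    good-bad : ∀ {as} → Repeated as → Good as
    good-bad {as} r = weigh false false false false as (valid-repeated r w) (valid-repeated (repeated-s* r) w)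
      (valid-repeated r (s* i w)) (valid-repeated (repeated-s* r) (s* i w)) ((λ e → refl) , Xi-symmetric (λ e → refl))

    -- Apart from the common letters `r`, the pair contributes x_{i+1} h₁ + x_i h₂ with h₁ = ξ h₂
    -- symmetric. `valid-one` leaves the weight `ρ` of x_{i+1} h₁ on the `R` side undetermined,
    -- which is harmless because ξ kills that summand.
    good-one : ∀ {as} → One {i} as → Good as
    good-one {as} o with one-↭ o | valid-one hw o
    ... | r , nr , p , q | v₁ , v₂ = weigh β β ρ β as refl v₁ refl v₂ (go β ρ)
      where
      β = valid w as
      ρ = valid (s* i w) as
      fixed : ∀ {f : Poly n} → X* (s* i r) f ≐ X* r f
      fixed {f} e = cong (λ bs → X* bs f e) (s*-none nr)
      h₁ h₂ : Poly n
      h₁ = X* r (H A ks as)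
      h₂ = X* r (H A ks (s* i as))
      sym₁ : Symmetric h₁
      sym₁ = Symmetric-X* r fixed (proj₁ (ih (one-high o)))
      xi : Xi h₁ h₂
      xi = Xi-X* r fixed (proj₂ (ih (one-high o)))
      g₁ : X₁ h₁ ≐ g as
      g₁ e = sym (X*-↭ (H A ks as) p e)
      g₂ : X₀ h₂ ≐ g (s* i as)
      g₂ e = sym (X*-↭ (H A ks (s* i as)) q e)
      sum≐ : (λ e → X₁ h₁ e + X₀ h₂ e) ≐ (λ e → g as e + g (s* i as) e)
      sum≐ e = cong₂ _+_ (g₁ e) (g₂ e)
      sym-sum : Symmetric (λ e → g as e + g (s* i as) e)
      sym-sum e = trans (sym (sum≐ (swE i e))) (trans (Symmetric-pair sym₁ xi e) (sum≐ e))
      low : Xi (λ e → g as e + g (s* i as) e) (g (s* i as))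
      low = Xi-cong sum≐ g₂ (Xi-pair sym₁ xi)
      nil : Xi zeroP (g as)
      nil = Xi-cong (λ _ → refl) g₁ (Xi-zero sym₁ xi)
      go : ∀ β ρ → Symmetric (λ e → (β ▹ g as e) + (β ▹ g (s* i as) e)) ×
        Xi (λ e → (β ▹ g as e) + (β ▹ g (s* i as) e)) (λ e → (ρ ▹ g as e) + (β ▹ g (s* i as) e))
      go true  true  = sym-sum , Xi-symmetric sym-sum
      go true  false = sym-sum , Xi-cong (λ _ → refl) (+-zeroˡ _) low
      go false true  = (λ _ → refl) , Xi-cong (λ _ → refl) (+-zeroʳ _) nil
      go false false = (λ _ → refl) , Xi-symmetric (λ _ → refl)

    -- The monomial contains x_i and x_{i+1} once each and is symmetric. If the row is kept, both
    -- sides are the same symmetric polynomial; if it is flipped, the word s_i `as` replaces `as`,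
    -- and the induction hypothesis relates the rows above.
    good-two : ∀ {as} → Two {i} as → Good as
    good-two {as} t with valid-two hw t
    ... | v , kept p q = weigh β false β false as refl v p q (go β)
      where
      β = valid w as
      sym-g : Symmetric (g as)
      sym-g = Symmetric-X* as (X*-↭ (sw (H A ks as)) (two-↭ t)) (proj₁ (ih (two-high t)))
      go : ∀ β → Symmetric (λ e → (β ▹ g as e) + 0ℤ) × Xi (λ e → (β ▹ g as e) + 0ℤ) (λ e → (β ▹ g as e) + 0ℤ)
      go β = sym' , Xi-symmetric sym'
        where
        sym' : Symmetric (λ e → (β ▹ g as e) + 0ℤ)
        sym' e = cong (λ x → (β ▹ x) + 0ℤ) (sym-g e)
    ... | v , flipped p q = weigh β false false β as refl v p q (go β)
      where
      β = valid w as
      sym-g : Symmetric (g as)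
      sym-g = Symmetric-X* as (X*-↭ (sw (H A ks as)) (two-↭ t)) (proj₁ (ih (two-high t)))
      xi : Xi (g as) (g (s* i as))
      xi = Xi-cong (λ _ → refl) (λ e → sym (X*-↭ (H A ks (s* i as)) (two-↭ t) e))
             (Xi-X* as (X*-↭ (sw (H A ks (s* i as))) (two-↭ t)) (proj₂ (ih (two-high t))))
      go : ∀ β → Symmetric (λ e → (β ▹ g as e) + 0ℤ) × Xi (λ e → (β ▹ g as e) + 0ℤ) (λ e → 0ℤ + (β ▹ g (s* i as) e))
      go true  = (λ e → cong (_+ 0ℤ) (sym-g e)) , Xi-cong (+-zeroʳ _) (+-zeroˡ _) xi
      go false = (λ _ → refl) , Xi-symmetric (λ _ → refl)

    good : ∀ as → Good as
    good as with kind {i} as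
    ... | none-kind h = good-none h
    ... | one-kind  h = good-one h
    ... | one'-kind h = good-flip-sum {as} (good-one h)
    ... | two-kind  h = good-two h
    ... | two'-kind h = good-flip-sum {as} (good-two h)
    ... | bad-kind  h = good-bad h

    doubled : ∀ k (F : List ℕ → Poly n) e →
      wordSum A k (λ as → F as e + F (s* i as) e) ≡ wordSum A k (λ as → F as e) + wordSum A k (λ as → F as e)
    doubled k F e = trans (wordSum-+ A k _ _) (cong (_+_ (wordSum A k (λ as → F as e))) (wordSum-s i<n k (λ as → F as e)))

    result : ∀ k → Symmetric (H A (k ∷ ks) w) × Xi (H A (k ∷ ks) w) (H A (k ∷ ks) (s* i w))
    result k =
        (λ e → double-cancel (trans (sym (doubled k L (swE i e)))
                 (trans (wordSum-cong A k λ as → proj₁ (good as) e) (doubled k L e))))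
      , Xi-half (Xi-cong (doubled k L) (doubled k R) (Xi-wordSum A k (λ as → proj₂ (good as))))

  -- Valid rows over `High` labels lead to labels for which the hypothesis is available again, up to
  -- the image under s_i; this closes the induction.
  demazure : ∀ ks {w} → High {i} w → Symmetric (H A ks w) × Xi (H A ks w) (H A ks (s* i w))
  demazure []       hw = δ-sw , Xi-symmetric δ-sw
  demazure (k ∷ ks) hw = Step.result ks _ hw (demazure ks) k

-- Sorting the columns

Decreasing : List Col → Set
Decreasing = AllPairs (λ c d → proj₁ d ≤ proj₁ c)

heights labels : List Col → List ℕ
heights = map proj₁
labels  = map proj₂

active : List ℕ → ℕ
active []           = 0
active (zero ∷ hs)  = active hs
active (suc h ∷ hs) = suc (active hs)

lowered : List ℕ → List ℕ
lowered []           = []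
lowered (zero ∷ hs)  = lowered hs
lowered (suc h ∷ hs) = h ∷ lowered hs

rowLengths : ℕ → List ℕ → List ℕ
rowLengths zero    hs = []
rowLengths (suc k) hs = active hs ∷ rowLengths k (lowered hs)

attach : List Col → List ℕ → List Cell
attach ((zero  , b) ∷ cs) as       = idle b ∷ attach cs as
attach ((suc h , b) ∷ cs) (a ∷ as) = move h b a ∷ attach cs as
attach _                  _        = []

rowSum-wordSum : ∀ A cs F → rowSum A cs F ≡ wordSum A (active (heights cs)) (F ∘ attach cs)
rowSum-wordSum A []                 F = refl
rowSum-wordSum A ((zero  , b) ∷ cs) F = rowSum-wordSum A cs (F ∘ (idle b ∷_))
rowSum-wordSum A ((suc h , b) ∷ cs) F = sumL-cong A λ a → rowSum-wordSum A cs (F ∘ (move h b a ∷_))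

wordSum-cong-length : ∀ A k {F F'} → (∀ as → length as ≡ k → F as ≡ F' as) → wordSum A k F ≡ wordSum A k F'
wordSum-cong-length A zero    h = h [] refl
wordSum-cong-length A (suc k) h = sumL-cong A λ a → wordSum-cong-length A k λ as eq → h (a ∷ as) (cong suc eq)

letters-attach : ∀ cs as → length as ≡ active (heights cs) → letters (attach cs as) ≡ as
letters-attach []                 []       eq = refl
letters-attach ((zero  , b) ∷ cs) as       eq = letters-attach cs as eq
letters-attach ((suc h , b) ∷ cs) (a ∷ as) eq = cong (a ∷_) (letters-attach cs as (cong pred eq))

next-heights : ∀ cs as → length as ≡ active (heights cs) → heights (next (attach cs as)) ≡ lowered (heights cs)
next-heights []                 []       eq = refl
next-heights ((zero  , b) ∷ cs) as       eq = next-heights cs as eq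
next-heights ((suc h , b) ∷ cs) (a ∷ as) eq = cong (h ∷_) (next-heights cs as (cong pred eq))

next-labels : ∀ cs as → length as ≡ active (heights cs) → labels (next (attach cs as)) ≡ as
next-labels []                 []       eq = refl
next-labels ((zero  , b) ∷ cs) as       eq = next-labels cs as eq
next-labels ((suc h , b) ∷ cs) (a ∷ as) eq = cong (a ∷_) (next-labels cs as (cong pred eq))

next-decreasing : ∀ cs as → Decreasing cs → Decreasing (next (attach cs as))
next-decreasing [] as d = []
next-decreasing ((zero  , b) ∷ cs) as       (_ ∷ d) = next-decreasing cs as d
next-decreasing ((suc h , b) ∷ cs) []       (_ ∷ d) = []
next-decreasing ((suc h , b) ∷ cs) (a ∷ as) (p ∷ d) = go cs as p ∷ next-decreasing cs as d
  where
  go : ∀ cs as → All (λ c → proj₁ c ≤ suc h) cs → All (λ c → proj₁ c ≤ h) (next (attach cs as))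
  go [] as p = []
  go ((zero  , b) ∷ cs) as       (_ ∷ p)       = go cs as p
  go ((suc h , b) ∷ cs) []       p             = []
  go ((suc h , b) ∷ cs) (a ∷ as) (s≤s q ∷ p)   = q ∷ go cs as p

inactive : ∀ {cs} → All (λ c → proj₁ c ≤ 0) cs → active (heights cs) ≡ 0
inactive []        = refl
inactive (z≤n ∷ p) = inactive p

okRow-idle : ∀ {cs} → All (λ c → proj₁ c ≤ 0) cs → ∀ as → okRow (attach cs as) ≡ true
okRow-idle [] as = refl
okRow-idle (_∷_ {zero , b} z≤n p) as = cong₂ _∧_ (alls p) (okRow-idle p as)
  where
  alls : ∀ {cs} → All (λ c → proj₁ c ≤ 0) cs → all (ok (idle b)) (attach cs as) ≡ true
  alls []         = refl
  alls (z≤n ∷ p)  = alls p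

ok-outside : ∀ {h h'} b a b' a' → h' ≤ h → (b <ᵇ a) ≡ false →
  ok (move h b a) (move h' b' a') ≡ outside a b a'
ok-outside {h} {h'} b a b' a' h'≤h p rewrite <ᵇ-false {h} {h'} h'≤h = ⇔ᵇ-elim (⇛-elim
  (order-tautology 3 (λ c → let lt = λ i j → lookup (lookup c i) j in
     not (lt 0F 1F) ⇛ (apart lt 1F 2F ∧ not (openClosed lt 1F 2F 0F) ⇔ᵇ not (not (lt 2F 1F) ∧ not (lt 0F 2F))))
     refl (b ∷ a ∷ a' ∷ [])) (not-intro p))

okRow-valid : ∀ cs as → Decreasing cs → length as ≡ active (heights cs) →
  okRow (attach cs as) ≡ valid (labels cs) as
okRow-valid [] [] d eq = refl
okRow-valid ((zero , b) ∷ cs) as (p ∷ d) eq = trans (okRow-idle (z≤n ∷ p) as)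
  (cong (valid (b ∷ labels cs)) (sym (nil as (trans eq (inactive p)))))
  where
  nil : ∀ as → length as ≡ 0 → as ≡ []
  nil [] _ = refl
okRow-valid ((suc h , b) ∷ cs) (a ∷ as) (p ∷ d) eq with b <ᵇ a in le
... | true  = refl
... | false = cong₂ _∧_ (go cs as p (cong pred eq)) (okRow-valid cs as d (cong pred eq))
  where
  go : ∀ cs as → All (λ c → proj₁ c ≤ suc h) cs → length as ≡ active (heights cs) →
    all (ok (move h b a)) (attach cs as) ≡ all (outside a b) as
  go []                  []         p         eq = refl
  go ((zero , b')  ∷ cs) as         (_ ∷ p)   eq = go cs as p eq
  go ((suc h' , b') ∷ cs) (a' ∷ as) (s≤s q ∷ p) eq =
    cong₂ _∧_ (ok-outside b a b' a' q le) (go cs as p (cong pred eq))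

-- In a list of decreasing heights the right column of each pair is at least as high as the left
-- one, so `pair` always takes the same branch and no longer sees heights. What is left of them is
-- the number of boxes in each row.
G-decreasing : ∀ {n} A k cs → Decreasing cs →
  G {n} A k cs ≐ H A (rowLengths k (heights cs)) (labels cs)
G-decreasing A zero    cs d e = refl
G-decreasing A (suc k) cs d e = trans (rowSum-wordSum A cs _)
  (wordSum-cong-length A (active (heights cs)) λ as eq →
    cong₂ _▹_ (okRow-valid cs as d eq)
      (trans (cong (λ bs → X* bs (G A k (next (attach cs as))) e) (letters-attach cs as eq))
             (X*-cong as (λ e → trans (G-decreasing A k (next (attach cs as)) (next-decreasing cs as d) e)
               (cong₂ (λ hs ws → H A (rowLengths k hs) ws e) (next-heights cs as eq) (next-labels cs as eq))) e)))

insert : Col → List Col → List Col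
insert c []      = c ∷ []
insert c (d ∷ T) = if proj₁ c <ᵇ proj₁ d then d ∷ insert c T else c ∷ d ∷ T

sort : List Col → List Col
sort = foldr insert []

insert-↭ : ∀ c T → insert c T ↭ c ∷ T
insert-↭ c []      = ↭-refl
insert-↭ c (d ∷ T) with proj₁ c <ᵇ proj₁ d
... | true  = ↭-trans (prep d (insert-↭ c T)) (swap d c refl)
... | false = ↭-refl

sort-↭ : ∀ T → sort T ↭ T
sort-↭ []      = ↭-refl
sort-↭ (c ∷ T) = ↭-trans (insert-↭ c (sort T)) (prep c (sort-↭ T))

insert-decreasing : ∀ c {T} → Decreasing T → Decreasing (insert c T)
insert-decreasing c []                = [] ∷ []
insert-decreasing c (_∷_ {d} {T} p q) with proj₁ c <ᵇ proj₁ d in eq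
... | true  = All-resp-↭ (↭-sym (insert-↭ c T)) (<⇒≤ (<ᵇ-true⁻ {proj₁ c} {proj₁ d} eq) ∷ p) ∷ insert-decreasing c q
... | false = (<ᵇ-false⁻ {proj₁ c} {proj₁ d} eq ∷ All.map (λ r → ≤-trans r (<ᵇ-false⁻ {proj₁ c} {proj₁ d} eq)) p) ∷ (p ∷ q)

sort-decreasing : ∀ T → Decreasing (sort T)
sort-decreasing []      = []
sort-decreasing (c ∷ T) = insert-decreasing c (sort-decreasing T)

Distinct : List Col → Set
Distinct = AllPairs (λ c d → proj₂ c ≢ proj₂ d)

distinct-↭ : ∀ {S T} → S ↭ T → Distinct S → Distinct T
distinct-↭ refl         d                   = d
distinct-↭ (prep x p)   (h ∷ d)             = All-resp-↭ p h ∷ distinct-↭ p d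
distinct-↭ (swap x y p) ((h ∷ h₁) ∷ h₂ ∷ d) =
  ((λ e → h (sym e)) ∷ All-resp-↭ p h₂) ∷ All-resp-↭ p h₁ ∷ distinct-↭ p d
distinct-↭ (↭-trans p q) d                  = distinct-↭ q (distinct-↭ p d)

apart-≢ : ∀ {b u} → u ≢ b → apart _<ᵇ_ b u ≡ true
apart-≢ {b} {u} h with <-cmp b u
... | tri< b<u _ _  rewrite <ᵇ-true b<u = refl
... | tri≈ _ refl _ = ⊥-elim (h refl)
... | tri> _ _ u<b  rewrite <ᵇ-true u<b = ∨-trueʳ (b <ᵇ u)
  where
  ∨-trueʳ : ∀ x → x ∨ true ≡ true
  ∨-trueʳ true  = refl
  ∨-trueʳ false = refl

-- The list runs from right to left, so before the exchange the higher column is on the left with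
-- the smaller label: this is the first law.
G-swap : ∀ {n} A k P T {h h' v u} → h < h' → h' ≤ k → u < v → Distinct (P ++ (h , v) ∷ (h' , u) ∷ T) →
  G {n} A k (P ++ (h , v) ∷ (h' , u) ∷ T) ≐ G A k (P ++ (h' , u) ∷ (h , v) ∷ T)
G-swap {n} A k P T {h} {h'} {v} {u} h<h' h'≤k u<v d =
  ordered-at d'
  where
  d' : Distinct ((h , v) ∷ (h' , u) ∷ (P ++ T))
  d' = distinct-↭ (↭-trans (shift (h , v) P ((h' , u) ∷ T)) (prep (h , v) (shift (h' , u) P T))) d
  ordered-at : Distinct ((h , v) ∷ (h' , u) ∷ (P ++ T)) →
    G {n} A k (P ++ (h , v) ∷ (h' , u) ∷ T) ≐ G A k (P ++ (h' , u) ∷ (h , v) ∷ T)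
  ordered-at ((_ ∷ dv) ∷ du ∷ _) = SwapLaws.ordered
    (swap-laws n A k P T h<h' h'≤k (All-tag P (All.map apart-≢ du)) (All-tag P (All.map apart-≢ dv)))
    (<ᵇ-true u<v)

-- `c` moves left past columns that are higher and have smaller labels, each step being one
-- `G-swap`. `P` holds the columns to the right, among them those already passed.
G-insert : ∀ {n} A k P c T → Distinct (P ++ c ∷ T) → All (λ d → proj₂ d < proj₂ c) T → All (λ d → proj₁ d ≤ k) T →
  G {n} A k (P ++ c ∷ T) ≐ G A k (P ++ insert c T)
G-insert A k P c []      d l b e = refl
G-insert A k P c (x ∷ T) d (l ∷ ls) (b ∷ bs) e with proj₁ c <ᵇ proj₁ x in eq
... | false = refl
... | true  = trans (G-swap A k P T (<ᵇ-true⁻ {proj₁ c} {proj₁ x} eq) b l d e)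
   (trans (cong (λ S → G A k S e) (sym (++-assoc P (x ∷ []) (c ∷ T))))
   (trans (G-insert A k (P ++ x ∷ []) c T (distinct-↭ moved d) ls bs e)
          (cong (λ S → G A k S e) (++-assoc P (x ∷ []) (insert c T)))))
  where
  moved : P ++ c ∷ x ∷ T ↭ (P ++ x ∷ []) ++ c ∷ T
  moved = ↭-trans (↭-++⁺ˡ P (swap c x refl)) (↭-reflexive (sym (++-assoc P (x ∷ []) (c ∷ T))))

G-sort : ∀ {n} A k P T → Distinct (P ++ T) → AllPairs (λ c d → proj₂ d < proj₂ c) T → All (λ d → proj₁ d ≤ k) T →
  G {n} A k (P ++ T) ≐ G A k (P ++ sort T)
G-sort A k P []      d l b e = refl
G-sort A k P (c ∷ T) d (l ∷ ls) (b ∷ bs) e =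
   trans (cong (λ S → G A k S e) (sym (++-assoc P (c ∷ []) T)))
  (trans (G-sort A k (P ++ c ∷ []) T (subst Distinct (sym (++-assoc P (c ∷ []) T)) d) ls bs e)
  (trans (cong (λ S → G A k S e) (++-assoc P (c ∷ []) (sort T)))
         (G-insert A k P c (sort T) (distinct-↭ (↭-++⁺ˡ P (prep c (↭-sym (sort-↭ T)))) d)
            (All-resp-↭ (↭-sym (sort-↭ T)) l) (All-resp-↭ (↭-sym (sort-↭ T)) bs) e)))

relabel : ℕ → List Col → List Col
relabel i = map (λ (h , b) → h , s i b)

insert-relabel : ∀ i h b T → relabel i (insert (h , b) T) ≡ insert (h , s i b) (relabel i T)
insert-relabel i h b []      = refl
insert-relabel i h b (d ∷ T) with h <ᵇ proj₁ d
... | true  = cong (_ ∷_) (insert-relabel i h b T)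
... | false = refl

-- Different heights leave no tie for the order of insertion to decide.
insert-comm : ∀ {h h'} → h < h' → ∀ b b' T → insert (h , b) (insert (h' , b') T) ≡ insert (h' , b') (insert (h , b) T)
insert-comm {h} {h'} p b b' [] rewrite <ᵇ-true p | <ᵇ-false (<⇒≤ p) = refl
insert-comm {h} {h'} p b b' (d ∷ T) with h' <ᵇ proj₁ d in eq
... | true  rewrite <ᵇ-true (<-trans p (<ᵇ-true⁻ {h'} {proj₁ d} eq)) | eq = cong (d ∷_) (insert-comm p b b' T)
... | false with h <ᵇ proj₁ d in eq'
...   | true  rewrite eq | <ᵇ-true p = refl
...   | false rewrite <ᵇ-true p | <ᵇ-false (<⇒≤ p) = refl

high-insert-out : ∀ {i h b} → Out i b → ∀ {T} → High {i} (labels T) → High {i} (labels (insert (h , b) T))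
high-insert-out ob {[]} hT = there ob []
high-insert-out {i} {h} {b} ob {d ∷ T} hT with h <ᵇ proj₁ d
... | false = there ob hT
... | true with hT
...   | there od hT' = there od (high-insert-out ob hT')
...   | here nT      = here (go T nT)
  where
  go : ∀ T → All (_≢ suc i) (labels T) → All (_≢ suc i) (labels (insert (h , b) T))
  go []      n        = proj₂ ob ∷ []
  go (d ∷ T) (p ∷ n) with h <ᵇ proj₁ d
  ... | true  = p ∷ go T n
  ... | false = proj₂ ob ∷ (p ∷ n)

high-insert-top : ∀ {i h} T → All (λ d → proj₂ d ≢ suc i × (h < proj₁ d → Out i (proj₂ d))) T →
  High {i} (labels (insert (h , suc i) T))
high-insert-top []      p = here []
high-insert-top {i} {h} (d ∷ T) (p ∷ ps) with h <ᵇ proj₁ d in eq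
... | true  = there (proj₂ p (<ᵇ-true⁻ {h} {proj₁ d} eq)) (high-insert-top T ps)
... | false = here (proj₁ p ∷ go ps)
  where
  go : ∀ {T} → All (λ d → proj₂ d ≢ suc i × (h < proj₁ d → Out i (proj₂ d))) T → All (_≢ suc i) (labels T)
  go []       = []
  go (q ∷ qs) = proj₁ q ∷ go qs

module _ {i : ℕ} (R L : List Col) {x y : ℕ} (y<x : y < x)
         (oR : All (λ c → Out i (proj₂ c)) R) (oL : All (λ c → Out i (proj₂ c)) L) where

  private
    relabel-out : ∀ {T} → All (λ c → Out i (proj₂ c)) T → relabel i T ≡ T
    relabel-out []       = refl
    relabel-out (o ∷ os) = cong₂ _∷_ (cong (_ ,_) (s-out o)) (relabel-out os)

    oS : All (λ c → Out i (proj₂ c)) (sort L)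
    oS = All-resp-↭ (↭-sym (sort-↭ L)) oL

  -- The heights x and y differ, so sorting brings the two columns to the same places in both lists
  -- and only the labels i and i + 1 are interchanged.
  sort-relabel : sort (R ++ (y , suc i) ∷ (x , i) ∷ L) ≡ relabel i (sort (R ++ (x , suc i) ∷ (y , i) ∷ L))
  sort-relabel = sym (go R oR)
    where
    base : relabel i (insert (x , suc i) (insert (y , i) (sort L))) ≡ insert (y , suc i) (insert (x , i) (sort L))
    base rewrite insert-relabel i x (suc i) (insert (y , i) (sort L)) | insert-relabel i y i (sort L)
               | relabel-out oS | s-i i | s-1+i i = sym (insert-comm y<x (suc i) i (sort L))
    go : ∀ R → All (λ c → Out i (proj₂ c)) R →
      relabel i (sort (R ++ (x , suc i) ∷ (y , i) ∷ L)) ≡ sort (R ++ (y , suc i) ∷ (x , i) ∷ L)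
    go []      []       = base
    go ((h , b) ∷ R) (o ∷ os) = trans (insert-relabel i h b (sort (R ++ (x , suc i) ∷ (y , i) ∷ L)))
      (cong₂ (λ c T → insert (h , c) T) (s-out o) (go R os))

  -- The column of height x is sorted before that of height y, and it carries the label i + 1.
  sort-high : High {i} (labels (sort (R ++ (x , suc i) ∷ (y , i) ∷ L)))
  sort-high = go R oR
    where
    T = insert (y , i) (sort L)
    allowed : All (λ d → proj₂ d ≢ suc i × (x < proj₁ d → Out i (proj₂ d))) T
    allowed = All-resp-↭ (↭-sym (insert-↭ (y , i) (sort L)))
      (((λ e → <-irrefl e (n<1+n i)) , (λ x<y → ⊥-elim (<⇒≯ x<y y<x)))
      ∷ All.map (λ o → proj₂ o , (λ _ → o)) oS)
    go : ∀ R → All (λ c → Out i (proj₂ c)) R → High {i} (labels (sort (R ++ (x , suc i) ∷ (y , i) ∷ L)))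
    go []      []       = high-insert-top T allowed
    go (c ∷ R) (o ∷ os) = high-insert-out o (go R os)

-- Dominant compositions

columns : ℕ → List ℕ → List Col
columns j []      = []
columns j (x ∷ α) = columns (suc j) α ++ (x , j) ∷ []

columns-≥ : ∀ j α → All (λ c → j ≤ proj₂ c) (columns j α)
columns-≥ j []      = []
columns-≥ j (x ∷ α) = All-++⁺ (All.map (≤-trans (n≤1+n j)) (columns-≥ (suc j) α)) (≤-refl ∷ [])

columns-labels : ∀ j α → AllPairs (λ c d → proj₂ d < proj₂ c) (columns j α)
columns-labels j []      = []
columns-labels j (x ∷ α) = AllPairs-++⁺ (columns-labels (suc j) α) ([] ∷ [])
  (All.map (λ p → p ∷ []) (columns-≥ (suc j) α))

columns-distinct : ∀ j α → Distinct (columns j α)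
columns-distinct j α = AllPairs.map (λ p e → <-irrefl (sym e) p) (columns-labels j α)

columns-heights : ∀ {P : ℕ → Set} j {α} → All P α → All (λ c → P (proj₁ c)) (columns j α)
columns-heights j []       = []
columns-heights j (p ∷ ps) = All-++⁺ (columns-heights (suc j) ps) (p ∷ [])

-- The row of the only filling of a dominant shape: every box repeats the label below it.
identity : List Col → List Cell
identity []                 = []
identity ((zero  , b) ∷ cs) = idle b ∷ identity cs
identity ((suc h , b) ∷ cs) = move h b b ∷ identity cs

identity-++ : ∀ cs ds → identity (cs ++ ds) ≡ identity cs ++ identity ds
identity-++ []                 ds = refl
identity-++ ((zero  , b) ∷ cs) ds = cong (_ ∷_) (identity-++ cs ds)
identity-++ ((suc h , b) ∷ cs) ds = cong (_ ∷_) (identity-++ cs ds)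

okRow-identity : ∀ {cs} → Distinct cs → okRow (identity cs) ≡ true
okRow-identity [] = refl
okRow-identity (_∷_ {zero , b} {cs} p d) = cong₂ _∧_ (go cs) (okRow-identity d)
  where
  go : ∀ cs → all (ok (idle b)) (identity cs) ≡ true
  go []                  = refl
  go ((zero   , b') ∷ cs) = go cs
  go ((suc h' , b') ∷ cs) with b <ᵇ b'
  ... | true  = go cs
  ... | false = go cs
okRow-identity (_∷_ {suc h , b} {cs} p d) =
  cong₂ _∧_ (cong not (<ᵇ-false (≤-refl {b}))) (cong₂ _∧_ (go cs p) (okRow-identity d))
  where
  go : ∀ cs → All (λ d → b ≢ proj₂ d) cs → all (ok (move h b b)) (identity cs) ≡ true
  go []                   []       = refl
  go ((zero   , b') ∷ cs) (_ ∷ ps) = go cs ps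
  go ((suc h' , b') ∷ cs) (p ∷ ps) rewrite apart-≢ (λ e → p (sym e)) with h <ᵇ h' | b <ᵇ b'
  ... | true  | true  = go cs ps
  ... | true  | false = go cs ps
  ... | false | true  = go cs ps
  ... | false | false = go cs ps

sumL-single : ∀ {n b} → b < n → (f : ℕ → ℤ) → (∀ a → a ≢ b → f a ≡ 0ℤ) → sumL (upTo n) f ≡ f b
sumL-single {suc n} {zero}  _       f h = trans (cong (_+_ (f 0))
  (trans (sumL-applyUpTo n suc f) (trans (sumL-cong (upTo n) (λ a → h (suc a) λ ())) (sumL-0 (upTo n))))) (+-identityʳ _)
sumL-single {suc n} {suc b} (s≤s p) f h = trans (cong₂ _+_ (h 0 λ ())
  (trans (sumL-applyUpTo n suc f) (sumL-single p (f ∘ suc) (λ a q → h (suc a) (λ e → q (suc-injective e)))))) (+-identityˡ _)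

rowSum-0 : ∀ A cs {F} → (∀ r → map col r ≡ cs → F r ≡ 0ℤ) → rowSum A cs F ≡ 0ℤ
rowSum-0 A []                 h = h [] refl
rowSum-0 A ((zero  , b) ∷ cs) h = rowSum-0 A cs (λ r e → h _ (cong (_ ∷_) e))
rowSum-0 A ((suc _ , b) ∷ cs) h =
  trans (sumL-cong A λ a → rowSum-0 A cs (λ r e → h _ (cong (_ ∷_) e))) (sumL-0 A)

rowSum-single : ∀ {n} cs {F} → All (λ c → proj₂ c < n) cs →
  (∀ r → map col r ≡ cs → r ≢ identity cs → F r ≡ 0ℤ) → rowSum (upTo n) cs F ≡ F (identity cs)
rowSum-single []                 []       h = refl
rowSum-single ((zero  , b) ∷ cs) (_ ∷ ps) h =
  rowSum-single cs ps (λ r e q → h _ (cong (_ ∷_) e) (λ e → q (∷-injectiveʳ e)))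
rowSum-single {n} ((suc x , b) ∷ cs) {F} (p ∷ ps) h =
  trans (sumL-single p _ (λ a a≢b → rowSum-0 (upTo n) cs (λ r e → h _ (cong (_ ∷_) e) (λ e → a≢b (moved e)))))
        (rowSum-single cs ps (λ r e q → h _ (cong (_ ∷_) e) (λ e → q (∷-injectiveʳ e))))
  where
  moved : ∀ {a} {r s : List Cell} → _≡_ {A = List Cell} (move x b a ∷ r) (move x b b ∷ s) → a ≡ b
  moved refl = refl

okRow-snoc : ∀ r c → okRow (r ++ c ∷ []) ≡ true →
  okRow r ≡ true × fit c ≡ true × All (λ z → ok z c ≡ true) r
okRow-snoc []      c h = refl , proj₁ (∧-elim h) , []
okRow-snoc (x ∷ r) c h with ∧-elim {fit x} h
... | f , g with ∧-elim {all (ok x) (r ++ c ∷ [])} (trans refl g)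
... | o , g' with okRow-snoc r c g' | ∧-elim {all (ok x) r} (trans (sym (all-++ (ok x) r (c ∷ []))) o)
... | p , q , s | o₁ , o₂ = ∧-intro f (∧-intro o₁ p) , q , proj₁ (∧-elim o₂) ∷ s

unsnoc-row : ∀ r {cs d} → map col r ≡ cs ++ d ∷ [] → ∃₂ λ r' c → r ≡ r' ++ c ∷ [] × map col r' ≡ cs × col c ≡ d
unsnoc-row (c ∷ [])     {[]}     refl = [] , c , refl , refl , refl
unsnoc-row (c ∷ _ ∷ _)  {[]}     ()
unsnoc-row []           {_ ∷ _}  ()
unsnoc-row (x ∷ r)      {_ ∷ cs} e with ∷-injective e
... | refl , e' with unsnoc-row r e'
... | r' , c , refl , refl , p = x ∷ r' , c , refl , refl , p

linked-0 : ∀ {α} → Linked _≥_ (0 ∷ α) → All (_≡ 0) α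
linked-0 [-]         = []
linked-0 (z≤n ∷ l)   = refl ∷ linked-0 l

identity-0 : ∀ r {cs} → map col r ≡ cs → All (λ c → proj₁ c ≡ 0) cs → r ≡ identity cs
identity-0 []               refl []         = refl
identity-0 (idle b ∷ r)     refl (_ ∷ ps)   = cong (_ ∷_) (identity-0 r refl ps)
identity-0 (move _ _ _ ∷ r) refl (() ∷ ps)

-- Induction from the leftmost column, which is last in the list. Its letter is at most its label j
-- by descent and at least j by assumption; the other letters of the row differ from it, hence are
-- at least j + 1.
row-unique : ∀ j α → Linked _≥_ α → ∀ r → map col r ≡ columns j α → All (j ≤_) (letters r) →
  okRow r ≡ true → r ≡ identity (columns j α)
row-unique j [] l [] e b o = refl
row-unique j (zero ∷ α) l r e b o = identity-0 r e (columns-heights j (refl ∷ linked-0 l))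
row-unique j (suc x ∷ α) l r e b o with unsnoc-row r e
... | r' , idle _     , refl , e' , ()
... | r' , move h u a , refl , e' , refl with okRow-snoc r' (move x j a) o
... | o' , f , s = trans (cong₂ (λ r a → r ++ move x j a ∷ [])
        (row-unique (suc j) α (Linked.tail l) r' e' (raise r' s (All-++⁻ˡ (letters r') b')) o') a≡j)
        (sym (identity-++ (columns (suc j) α) ((suc x , j) ∷ [])))
  where
  b' : All (j ≤_) (letters r' ++ a ∷ [])
  b' = subst (All (j ≤_)) (letters-++ r' (move x j a ∷ [])) b
  a≡j : a ≡ j
  a≡j = ≤-antisym (<ᵇ-false⁻ {j} {a} (not-elim f)) (All.head (All-++⁻ʳ (letters r') b'))
  raise : ∀ r' → All (λ z → ok z (move x j a) ≡ true) r' → All (j ≤_) (letters r') → All (suc j ≤_) (letters r')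
  raise []                  s        b        = []
  raise (idle _ ∷ r')       (_ ∷ s)  b        = raise r' s b
  raise (move h v c ∷ r')   (p ∷ s)  (q ∷ b)  = ≤∧≢⇒< q differ ∷ raise r' s b
    where
    differ : j ≢ c
    differ refl with trans (sym (proj₁ (∧-elim {apart _<ᵇ_ j a} p)))
                     (trans (cong (apart _<ᵇ_ j) a≡j) (cong₂ _∨_ (<ᵇ-false (≤-refl {j})) (<ᵇ-false (≤-refl {j}))))
    ... | ()

-- The monomial x^α with α padded by zeros to `n` entries; `lowered` drops finished columns, so α
-- may be shorter than `n`.
ind : ∀ {n} → List ℕ → Poly n
ind []      e       = δ e
ind (x ∷ α) []      = 0ℤ
ind (x ∷ α) (y ∷ e) = (x ≡ᵇ y) ▹ ind α e

ind-0 : ∀ {n α} → All (_≡ 0) α → length α ≤ n → ind {n} α ≐ δ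
ind-0 []          l       e           = refl
ind-0 (refl ∷ ps) (s≤s l) (zero ∷ e)  = ind-0 ps l e
ind-0 (refl ∷ ps) (s≤s l) (suc y ∷ e) = refl

lowered-0 : ∀ {α} → All (_≡ 0) α → lowered α ≡ []
lowered-0 []          = refl
lowered-0 (refl ∷ ps) = lowered-0 ps

lowered-linked : ∀ {α} → Linked _≥_ α → Linked _≥_ (lowered α)
lowered-linked {[]} l = []
lowered-linked {zero ∷ α} l rewrite lowered-0 (linked-0 l) = []
lowered-linked {suc x ∷ []} l = [-]
lowered-linked {suc x ∷ zero ∷ α} (_ ∷ l) rewrite lowered-0 (linked-0 l) = [-]
lowered-linked {suc x ∷ suc y ∷ α} (s≤s p ∷ l) = p ∷ lowered-linked l

lowered-length : ∀ α → length (lowered α) ≤ length α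
lowered-length []          = z≤n
lowered-length (zero ∷ α)  = m≤n⇒m≤1+n (lowered-length α)
lowered-length (suc x ∷ α) = s≤s (lowered-length α)

lowered-bound : ∀ {k α} → All (_≤ suc k) α → All (_≤ k) (lowered α)
lowered-bound []                        = []
lowered-bound {α = zero ∷ α}  (_ ∷ ps)     = lowered-bound ps
lowered-bound {α = suc x ∷ α} (s≤s p ∷ ps) = p ∷ lowered-bound ps

next-0 : ∀ {cs} → All (λ c → proj₁ c ≡ 0) cs → next (identity cs) ≡ []
next-0 []          = refl
next-0 (refl ∷ ps) = next-0 ps

letters-0 : ∀ {cs} → All (λ c → proj₁ c ≡ 0) cs → letters (identity cs) ≡ []
letters-0 []          = refl
letters-0 (refl ∷ ps) = letters-0 ps

next-identity : ∀ j {α} → Linked _≥_ α → next (identity (columns j α)) ≡ columns j (lowered α)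
next-identity j {[]} l = refl
next-identity j {zero ∷ α} l =
  trans (next-0 (columns-heights j (refl ∷ linked-0 l))) (cong (columns j) (sym (lowered-0 (linked-0 l))))
next-identity j {suc x ∷ α} l =
  trans (cong next (identity-++ (columns (suc j) α) _)) (trans (next-++ (identity (columns (suc j) α)) _)
    (cong (_++ (x , j) ∷ []) (next-identity (suc j) (Linked.tail l))))

letters-suc : ∀ j α → letters (identity (columns (suc j) α)) ≡ map suc (letters (identity (columns j α)))
letters-suc j []      = refl
letters-suc j (x ∷ α) = trans (split (suc j) x) (trans (cong₂ _++_ (letters-suc (suc j) α) (last x))
    (trans (sym (map-++ suc (letters (identity (columns (suc j) α))) _)) (cong (map suc) (sym (split j x)))))
  where
  split : ∀ j x → letters (identity (columns j (x ∷ α))) ≡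
            letters (identity (columns (suc j) α)) ++ letters (identity ((x , j) ∷ []))
  split j x = trans (cong letters (identity-++ (columns (suc j) α) _)) (letters-++ (identity (columns (suc j) α)) _)
  last : ∀ x → letters (identity ((x , suc j) ∷ [])) ≡ map suc (letters (identity ((x , j) ∷ [])))
  last zero    = refl
  last (suc x) = refl

X*-suc : ∀ {n} ls (f : Poly (suc n)) y e → X* (map suc ls) f (y ∷ e) ≡ X* ls (λ e → f (y ∷ e)) e
X*-suc []       f y e = refl
X*-suc (a ∷ ls) f y e = trans (X-suc a (X* (map suc ls) f) y e) (X-cong a (X*-suc ls f y) e)

-- Induction on the variables: the leftmost column contributes the first variable once, and the
-- letters of the other columns, shifted by one, act on the remaining variables.
X*-ind : ∀ {n α} → Linked _≥_ α → length α ≤ n →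
  X* (letters (identity (columns 0 α))) (ind {n} (lowered α)) ≐ ind α
X*-ind {α = []} l p e = refl
X*-ind {α = zero ∷ α} l p e rewrite letters-0 (columns-heights {_≡ 0} 0 (refl ∷ linked-0 l)) | lowered-0 (linked-0 l) =
  sym (ind-0 (refl ∷ linked-0 l) p e)
X*-ind {suc n} {suc x ∷ α} l (s≤s p) (y ∷ e) = trans (cong (λ ls → X* ls (ind (x ∷ lowered α)) (y ∷ e)) letters≡)
  (trans (X*-++ (map suc ls) (0 ∷ []) (ind (x ∷ lowered α)) (y ∷ e))
  (trans (X*-suc ls (X 0 (ind (x ∷ lowered α))) y e) (go y)))
  where
  ls = letters (identity (columns 0 α))
  letters≡ : letters (identity (columns 0 (suc x ∷ α))) ≡ map suc ls ++ 0 ∷ []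
  letters≡ = trans (cong letters (identity-++ (columns 1 α) _)) (trans (letters-++ (identity (columns 1 α)) _)
               (cong (_++ 0 ∷ []) (letters-suc 0 α)))
  go : ∀ y → X* ls (λ e → X 0 (ind (x ∷ lowered α)) (y ∷ e)) e ≡ ind (suc x ∷ α) (y ∷ e)
  go zero    = X*-0 ls e
  go (suc y) with x ≡ᵇ y
  ... | true  = X*-ind (Linked.tail l) p e
  ... | false = X*-0 ls e

columns-< : ∀ j α → All (λ c → proj₂ c < length α +ℕ j) (columns j α)
columns-< j []      = []
columns-< j (x ∷ α) = All-++⁺ (subst (λ m → All (λ c → proj₂ c < m) (columns (suc j) α)) (+-suc (length α) j) (columns-< (suc j) α))
                        (s≤s (m≤n+m j (length α)) ∷ [])

G-dominant : ∀ n k {α} → Linked _≥_ α → length α ≤ n → All (_≤ k) α → G (upTo n) k (columns 0 α) ≐ ind α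
G-dominant n zero    l p b e = sym (ind-0 (All.map (λ { z≤n → refl }) b) p e)
G-dominant n (suc k) {α} l p b e =
  trans (rowSum-single cs (All.map (λ q → ≤-trans q (subst (_≤ n) (sym (+-identityʳℕ (length α))) p)) (columns-< 0 α)) vanish)
 (trans (cong (_▹ X* (letters (identity cs)) (G (upTo n) k (next (identity cs))) e) (okRow-identity (columns-distinct 0 α)))
 (trans (X*-cong (letters (identity cs)) (λ e → trans (cong (λ ds → G (upTo n) k ds e) (next-identity 0 l))
          (G-dominant n k (lowered-linked l) (≤-trans (lowered-length α) p) (lowered-bound b) e)) e)
        (X*-ind l p e)))
  where

  cs = columns 0 α
  vanish : ∀ r → map col r ≡ cs → r ≢ identity cs → (okRow r ▹ X* (letters r) (G (upTo n) k (next r)) e) ≡ 0ℤ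
  vanish r eq q with okRow r in o
  ... | false = refl
  ... | true  = ⊥-elim (q (row-unique 0 α l r eq (All.universal (λ _ → z≤n) (letters r)) o))

-- Key polynomials

mulX-X : ∀ {n} (i : Fin n) (f : Poly n) e → mulX i f e ≡ X (toℕ i) f e
mulX-X fzero    f (zero ∷ e)  = refl
mulX-X fzero    f (suc x ∷ e) = refl
mulX-X (fsuc i) f (x ∷ e) = trans (step i f x e) (trans (mulX-X i (λ e → f (x ∷ e)) e) (sym (X-suc (toℕ i) f x e)))
  where
  step : ∀ {n} (i : Fin n) (f : Poly (suc n)) x e → mulX (fsuc i) f (x ∷ e) ≡ mulX i (λ e → f (x ∷ e)) e
  step i f x e with lookup e i
  ... | zero  = refl
  ... | suc _ = refl

mulX-inject₁ : ∀ {m} (i : Fin m) (f : Poly (suc m)) e → mulX (inject₁ i) f e ≡ X (toℕ i) f e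
mulX-inject₁ i f e = trans (mulX-X (inject₁ i) f e) (cong (λ a → X a f e) (toℕ-inject₁ i))

swapV-swE : ∀ {m} (i : Fin m) e → swapV i e ≡ swE (toℕ i) e
swapV-swE fzero    (x ∷ y ∷ e) = refl
swapV-swE (fsuc i) (x ∷ e)     = cong (x ∷_) (swapV-swE i e)

-- At the two exponents concerned, comparing coefficients gives d(x, 0) = 0 and d(x, y + 1) = d(x +
-- 1, y), so induction on y makes `d` vanish.
X-cancel : ∀ {n i} → suc i < n → (d : Poly n) → X i d ≐ X (suc i) d → d ≐ λ _ → 0ℤ
X-cancel {i = zero} p d h (x ∷ y ∷ e) = go y x
  where
  go : ∀ y x → d (x ∷ y ∷ e) ≡ 0ℤ
  go zero    x = h (suc x ∷ zero ∷ e)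
  go (suc y) x = trans (h (suc x ∷ suc y ∷ e)) (go y (suc x))
X-cancel {i = zero} (s≤s ()) d h (x ∷ [])
X-cancel {i = suc i} (s≤s p) d h (x ∷ e) = X-cancel p (λ e → d (x ∷ e))
  (λ e → trans (sym (X-suc i d x e)) (trans (h (x ∷ e)) (X-suc (suc i) d x e))) e

Xi-unique : ∀ {m} (i : Fin m) {f f' g g' : Poly (suc m)} → f ≐ f' → IsXi i f g → IsXi i f' g' → g ≐ g'
Xi-unique {m} i {f} {f'} {g} {g'} f≐f' p p' e =
  equal (X-cancel (s≤s (toℕ<n i)) (λ e → g e - g' e) differ e)
  where
  equal : ∀ {a b : ℤ} → a - b ≡ 0ℤ → a ≡ b
  equal {a} {b} h = trans (sym (back a b)) (trans (cong (_+ b) h) (zeroˡ b))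
    where
    back : ∀ a b → (a - b) + b ≡ a
    back = solve-∀
    zeroˡ : ∀ b → 0ℤ + b ≡ b
    zeroˡ = solve-∀
  a₀ = toℕ i
  rearrange : ∀ a b c d → a - b ≡ c - d → a - c ≡ b - d
  rearrange a b c d h = trans (sym (step₁ a b c)) (trans (cong (λ z → (z + b) - c) h) (step₂ b c d))
    where
    step₁ : ∀ a b c → ((a - b) + b) - c ≡ a - c
    step₁ = solve-∀
    step₂ : ∀ b c d → ((c - d) + b) - c ≡ b - d
    step₂ = solve-∀
  same : ∀ e → X a₀ g e - X (suc a₀) g e ≡ X a₀ g' e - X (suc a₀) g' e
  same e = trans (sym (cong₂ _-_ (mulX-inject₁ i g e) (mulX-X (fsuc i) g e)))
    (trans (p e) (trans (cong₂ _-_ (trans (mulX-inject₁ i f e) (trans (X-cong a₀ f≐f' e) (sym (mulX-inject₁ i f' e))))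
        (trans (mulX-X (fsuc i) (swapP i f) e) (trans (X-cong (suc a₀) (λ e → f≐f' (swapV i e)) e) (sym (mulX-X (fsuc i) (swapP i f') e)))))
    (trans (sym (p' e)) (cong₂ _-_ (mulX-inject₁ i g' e) (mulX-X (fsuc i) g' e)))))
  differ : X a₀ (λ e → g e - g' e) ≐ X (suc a₀) (λ e → g e - g' e)
  differ e = trans (X-- a₀ g g' e) (trans (rearrange (X a₀ g e) (X (suc a₀) g e) (X a₀ g' e) (X (suc a₀) g' e) (same e)) (sym (X-- (suc a₀) g g' e)))

module _ {m : ℕ} (j : ℕ) (i : Fin m) (α : Vec ℕ (suc m)) where
  record Split : Set where
    constructor mkSplit
    field
      R L      : List Col
      before   : columns j (toList α) ≡
                 R ++ (lookup α (fsuc i) , suc (toℕ i +ℕ j)) ∷ (lookup α (inject₁ i) , toℕ i +ℕ j) ∷ L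
      after    : columns j (toList (swapV i α)) ≡
                 R ++ (lookup α (inject₁ i) , suc (toℕ i +ℕ j)) ∷ (lookup α (fsuc i) , toℕ i +ℕ j) ∷ L
      outR     : All (λ c → Out (toℕ i +ℕ j) (proj₂ c)) R
      outL     : All (λ c → Out (toℕ i +ℕ j) (proj₂ c)) L

split-columns : ∀ {m} j (i : Fin m) α → Split j i α
split-columns j fzero (x ∷ y ∷ α) = mkSplit (columns (2 +ℕ j) (toList α)) []
  (++-assoc (columns (2 +ℕ j) (toList α)) _ _) (++-assoc (columns (2 +ℕ j) (toList α)) _ _)
  (All.map (λ p → (λ { refl → <-irrefl refl (≤-trans (n≤1+n _) p) }) , (λ { refl → <-irrefl refl p })) (columns-≥ (2 +ℕ j) (toList α))) []
split-columns j (fsuc i) (x ∷ α) with split-columns (suc j) i α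
... | mkSplit R L b a oR oL rewrite +-suc (toℕ i) j = mkSplit R (L ++ (x , j) ∷ [])
  (trans (cong (_++ (x , j) ∷ []) b) (++-assoc R _ _)) (trans (cong (_++ (x , j) ∷ []) a) (++-assoc R _ _))
  oR (All-++⁺ oL (((λ e → <⇒≢ (s≤s (m≤n+m j (toℕ i))) e) , (λ e → <⇒≢ (s≤s (≤-trans (m≤n+m j (toℕ i)) (n≤1+n _))) e)) ∷ []))

𝒢 : ∀ {n} → ℕ → Vec ℕ n → Poly n
𝒢 {n} k α = G (upTo n) k (columns 0 (toList α))

𝒢-sorted : ∀ {n} k (α : Vec ℕ n) → All (_≤ k) (toList α) → let S = sort (columns 0 (toList α)) in
  𝒢 k α ≐ H (upTo n) (rowLengths k (heights S)) (labels S)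
𝒢-sorted k α b e =
  trans (G-sort _ k [] cs (columns-distinct 0 (toList α)) (columns-labels 0 (toList α)) (columns-heights 0 b) e)
        (G-decreasing _ k (sort cs) (sort-decreasing cs) e)
  where cs = columns 0 (toList α)

All-swapV : ∀ {P : ℕ → Set} {m} (i : Fin m) α → All P (toList α) → All P (toList (swapV i α))
All-swapV fzero    (x ∷ y ∷ α) (p ∷ q ∷ ps) = q ∷ p ∷ ps
All-swapV (fsuc i) (x ∷ α)     (p ∷ ps)     = p ∷ All-swapV i α ps

-- For α_i > α_{i+1} the sorted columns of α and of s_i α have the same heights and labels that
-- differ by s_i, with those of s_i α in `High` position; so `demazure` applies.
𝒢-xi : ∀ {m} k (α : Vec ℕ (suc m)) (i : Fin m) → lookup α (fsuc i) < lookup α (inject₁ i) → All (_≤ k) (toList α) →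
  IsXi i (𝒢 k α) (𝒢 k (swapV i α))
𝒢-xi {m} k α i y<x b with split-columns 0 i α
... | mkSplit R L before after oR oL rewrite +-identityʳℕ (toℕ i) = λ e →
  trans (cong₂ _-_ (trans (mulX-inject₁ i (𝒢 k (swapV i α)) e) refl) (mulX-X (fsuc i) (𝒢 k (swapV i α)) e))
 (trans (xi e)
 (sym (cong₂ _-_ (mulX-inject₁ i (𝒢 k α) e) (trans (mulX-X (fsuc i) (swapP i (𝒢 k α)) e)
   (X-cong (suc a₀) (λ e → cong (𝒢 k α) (swapV-swE i e)) e)))))
  where
  a₀ = toℕ i
  open Operators (s≤s (toℕ<n i))
  S S' : List Col
  S  = sort (R ++ (lookup α (inject₁ i) , suc a₀) ∷ (lookup α (fsuc i) , a₀) ∷ L)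
  S' = sort (R ++ (lookup α (fsuc i) , suc a₀) ∷ (lookup α (inject₁ i) , a₀) ∷ L)
  S'≡ : S' ≡ relabel a₀ S
  S'≡ = sort-relabel R L y<x oR oL
  heights≡ : heights S' ≡ heights S
  heights≡ = trans (cong heights S'≡) (sym (map-∘ S))
  labels≡ : labels S' ≡ s* a₀ (labels S)
  labels≡ = trans (cong labels S'≡) (trans (sym (map-∘ S)) (map-∘ S))
  ks = rowLengths k (heights S)
  g : H (upTo (suc m)) ks (labels S) ≐ 𝒢 k (swapV i α)
  g e = sym (trans (𝒢-sorted k (swapV i α) (All-swapV i α b) e)
    (cong (λ T → H (upTo (suc m)) (rowLengths k (heights (sort T))) (labels (sort T)) e) after))
  f : H (upTo (suc m)) ks (s* a₀ (labels S)) ≐ 𝒢 k α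
  f e = sym (trans (𝒢-sorted k α b e)
    (trans (cong (λ T → H (upTo (suc m)) (rowLengths k (heights (sort T))) (labels (sort T)) e) before)
           (cong₂ (λ hs ws → H (upTo (suc m)) (rowLengths k hs) ws e) heights≡ labels≡)))
  xi : Xi (𝒢 k (swapV i α)) (𝒢 k α)
  xi = Xi-cong g f (proj₂ (demazure (s≤s (toℕ<n i)) ks (sort-high R L y<x oR oL)))

-- The sum of j α_j drops when an ascent is removed; it is the measure for the recursion in `key-𝒢`.
weight : ∀ {n} → ℕ → Vec ℕ n → ℕ
weight j []      = 0
weight j (x ∷ α) = j *ℕ x +ℕ weight (suc j) α

weight-swap : ∀ {m} j (i : Fin m) α → lookup α (inject₁ i) < lookup α (fsuc i) → weight j (swapV i α) < weight j α
weight-swap j fzero (x ∷ y ∷ α) x<y = subst₂ _<_ (sym (lhs j x y (weight (2 +ℕ j) α))) (sym (rhs j x y (weight (2 +ℕ j) α)))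
  (+-monoˡ-< (j *ℕ x +ℕ j *ℕ y +ℕ weight (2 +ℕ j) α) x<y)
  where
  lhs : ∀ j x y w → j *ℕ y +ℕ (suc j *ℕ x +ℕ w) ≡ x +ℕ (j *ℕ x +ℕ j *ℕ y +ℕ w)
  lhs = ℕ-solve-∀
  rhs : ∀ j x y w → j *ℕ x +ℕ (suc j *ℕ y +ℕ w) ≡ y +ℕ (j *ℕ x +ℕ j *ℕ y +ℕ w)
  rhs = ℕ-solve-∀
weight-swap j (fsuc i) (x ∷ α) p = +-monoʳ-< (j *ℕ x) (weight-swap (suc j) i α p)

ascent? : ∀ {m} (α : Vec ℕ (suc m)) → DecreasingV α ⊎ ∃ λ (i : Fin m) → lookup α (inject₁ i) < lookup α (fsuc i)
ascent? (x ∷ []) = inj₁ [-]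
ascent? (x ∷ y ∷ α) with y ≤? x | ascent? (y ∷ α)
... | no  q | _            = inj₂ (fzero , ≰⇒> q)
... | yes p | inj₁ d       = inj₁ (p ∷ d)
... | yes p | inj₂ (i , q) = inj₂ (fsuc i , q)

swapV-involutive : ∀ {m} (i : Fin m) α → swapV i (swapV i α) ≡ α
swapV-involutive fzero    (x ∷ y ∷ α) = refl
swapV-involutive (fsuc i) (x ∷ α)     = cong (x ∷_) (swapV-involutive i α)

lookup-swapV : ∀ {m} (i : Fin m) α →
  lookup (swapV i α) (inject₁ i) ≡ lookup α (fsuc i) × lookup (swapV i α) (fsuc i) ≡ lookup α (inject₁ i)
lookup-swapV fzero    (x ∷ y ∷ α) = refl , refl
lookup-swapV (fsuc i) (x ∷ α)     = lookup-swapV i α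

≡ᵇ-refl : ∀ x → (x ≡ᵇ x) ≡ true
≡ᵇ-refl x = Equivalence.to T-≡ (≡⇒≡ᵇ x x refl)

ind-same : ∀ {n} (α : Vec ℕ n) → ind (toList α) α ≡ 1ℤ
ind-same []      = refl
ind-same (x ∷ α) rewrite ≡ᵇ-refl x = ind-same α

ind-other : ∀ {n} (α e : Vec ℕ n) → e ≢ α → ind (toList α) e ≡ 0ℤ
ind-other []      []      p = ⊥-elim (p refl)
ind-other (x ∷ α) (y ∷ e) p with x ≡ᵇ y in eq
... | false = refl
... | true  = ind-other α e (λ q → p (cong₂ _∷_ (sym (≡ᵇ⇒≡ x y (Equivalence.from T-≡ eq))) q))

module _ (K : KeyFamily) (isKey : IsKeyFamily K) where

  key-dominant : ∀ {n} k (α : Vec ℕ n) → DecreasingV α → All (_≤ k) (toList α) → K n α ≐ 𝒢 k α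
  key-dominant {n} k α d b e = trans (indicator e) (sym (G-dominant n k d (≤-reflexive (length-toList α)) b e))
    where
    indicator : ∀ e → K n α e ≡ ind (toList α) e
    indicator e with ≡-decᵛ _≟_ e α
    ... | yes refl = trans (proj₁ (proj₁ isKey n α d)) (sym (ind-same α))
    ... | no p     = trans (proj₂ (proj₁ isKey n α d) e p) (sym (ind-other α e p))

  key-𝒢 : ∀ {n} k (α : Vec ℕ n) → All (_≤ k) (toList α) → K n α ≐ 𝒢 k α
  key-𝒢 {zero}  k []  b = key-dominant k [] [] b
  key-𝒢 {suc m} k α₀  b₀ = go α₀ b₀ (<-wellFounded (weight 0 α₀))
    where
    go : ∀ (α : Vec ℕ (suc m)) → All (_≤ k) (toList α) → Acc _<_ (weight 0 α) → K (suc m) α ≐ 𝒢 k α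
    go α b (acc rec) with ascent? α
    ... | inj₁ d       = key-dominant k α d b
    -- The defining recursion goes from a descent to an ascent, so it is applied at α' = s_i α,
    -- which has smaller weight, and s_i α' is α again.
    ... | inj₂ (i , p) = subst (λ β → K (suc m) β ≐ 𝒢 k β) (swapV-involutive i α)
          (Xi-unique i (go α' b' (rec (weight-swap 0 i α p))) (proj₂ isKey m α' i p') (𝒢-xi k α' i p' b'))
      where
      α' = swapV i α
      b' = All-swapV i α b
      p' : lookup α' (fsuc i) < lookup α' (inject₁ i)
      p' = subst₂ _<_ (sym (proj₂ (lookup-swapV i α))) (sym (proj₁ (lookup-swapV i α))) p

-- Fillings column by column

nonzero : List Col → List Col
nonzero []                 = []
nonzero ((zero  , b) ∷ cs) = nonzero cs
nonzero ((suc h , b) ∷ cs) = (suc h , b) ∷ nonzero cs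

dropIdle : List Cell → List Cell
dropIdle []               = []
dropIdle (idle b ∷ r)     = dropIdle r
dropIdle (move h b a ∷ r) = move h b a ∷ dropIdle r

next-dropIdle : ∀ r → next (dropIdle r) ≡ next r
next-dropIdle []               = refl
next-dropIdle (idle b ∷ r)     = next-dropIdle r
next-dropIdle (move h b a ∷ r) = cong (_ ∷_) (next-dropIdle r)

letters-dropIdle : ∀ r → letters (dropIdle r) ≡ letters r
letters-dropIdle []               = refl
letters-dropIdle (idle b ∷ r)     = letters-dropIdle r
letters-dropIdle (move h b a ∷ r) = cong (_ ∷_) (letters-dropIdle r)

rowSum-nonzero : ∀ A cs F → rowSum A (nonzero cs) F ≡ rowSum A cs (F ∘ dropIdle)
rowSum-nonzero A []                 F = refl
rowSum-nonzero A ((zero  , b) ∷ cs) F = rowSum-nonzero A cs F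
rowSum-nonzero A ((suc h , b) ∷ cs) F = sumL-cong A λ a → rowSum-nonzero A cs (F ∘ (move h b a ∷_))

okRow-dropIdle : ∀ r → AllPairs (λ c d → proj₂ d < proj₂ c) (map col r) → okRow (dropIdle r) ≡ okRow r
okRow-dropIdle [] [] = refl
okRow-dropIdle (idle b ∷ r) (p ∷ d) = trans (okRow-dropIdle r d) (sym (cong (_∧ okRow r) (go r p)))
  where
  go : ∀ r → All (λ d → proj₂ d < b) (map col r) → all (ok (idle b)) r ≡ true
  go []                  []      = refl
  go (idle _ ∷ r)        (_ ∷ p) = go r p
  go (move h b' a' ∷ r)  (q ∷ p) = cong₂ _∧_
    (cong not (trans (cong (not (b <ᵇ a') ∧_) (<ᵇ-false (<⇒≤ q))) (∧-zeroʳ _))) (go r p)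
okRow-dropIdle (move h b a ∷ r) (p ∷ d) = cong (not (b <ᵇ a) ∧_) (cong₂ _∧_ (go r) (okRow-dropIdle r d))
  where
  go : ∀ r → all (ok (move h b a)) (dropIdle r) ≡ all (ok (move h b a)) r
  go []                 = refl
  go (idle _ ∷ r)       = go r
  go (move _ _ _ ∷ r)   = cong (_ ∧_) (go r)

-- A column without boxes could only forbid ap ≤ bq < bp for a column on its left. Basement labels
-- increase from left to right, so bq < bp never holds.
G-nonzero : ∀ {n} A k {cs} → AllPairs (λ c d → proj₂ d < proj₂ c) cs → G {n} A k (nonzero cs) ≐ G A k cs
G-nonzero A zero    d e = refl
G-nonzero A (suc k) {cs} d e = trans (rowSum-nonzero A cs _) (rowSum-cong A cs λ { r refl →
  cong₂ _▹_ (okRow-dropIdle r d)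
    (cong₂ (λ ls ds → X* ls (G A k ds) e) (letters-dropIdle r) (next-dropIdle r)) })

-- The row tests for two columns, followed upwards. When the right column ends, its top box enters
-- one last test; when the left one ends, nothing remains to be tested.
okPair : ℕ → List ℕ → ℕ → List ℕ → Bool
okPair bq wq        bp []        = true
okPair bq []        bp (ap ∷ wp) = not (closedOpen _<ᵇ_ ap bq bp)
okPair bq (aq ∷ wq) bp (ap ∷ wp) = pair _<ᵇ_ (length wq <ᵇ length wp) bq aq bp ap ∧ okPair aq wq ap wp

okCols : ℕ × List ℕ → ℕ × List ℕ → Bool
okCols (bq , wq) (bp , wp) = okPair bq wq bp wp

descending : ℕ → List ℕ → Bool
descending b []      = true
descending b (a ∷ w) = not (b <ᵇ a) ∧ descending a w

okFill : List (ℕ × List ℕ) → Bool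
okFill []            = true
okFill ((b , w) ∷ F) = descending b w ∧ (all (okCols (b , w)) F ∧ okFill F)

fillSum : List ℕ → List Col → (List (ℕ × List ℕ) → ℤ) → ℤ
fillSum A []             Φ = Φ []
fillSum A ((h , b) ∷ cs) Φ = wordSum A h (λ w → fillSum A cs (λ F → Φ ((b , w) ∷ F)))

content : List (ℕ × List ℕ) → List ℕ
content F = concat (map proj₂ F)

shape : List (ℕ × List ℕ) → List Col
shape = map (λ (b , w) → length w , b)

fillSum-cong : ∀ A cs {Φ Φ'} → (∀ F → shape F ≡ cs → Φ F ≡ Φ' F) → fillSum A cs Φ ≡ fillSum A cs Φ'
fillSum-cong A []             h = h [] refl
fillSum-cong A ((k , b) ∷ cs) h = wordSum-cong-length A k λ w l →
  fillSum-cong A cs λ F eq → h ((b , w) ∷ F) (cong₂ (λ l cs → (l , b) ∷ cs) l eq)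

▹-sumL : ∀ {A : Set} β (as : List A) f → (β ▹ sumL as f) ≡ sumL as (λ a → β ▹ f a)
▹-sumL true  as f = refl
▹-sumL false as f = sym (sumL-0 as)

▹-wordSum : ∀ β A k F → (β ▹ wordSum A k F) ≡ wordSum A k (λ w → β ▹ F w)
▹-wordSum β A zero    F = refl
▹-wordSum β A (suc k) F = trans (▹-sumL β A _) (sumL-cong A λ a → ▹-wordSum β A k (F ∘ (a ∷_)))

▹-fillSum : ∀ β A cs Φ → (β ▹ fillSum A cs Φ) ≡ fillSum A cs (λ F → β ▹ Φ F)
▹-fillSum β A []             Φ = refl
▹-fillSum β A ((h , b) ∷ cs) Φ = trans (▹-wordSum β A h _) (wordSum-cong A h λ w → ▹-fillSum β A cs _)

X-fillSum : ∀ {n} a A cs (Φ : List (ℕ × List ℕ) → Poly n) →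
  X a (λ e → fillSum A cs (λ F → Φ F e)) ≐ λ e → fillSum A cs (λ F → X a (Φ F) e)
X-fillSum a A []             Φ e = refl
X-fillSum a A ((h , b) ∷ cs) Φ e =
  trans (X-wordSum a A h (λ w e → fillSum A cs (λ F → Φ ((b , w) ∷ F) e)) e)
        (wordSum-cong A h λ w → X-fillSum a A cs (λ F → Φ ((b , w) ∷ F)) e)

X*-fillSum : ∀ {n} as A cs (Φ : List (ℕ × List ℕ) → Poly n) →
  X* as (λ e → fillSum A cs (λ F → Φ F e)) ≐ λ e → fillSum A cs (λ F → X* as (Φ F) e)
X*-fillSum []       A cs Φ e = refl
X*-fillSum (a ∷ as) A cs Φ e =
  trans (X-cong a (X*-fillSum as A cs Φ) e) (X-fillSum a A cs (λ F → X* as (Φ F)) e)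

X*-▹ : ∀ {n} as β (f : Poly n) → X* as (λ e → β ▹ f e) ≐ λ e → β ▹ X* as f e
X*-▹ as true  f e = refl
X*-▹ as false f e = X*-0 as e

wordSum-sumL : ∀ {B : Set} A k (bs : List B) (f : List ℕ → B → ℤ) →
  wordSum A k (λ w → sumL bs (f w)) ≡ sumL bs (λ b → wordSum A k (λ w → f w b))
wordSum-sumL A zero    bs f = refl
wordSum-sumL A (suc k) bs f = trans (sumL-cong A λ a → wordSum-sumL A k bs (f ∘ (a ∷_))) (sumL-swap A bs _)

wordSum-rowSum : ∀ A k cs (f : List ℕ → List Cell → ℤ) →
  wordSum A k (λ w → rowSum A cs (f w)) ≡ rowSum A cs (λ r → wordSum A k (λ w → f w r))
wordSum-rowSum A k []                 f = refl
wordSum-rowSum A k ((zero  , b) ∷ cs) f = wordSum-rowSum A k cs (λ w → f w ∘ (idle b ∷_))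
wordSum-rowSum A k ((suc h , b) ∷ cs) f = trans (wordSum-sumL A k A _)
  (sumL-cong A λ a → wordSum-rowSum A k cs (λ w → f w ∘ (move h b a ∷_)))

-- Puts the row `r` underneath a filling of the rows above it. Idle cells become empty columns,
-- since `next r` has no entry for them.
grow : List Cell → List (ℕ × List ℕ) → List (ℕ × List ℕ)
grow []               F              = []
grow (idle b ∷ r)     F              = (b , []) ∷ grow r F
grow (move h b a ∷ r) []             = []
grow (move h b a ∷ r) ((_ , w) ∷ F)  = (b , a ∷ w) ∷ grow r F

fillSum-rowSum : ∀ A cs Φ → fillSum A cs Φ ≡ rowSum A cs (λ r → fillSum A (next r) (Φ ∘ grow r))
fillSum-rowSum A []                 Φ = refl
fillSum-rowSum A ((zero  , b) ∷ cs) Φ = fillSum-rowSum A cs (Φ ∘ ((b , []) ∷_))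
fillSum-rowSum A ((suc h , b) ∷ cs) Φ = sumL-cong A λ a →
  trans (wordSum-cong A h λ w → fillSum-rowSum A cs (Φ ∘ ((b , a ∷ w) ∷_)))
        (wordSum-rowSum A h cs _)

content-grow : ∀ r F → shape F ≡ next r → content (grow r F) ↭ letters r ++ content F
content-grow []               []            eq = ↭-refl
content-grow (idle b ∷ r)     F             eq = content-grow r F eq
content-grow (move h b a ∷ r) ((b' , w) ∷ F) eq = prep a
  (↭-trans (↭-++⁺ˡ w (content-grow r F (proj₂ (∷-injective eq)))) (shifts w (letters r)))

okCols-idle : ∀ b r F → shape F ≡ next r → all (okCols (b , [])) (grow r F) ≡ all (ok (idle b)) r
okCols-idle b []                 F             eq = refl
okCols-idle b (idle b' ∷ r)      F             eq = okCols-idle b r F eq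
okCols-idle b (move h' b' a' ∷ r) ((_ , w) ∷ F) eq = cong (_ ∧_) (okCols-idle b r F (proj₂ (∷-injective eq)))

okCols-move : ∀ b a w r F → shape F ≡ next r →
  all (okCols (b , a ∷ w)) (grow r F) ≡ all (ok (move (length w) b a)) r ∧ all (okCols (a , w)) F
okCols-move b a w [] [] eq = refl
okCols-move b a w (idle b' ∷ r) F eq = okCols-move b a w r F eq
okCols-move b a w (move h' b' a' ∷ r) ((_ , w') ∷ F) eq with ∷-injective eq
... | refl , eq' rewrite okCols-move b a w r F eq' =
  solve 4 (λ p q x y → (p :* q) :* (x :* y) := (p :* x) :* (q :* y)) refl
    (pair _<ᵇ_ (length w <ᵇ length w') b a b' a') (okCols (a , w) (a' , w'))
    (all (ok (move (length w) b a)) r) (all (okCols (a , w)) F)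
  where open ∨-∧-Solver

okFill-grow : ∀ r F → shape F ≡ next r → okFill (grow r F) ≡ okRow r ∧ okFill F
okFill-grow []                 []            eq = refl
okFill-grow (idle b ∷ r)       F             eq
  rewrite okCols-idle b r F eq | okFill-grow r F eq =
  solve 3 (λ x y z → x :* (y :* z) := (x :* y) :* z) refl (all (ok (idle b)) r) (okRow r) (okFill F)
  where open ∨-∧-Solver
okFill-grow (move h b a ∷ r)   ((a' , w) ∷ F) eq with ∷-injective eq
... | refl , eq' rewrite okCols-move b a w r F eq' | okFill-grow r F eq' =
  solve 6 (λ f d p q x y → (f :* d) :* ((p :* q) :* (x :* y)) := (f :* (p :* x)) :* (d :* (q :* y))) refl
    (not (b <ᵇ a)) (descending a w) (all (ok (move (length w) b a)) r) (all (okCols (a , w)) F) (okRow r) (okFill F)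
  where open ∨-∧-Solver

next-bound : ∀ {k} r → All (λ c → proj₁ c ≤ suc k) (map col r) → All (λ c → proj₁ c ≤ k) (next r)
next-bound []               []            = []
next-bound (idle b ∷ r)     (_ ∷ p)       = next-bound r p
next-bound (move h b a ∷ r) (s≤s q ∷ p)   = q ∷ next-bound r p

-- Splitting the lowest row off all columns turns the sum over columns into a sum over this row and
-- over fillings of the rest; the conditions and the monomial split accordingly.
G-fillSum : ∀ {n} A k {cs} → All (λ c → proj₁ c ≤ k) cs → ∀ (e : Vec ℕ n) →
  G A k cs e ≡ fillSum A cs (λ F → okFill F ▹ X* (content F) δ e)
G-fillSum A zero    p e = sym (trans (empty p (λ F → okFill F ▹ X* (content F) δ e))
    (trans (cong (_▹ X* (content (bare p)) δ e) (ok-empty p)) (cong (λ ls → X* ls δ e) (content-empty p))))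
  where
  bare : ∀ {cs} → All (λ c → proj₁ c ≤ 0) cs → List (ℕ × List ℕ)
  bare []                   = []
  bare (_∷_ {_ , b} z≤n p)  = (b , []) ∷ bare p
  empty : ∀ {cs} (p : All (λ c → proj₁ c ≤ 0) cs) Φ → fillSum A cs Φ ≡ Φ (bare p)
  empty []        Φ = refl
  empty (z≤n ∷ p) Φ = empty p _
  ok-empty : ∀ {cs} (p : All (λ c → proj₁ c ≤ 0) cs) → okFill (bare p) ≡ true
  ok-empty []                  = refl
  ok-empty (_∷_ {_ , b} z≤n p) = cong₂ _∧_ (go p) (ok-empty p)
    where
    go : ∀ {cs} (p : All (λ c → proj₁ c ≤ 0) cs) → all (okCols (b , [])) (bare p) ≡ true
    go []        = refl
    go (z≤n ∷ p) = go p
  content-empty : ∀ {cs} (p : All (λ c → proj₁ c ≤ 0) cs) → content (bare p) ≡ []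
  content-empty []        = refl
  content-empty (z≤n ∷ p) = content-empty p
G-fillSum A (suc k) {cs} p e = sym (trans (fillSum-rowSum A cs _) (rowSum-cong A cs λ { r refl →
    let D = next r in
    trans (fillSum-cong A D (λ F eq →
        trans (cong₂ _▹_ (okFill-grow r F eq) (trans (X*-↭ δ (content-grow r F eq) e) (X*-++ (letters r) (content F) δ e)))
       (trans (▹-∧ (okRow r) (okFill F))
              (cong (okRow r ▹_) (sym (X*-▹ (letters r) (okFill F) (X* (content F) δ) e))))))
   (trans (sym (▹-fillSum (okRow r) A D _))
          (cong (okRow r ▹_) (trans (sym (X*-fillSum (letters r) A D (λ F e → okFill F ▹ X* (content F) δ e) e))
             (X*-cong (letters r) (λ e → sym (G-fillSum A k (next-bound r p) e)) e)))) }))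

wordSum-0 : ∀ A k {F} → (∀ w → F w ≡ 0ℤ) → wordSum A k F ≡ 0ℤ
wordSum-0 A zero    h = h []
wordSum-0 A (suc k) h = trans (sumL-cong A λ a → wordSum-0 A k (λ w → h (a ∷ w))) (sumL-0 A)

fillSum-0 : ∀ A cs {Φ} → (∀ F → Φ F ≡ 0ℤ) → fillSum A cs Φ ≡ 0ℤ
fillSum-0 A []             h = h []
fillSum-0 A ((k , b) ∷ cs) h = wordSum-0 A k λ w → fillSum-0 A cs λ F → h _

-- Restricting to functions that vanish off `C` is what lets a sum over all variables shrink to the
-- letters that the chosen monomial can contain.
Restricts : List ℕ → List ℕ → Set
Restricts A C = ∀ f → (∀ a → a ∉ C → f a ≡ 0ℤ) → sumL A f ≡ sumL C f

wordSum-restrict : ∀ {A C} → Restricts A C → ∀ k F → (∀ w → Any (_∉ C) w → F w ≡ 0ℤ) → wordSum A k F ≡ wordSum C k F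
wordSum-restrict R zero    F h = refl
wordSum-restrict {A} {C} R (suc k) F h =
  trans (sumL-cong A λ a → wordSum-restrict R k (F ∘ (a ∷_)) (λ w p → h (a ∷ w) (there p)))
        (R _ (λ a p → wordSum-0 C k (λ w → h (a ∷ w) (here p))))

fillSum-restrict : ∀ {A C} → Restricts A C → ∀ cs Φ → (∀ F → Any (_∉ C) (content F) → Φ F ≡ 0ℤ) →
  fillSum A cs Φ ≡ fillSum C cs Φ
fillSum-restrict R []             Φ h = refl
fillSum-restrict {A} {C} R ((k , b) ∷ cs) Φ h =
  trans (wordSum-cong A k λ w → fillSum-restrict R cs _ (λ F p → h ((b , w) ∷ F) (Any-++⁺ʳ w p)))
        (wordSum-restrict R k _ (λ w p → fillSum-0 C cs (λ F → h ((b , w) ∷ F) (Any-++⁺ˡ p))))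

fillSum-++ : ∀ A cs ds Φ → fillSum A (cs ++ ds) Φ ≡ fillSum A cs (λ F → fillSum A ds (λ F' → Φ (F ++ F')))
fillSum-++ A []             ds Φ = refl
fillSum-++ A ((h , b) ∷ cs) ds Φ = wordSum-cong A h λ w → fillSum-++ A cs ds _

wordSum-fillSum : ∀ A k cs (f : List ℕ → List (ℕ × List ℕ) → ℤ) →
  wordSum A k (λ w → fillSum A cs (f w)) ≡ fillSum A cs (λ F → wordSum A k (λ w → f w F))
wordSum-fillSum A k []             f = refl
wordSum-fillSum A k ((h , b) ∷ cs) f =
  trans (wordSum-wordSum k h _) (wordSum-cong A h λ v → wordSum-fillSum A k cs _)
  where
  wordSum-wordSum : ∀ k h (f : List ℕ → List ℕ → ℤ) →
    wordSum A k (λ w → wordSum A h (f w)) ≡ wordSum A h (λ v → wordSum A k (λ w → f w v))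
  wordSum-wordSum k zero    f = refl
  wordSum-wordSum k (suc h) f = trans (wordSum-sumL A k A _)
    (sumL-cong A λ a → wordSum-wordSum k h (λ w v → f w (a ∷ v)))

fillSum-reverse : ∀ A cs Φ → fillSum A (reverse cs) Φ ≡ fillSum A cs (Φ ∘ reverse)
fillSum-reverse A []             Φ = refl
fillSum-reverse A ((h , b) ∷ cs) Φ rewrite unfold-reverse (h , b) cs =
  trans (fillSum-++ A (reverse cs) ((h , b) ∷ []) Φ)
 (trans (fillSum-reverse A cs _)
 (trans (sym (wordSum-fillSum A h cs (λ w F → Φ (reverse F ++ (b , w) ∷ []))))
        (wordSum-cong A h λ w → fillSum-cong A cs λ F _ → cong Φ (sym (unfold-reverse (b , w) F)))))

-- Contents of words

at : ∀ {n} → Vec ℕ n → ℕ → ℕ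
at []      a       = 0
at (x ∷ e) zero    = x
at (x ∷ e) (suc a) = at e a

count : ℕ → List ℕ → ℕ
count a bs = length (filter (_≟ a) bs)

Matches : ∀ {n} → Vec ℕ n → List ℕ → Set
Matches e as = ∀ a → count a as ≡ at e a

count-same : ∀ a bs → count a (a ∷ bs) ≡ suc (count a bs)
count-same a bs = cong length (filter-accept (_≟ a) refl)

count-other : ∀ {a b} bs → b ≢ a → count a (b ∷ bs) ≡ count a bs
count-other {a} bs p = cong length (filter-reject (_≟ a) p)

count-∈ : ∀ {a as} → a ∈ as → count a as ≢ 0
count-∈ {a} {_ ∷ bs} (here refl) e = 1+n≢0 (trans (sym (count-same a bs)) e)
count-∈ {a} {b ∷ bs} (there p)   e with b ≟ a
... | yes refl = 1+n≢0 (trans (sym (count-same b bs)) e)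
... | no q     = count-∈ p (trans (sym (count-other bs q)) e)

dec-nothing : ∀ {n} a (e : Vec ℕ n) → dec a e ≡ nothing → at e a ≡ 0
dec-nothing a       []          p = refl
dec-nothing zero    (zero ∷ e)  p = refl
dec-nothing (suc a) (x ∷ e)     p with dec a e in q
dec-nothing (suc a) (x ∷ e)     p | nothing = dec-nothing a e q

dec-just : ∀ {n} a (e : Vec ℕ n) {e'} → dec a e ≡ just e' →
  at e a ≡ suc (at e' a) × (∀ b → a ≢ b → at e b ≡ at e' b)
dec-just zero    (suc x ∷ e) refl = refl , λ { zero p → ⊥-elim (p refl) ; (suc b) p → refl }
dec-just (suc a) (x ∷ e)     p with dec a e in q
dec-just (suc a) (x ∷ e)     refl | just e' with dec-just a e q
... | r , s = r , λ { zero p → refl ; (suc b) p → s b (λ { refl → p refl }) }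

δ-cases : ∀ {n} (e : Vec ℕ n) → (δ e ≡ 1ℤ × (∀ a → 0 ≡ at e a)) ⊎ (δ e ≡ 0ℤ × ¬ (∀ a → 0 ≡ at e a))
δ-cases []          = inj₁ (refl , λ _ → refl)
δ-cases (suc x ∷ e) = inj₂ (refl , λ h → 0≢1+n (h 0))
δ-cases (zero ∷ e) with δ-cases e
... | inj₁ (p , h) = inj₁ (p , λ { zero → refl ; (suc a) → h a })
... | inj₂ (p , h) = inj₂ (p , λ h' → h (h' ∘ suc))

X*-δ : ∀ {n} as (e : Vec ℕ n) → (X* as δ e ≡ 1ℤ × Matches e as) ⊎ (X* as δ e ≡ 0ℤ × ¬ Matches e as)
X*-δ []       e = δ-cases e
X*-δ (b ∷ bs) e with dec b e in q
... | nothing = inj₂ (refl , λ h → 1+n≢0 (trans (sym (count-same b bs)) (trans (h b) (dec-nothing b e q))))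
... | just e' with dec-just b e q | X*-δ bs e'
...   | r , s | inj₁ (p , h) = inj₁ (p , step)
  where
  step : Matches e (b ∷ bs)
  step a with b ≟ a
  ... | yes refl = trans (count-same b bs) (trans (cong suc (h b)) (sym r))
  ... | no p     = trans (count-other bs p) (trans (h a) (sym (s a p)))
...   | r , s | inj₂ (p , h) = inj₂ (p , λ h' → h (back h'))
  where
  back : Matches e (b ∷ bs) → Matches e' bs
  back h' a with b ≟ a
  ... | yes refl = suc-injective (trans (sym (count-same b bs)) (trans (h' b) r))
  ... | no p     = trans (sym (count-other bs p)) (trans (h' a) (s a p))

restricts : ∀ {n C} → Unique C → All (_< n) C → Restricts (upTo n) C
restricts {n} [] [] f h = trans (sumL-cong (upTo n) (λ a → h a (λ ()))) (sumL-0 (upTo n))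
restricts {n} {c ∷ C} (c∉ ∷ u) (c<n ∷ l) f h =
  trans (sumL-cong (upTo n) parts)
 (trans (sumL-+ (upTo n) only rest)
        (cong₂ _+_ (trans (sumL-single c<n only others) only-c)
          (trans (restricts u l rest vanish) (sumL-local C (All.map same c∉)))))
  where
  only rest : ℕ → ℤ
  only a with a ≟ c
  ... | yes _ = f a
  ... | no _  = 0ℤ
  rest a with a ≟ c
  ... | yes _ = 0ℤ
  ... | no _  = f a
  parts : ∀ a → f a ≡ only a + rest a
  parts a with a ≟ c
  ... | yes _ = sym (+-identityʳ (f a))
  ... | no _  = sym (+-identityˡ (f a))
  others : ∀ a → a ≢ c → only a ≡ 0ℤ
  others a p with a ≟ c
  ... | yes q = ⊥-elim (p q)
  ... | no _  = refl
  only-c : only c ≡ f c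
  only-c with c ≟ c
  ... | yes _ = refl
  ... | no p  = ⊥-elim (p refl)
  vanish : ∀ a → a ∉ C → rest a ≡ 0ℤ
  vanish a p with a ≟ c
  ... | yes _ = refl
  ... | no q  = h a (λ { (here r) → q r ; (there r) → p r })
  same : ∀ {a} → c ≢ a → rest a ≡ f a
  same {a} p with a ≟ c
  ... | yes q = ⊥-elim (p (sym q))
  ... | no _  = refl
  sumL-local : ∀ as {f g : ℕ → ℤ} → All (λ a → f a ≡ g a) as → sumL as f ≡ sumL as g
  sumL-local []       []       = refl
  sumL-local (a ∷ as) (p ∷ ps) = cong₂ _+_ p (sumL-local as ps)

-- The finite alphabet

-- The position of a label in the finite alphabet x_{1,1}, …, x_{r,n_r}:
-- the basement labels ω_b, ω_b + 1, … take the last places of the b-th block.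

offset : ∀ {r} → Vec ℕ r → Fin r → ℕ
offset (n ∷ ns) fzero    = 0
offset (n ∷ ns) (fsuc b) = n +ℕ offset ns b

index : ∀ {r} → Label r → Fin r
index (letter k b) = b
index (omega b t)  = b

place : ∀ {r} → ℕ → ℕ → Label r → ℕ
place n ℓ (letter k b) = pred k
place n ℓ (omega b t)  = (n ∸ ℓ) +ℕ t

code : ∀ {r} → Vec ℕ r → Vec (List ℕ) r → Label r → ℕ
code ns λs x = offset ns (index x) +ℕ place (lookup ns (index x)) (length (lookup λs (index x))) x

Admissible : ∀ {r} → ℕ → Vec (List ℕ) r → Label r → Set
Admissible M λs (letter k b) = 1 ≤ k × k ≤ M
Admissible M λs (omega b t)  = t < length (lookup λs b)

-- Room in every block for the letters up to `M` in front of the places taken by the basement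
-- labels.
record Large {r} (M : ℕ) (λs : Vec (List ℕ) r) (ns : Vec ℕ r) : Set where
  constructor mkLarge
  field
    bound : ∀ b → M +ℕ length (lookup λs b) ≤ lookup ns b

offset-< : ∀ {r} (ns : Vec ℕ r) b b' → toℕ b < toℕ b' → offset ns b +ℕ lookup ns b ≤ offset ns b'
offset-< (n ∷ ns) fzero    (fsuc b') _       = m≤m+n n (offset ns b')
offset-< (n ∷ ns) (fsuc b) (fsuc b') (s≤s p) =
  ≤-trans (≤-reflexive (+-assocℕ n (offset ns b) (lookup ns b))) (+-monoʳ-≤ n (offset-< ns b b' p))

offset-sum : ∀ {r} (ns : Vec ℕ r) b → offset ns b +ℕ lookup ns b ≤ sum ns
offset-sum (n ∷ ns) fzero    = m≤m+n n (sum ns)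
offset-sum (n ∷ ns) (fsuc b) = ≤-trans (≤-reflexive (+-assocℕ n (offset ns b) (lookup ns b))) (+-monoʳ-≤ n (offset-sum ns b))

<L-cmp : ∀ {r} (x y : Label r) → x <L y ⊎ x ≡ y ⊎ y <L x
<L-cmp x y with <-cmp (toℕ (index x)) (toℕ (index y))
<L-cmp (letter k b) (letter k' b') | tri< p _ _ = inj₁ (inj₁ p)
<L-cmp (letter k b) (omega b' t)   | tri< p _ _ = inj₁ (≤-trans (n≤1+n _) p)
<L-cmp (omega b t)  (letter k' b') | tri< p _ _ = inj₁ p
<L-cmp (omega b t)  (omega b' t')  | tri< p _ _ = inj₁ (inj₁ p)
<L-cmp (letter k b) (letter k' b') | tri> _ _ p = inj₂ (inj₂ (inj₁ p))
<L-cmp (letter k b) (omega b' t)   | tri> _ _ p = inj₂ (inj₂ p)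
<L-cmp (omega b t)  (letter k' b') | tri> _ _ p = inj₂ (inj₂ (≤-trans (n≤1+n _) p))
<L-cmp (omega b t)  (omega b' t')  | tri> _ _ p = inj₂ (inj₂ (inj₁ p))
<L-cmp x y | tri≈ _ e _ with toℕ-injective e
<L-cmp (letter k b) (letter k' _) | tri≈ _ _ _ | refl with <-cmp k k'
... | tri< p _ _    = inj₁ (inj₂ (refl , p))
... | tri≈ _ refl _ = inj₂ (inj₁ refl)
... | tri> _ _ p    = inj₂ (inj₂ (inj₂ (refl , p)))
<L-cmp (letter k b) (omega _ t)   | tri≈ _ e _ | refl = inj₁ (≤-reflexive e)
<L-cmp (omega b t)  (letter k' _) | tri≈ _ e _ | refl = inj₂ (inj₂ (≤-reflexive e))
<L-cmp (omega b t)  (omega _ t')  | tri≈ _ _ _ | refl with <-cmp t t'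
... | tri< p _ _    = inj₁ (inj₂ (refl , p))
... | tri≈ _ refl _ = inj₂ (inj₁ refl)
... | tri> _ _ p    = inj₂ (inj₂ (inj₂ (refl , p)))

module _ {r : ℕ} {M : ℕ} {λs : Vec (List ℕ) r} {ns : Vec ℕ r} (large : Large M λs ns) where

  open Large large

  place-< : ∀ x → Admissible M λs x → place (lookup ns (index x)) (length (lookup λs (index x))) x < lookup ns (index x)
  place-< (letter (suc k) b) (_ , p) = ≤-trans p (≤-trans (m≤m+n M _) (bound b))
  place-< (omega b t)        p       =
    <-≤-trans (+-monoʳ-< (lookup ns b ∸ length (lookup λs b)) p)
              (≤-reflexive (m∸n+n≡m (≤-trans (m≤n+m _ M) (bound b))))

  code-bound : ∀ x → Admissible M λs x → code ns λs x < sum ns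
  code-bound x p = <-≤-trans (+-monoʳ-< (offset ns (index x)) (place-< x p)) (offset-sum ns (index x))

  private
    later : ∀ x y → Admissible M λs x → toℕ (index x) < toℕ (index y) → code ns λs x < code ns λs y
    later x y p q = <-≤-trans (+-monoʳ-< (offset ns (index x)) (place-< x p))
      (≤-trans (offset-< ns (index x) (index y) q) (m≤m+n _ _))

  code-< : ∀ x y → Admissible M λs x → Admissible M λs y → x <L y → code ns λs x < code ns λs y
  code-< x@(letter _ _) y@(letter _ _) p q (inj₁ h) = later x y p h
  code-< (letter (suc k) b) (letter (suc k') b) p q (inj₂ (refl , s≤s h)) = +-monoʳ-< (offset ns b) h
  code-< x@(letter (suc k) b) y@(omega b' t) p q h with m≤n⇒m<n∨m≡n h
  ... | inj₁ h' = later x y p h'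
  ... | inj₂ e with toℕ-injective e
  -- The place of k_b is below k ≤ M, and M ≤ n - ℓ by `bound`, where the places of the labels ω_b +
  -- t begin.
  ...   | refl = +-monoʳ-< (offset ns b) (≤-trans (proj₂ p)
                   (≤-trans (m+n≤o⇒m≤o∸n M (bound b)) (m≤m+n _ t)))
  code-< x@(omega _ _) y@(letter _ _) p q h = later x y p h
  code-< x@(omega _ _) y@(omega _ _) p q (inj₁ h) = later x y p h
  code-< (omega b t) (omega b t') p q (inj₂ (refl , h)) = +-monoʳ-< (offset ns b) (+-monoʳ-< (lookup ns b ∸ length (lookup λs b)) h)

  code-<⁻ : ∀ x y → Admissible M λs x → Admissible M λs y → code ns λs x < code ns λs y → x <L y
  code-<⁻ x y p q h with <L-cmp x y
  ... | inj₁ l           = l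
  ... | inj₂ (inj₁ refl) = ⊥-elim (<-irrefl refl h)
  ... | inj₂ (inj₂ g)    = ⊥-elim (<-irrefl refl (<-trans h (code-< y x q p g)))

  code-injective : ∀ x y → Admissible M λs x → Admissible M λs y → code ns λs x ≡ code ns λs y → x ≡ y
  code-injective x y p q e with <L-cmp x y
  ... | inj₁ l           = ⊥-elim (<⇒≢ (code-< x y p q l) e)
  ... | inj₂ (inj₁ refl) = refl
  ... | inj₂ (inj₂ g)    = ⊥-elim (<⇒≢ (code-< y x q p g) (sym e))

-- The nonzero columns of γ and their basement.

nonzero-++ : ∀ cs ds → nonzero (cs ++ ds) ≡ nonzero cs ++ nonzero ds
nonzero-++ []                 ds = refl
nonzero-++ ((zero  , b) ∷ cs) ds = nonzero-++ cs ds
nonzero-++ ((suc h , b) ∷ cs) ds = cong (_ ∷_) (nonzero-++ cs ds)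

columns-++ : ∀ j α α' → columns j (α ++ α') ≡ columns (length α +ℕ j) α' ++ columns j α
columns-++ j []      α' = sym (++-identityʳ (columns j α'))
columns-++ j (x ∷ α) α' = trans (cong (_++ (x , j) ∷ []) (columns-++ (suc j) α α'))
  (trans (++-assoc (columns (length α +ℕ suc j) α') (columns (suc j) α) _)
         (cong (λ i → columns i α' ++ columns j (x ∷ α)) (+-suc (length α) j)))

nonzero-zeros : ∀ z j → nonzero (columns j (replicate z 0)) ≡ []
nonzero-zeros zero    j = refl
nonzero-zeros (suc z) j = trans (nonzero-++ (columns (suc j) (replicate z 0)) _)
  (trans (++-identityʳ _) (nonzero-zeros z (suc j)))

nonzero-positive : ∀ {α} → All (1 ≤_) α → ∀ j →
  nonzero (columns j α) ≡ reverse (zip α (applyUpTo (_+ℕ j) (length α)))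
nonzero-positive []                    j = refl
nonzero-positive {suc x ∷ α} (_ ∷ ps) j = trans (nonzero-++ (columns (suc j) α) _)
  (trans (cong (_++ (suc x , j) ∷ []) (trans (nonzero-positive ps (suc j))
            (cong (λ bs → reverse (zip α bs)) (applyUpTo-cong (length α) (λ t → +-suc t j)))))
         (sym (unfold-reverse (suc x , j) (zip α (applyUpTo (λ t → suc t +ℕ j) (length α))))))
  where
  applyUpTo-cong : ∀ n {f g : ℕ → ℕ} → (∀ t → f t ≡ g t) → applyUpTo f n ≡ applyUpTo g n
  applyUpTo-cong zero    h = refl
  applyUpTo-cong (suc n) h = cong₂ _∷_ (h 0) (applyUpTo-cong n (h ∘ suc))

toList-leftAlign : ∀ n l → length l ≤ n → toList (leftAlign n l) ≡ l ++ replicate (n ∸ length l) 0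
toList-leftAlign zero    []      p       = refl
toList-leftAlign (suc n) []      p       = cong (0 ∷_) (toList-leftAlign n [] z≤n)
toList-leftAlign (suc n) (x ∷ l) (s≤s p) = cong (x ∷_) (toList-leftAlign n l p)

reverse-replicate : ∀ z → reverse (replicate z 0) ≡ replicate z 0
reverse-replicate zero    = refl
reverse-replicate (suc z) = trans (unfold-reverse 0 (replicate z 0))
  (trans (cong (_++ 0 ∷ []) (reverse-replicate z)) (snoc z))
  where
  snoc : ∀ z → replicate z 0 ++ 0 ∷ [] ≡ 0 ∷ replicate z 0
  snoc zero    = refl
  snoc (suc z) = cong (0 ∷_) (snoc z)

baseCodes : ∀ {r} → ℕ → Vec ℕ r → Vec (List ℕ) r → List ℕ
baseCodes j []       []       = []
baseCodes j (n ∷ ns) (l ∷ ls) = applyUpTo (λ t → t +ℕ ((n ∸ length l) +ℕ j)) (length l) ++ baseCodes (n +ℕ j) ns ls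

zip-++ : ∀ {A B : Set} (as as' : List A) (bs bs' : List B) → length as ≡ length bs →
  zip (as ++ as') (bs ++ bs') ≡ zip as bs ++ zip as' bs'
zip-++ []       as' []       bs' e = refl
zip-++ (a ∷ as) as' (b ∷ bs) bs' e = cong (_ ∷_) (zip-++ as as' bs bs' (suc-injective e))

-- The leading zeros of each block leave no column, and all parts of λ survive because they are
-- positive. `reverse` appears because columns are listed from right to left.
nonzero-gamma : ∀ {r} j (ns : Vec ℕ r) (λs : Vec (List ℕ) r) →
  (∀ b → length (lookup λs b) ≤ lookup ns b) → (∀ b → All (1 ≤_) (lookup λs b)) →
  nonzero (columns j (toList (gammaV ns λs))) ≡ reverse (zip (shapeβ λs) (baseCodes j ns λs))
nonzero-gamma j []       []       p q = refl
nonzero-gamma j (n ∷ ns) (l ∷ ls) p q = begin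
  nonzero (columns j (toList (reverseᵛ (leftAlign n l) ++ᵛ gammaV ns ls)))
    ≡⟨ cong (λ α → nonzero (columns j α)) (trans (toList-++ (reverseᵛ (leftAlign n l)) (gammaV ns ls)) (cong (_++ γ) block)) ⟩
  nonzero (columns j ((replicate z 0 ++ reverse l) ++ γ))
    ≡⟨ cong nonzero (columns-++ j (replicate z 0 ++ reverse l) γ) ⟩
  nonzero (columns (length (replicate z 0 ++ reverse l) +ℕ j) γ ++ columns j (replicate z 0 ++ reverse l))
    ≡⟨ nonzero-++ (columns (length (replicate z 0 ++ reverse l) +ℕ j) γ) _ ⟩
  nonzero (columns (length (replicate z 0 ++ reverse l) +ℕ j) γ) ++ nonzero (columns j (replicate z 0 ++ reverse l))
    ≡⟨ cong₂ _++_ (trans (cong (λ m → nonzero (columns (m +ℕ j) γ)) len) (nonzero-gamma (n +ℕ j) ns ls (p ∘ fsuc) (q ∘ fsuc))) this ⟩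
  reverse (zip (shapeβ ls) (baseCodes (n +ℕ j) ns ls)) ++ reverse (zip (reverse l) bs)
    ≡⟨ sym (reverse-++ (zip (reverse l) bs) _) ⟩
  reverse (zip (reverse l) bs ++ zip (shapeβ ls) (baseCodes (n +ℕ j) ns ls))
    ≡⟨ cong reverse (sym (zip-++ (reverse l) (shapeβ ls) bs _ (trans (length-reverse l) (sym (length-applyUpTo _ (length l)))))) ⟩
  reverse (zip (shapeβ (l ∷ ls)) (baseCodes j (n ∷ ns) (l ∷ ls))) ∎
  where
  open ≡-Reasoning
  z  = n ∸ length l
  γ  = toList (gammaV ns ls)
  bs = applyUpTo (λ t → t +ℕ (z +ℕ j)) (length l)
  block : toList (reverseᵛ (leftAlign n l)) ≡ replicate z 0 ++ reverse l
  block = trans (toList-reverse (leftAlign n l)) (trans (cong reverse (toList-leftAlign n l (p fzero)))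
    (trans (reverse-++ l (replicate z 0)) (cong (_++ reverse l) (reverse-replicate z))))
  length-zeros : ∀ z → length (replicate z 0) ≡ z
  length-zeros zero    = refl
  length-zeros (suc z) = cong suc (length-zeros z)
  len : length (replicate z 0 ++ reverse l) ≡ n
  len = trans (length-++ (replicate z 0)) (trans (cong₂ _+ℕ_ (length-zeros z) (length-reverse l)) (m∸n+n≡m (p fzero)))
  this : nonzero (columns j (replicate z 0 ++ reverse l)) ≡ reverse (zip (reverse l) bs)
  this = trans (cong nonzero (columns-++ j (replicate z 0) (reverse l)))
    (trans (nonzero-++ (columns (length (replicate z 0) +ℕ j) (reverse l)) _)
    (trans (cong₂ _++_ (nonzero-positive (All-resp-↭ (↭-sym (↭-reverse l)) (q fzero)) (length (replicate z 0) +ℕ j)) (nonzero-zeros z j))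
    (trans (++-identityʳ _)
           (cong₂ (λ m k → reverse (zip (reverse l) (applyUpTo (_+ℕ (m +ℕ j)) k))) (length-zeros z) (length-reverse l)))))

-- `h` and `j` remember the blocks already passed, so that the induction can run through the blocks.
map-basement : ∀ {r r'} j (h : Fin r → Fin r') (c : Label r' → ℕ) (ns : Vec ℕ r) (λs : Vec (List ℕ) r) →
  (∀ b t → c (omega (h b) t) ≡ j +ℕ code ns λs (omega b t)) →
  map c (concat (toList (zipWith (λ b l → map (omega b) (upTo (length l))) (tabulate h) λs))) ≡ baseCodes j ns λs
map-basement j h c []       []       p = refl
map-basement j h c (n ∷ ns) (l ∷ ls) p =
  trans (map-++ c (map (omega (h fzero)) (upTo (length l))) _)
        (cong₂ _++_ first (map-basement (n +ℕ j) (h ∘ fsuc) c ns ls rest))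
  where
  z = n ∸ length l
  swapped : ∀ t → j +ℕ (z +ℕ t) ≡ t +ℕ (z +ℕ j)
  swapped t = trans (+-commℕ j (z +ℕ t)) (trans (cong (_+ℕ j) (+-commℕ z t)) (+-assocℕ t z j))
  first : map c (map (omega (h fzero)) (upTo (length l))) ≡ applyUpTo (λ t → t +ℕ (z +ℕ j)) (length l)
  first = trans (sym (map-∘ (upTo (length l)))) (trans (map-cong (λ t → trans (p fzero t) (swapped t)) (upTo (length l)))
            (map-applyUpTo id (λ t → t +ℕ (z +ℕ j)) (length l)))
  rest : ∀ b t → c (omega (h (fsuc b)) t) ≡ (n +ℕ j) +ℕ code ns ls (omega b t)
  rest b t = trans (p (fsuc b) t) (trans (cong (j +ℕ_) (+-assocℕ n (offset ns b) _))
    (trans (sym (+-assocℕ j n _)) (cong (_+ℕ code ns ls (omega b t)) (+-commℕ j n))))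

baseCodes-basement : ∀ {r} (ns : Vec ℕ r) λs → baseCodes 0 ns λs ≡ map (code ns λs) (basement λs)
baseCodes-basement ns λs = sym (map-basement 0 id (code ns λs) ns λs (λ b t → refl))

at-++ˡ : ∀ {m n} (u : Vec ℕ m) (v : Vec ℕ n) {a} → a < m → at (u ++ᵛ v) a ≡ at u a
at-++ˡ (x ∷ u) v {zero}  p       = refl
at-++ˡ (x ∷ u) v {suc a} (s≤s p) = at-++ˡ u v p

at-++ʳ : ∀ {m n} (u : Vec ℕ m) (v : Vec ℕ n) a → at (u ++ᵛ v) (m +ℕ a) ≡ at v a
at-++ʳ []      v a = refl
at-++ʳ (x ∷ u) v a = at-++ʳ u v a

at-leftAlign : ∀ n l {k} → k < n → at (leftAlign n l) k ≡ nth0 l k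
at-leftAlign (suc n) []      {zero}  p       = refl
at-leftAlign (suc n) []      {suc k} (s≤s p) = at-leftAlign n [] p
at-leftAlign (suc n) (x ∷ l) {zero}  p       = refl
at-leftAlign (suc n) (x ∷ l) {suc k} (s≤s p) = at-leftAlign n l p

at-mono : ∀ {r} (ns : Vec ℕ r) (μs : Vec (List ℕ) r) b {k} → k < lookup ns b →
  at (monoV ns μs) (offset ns b +ℕ k) ≡ nth0 (lookup μs b) k
at-mono (n ∷ ns) (l ∷ ls) fzero    p = trans (at-++ˡ (leftAlign n l) (monoV ns ls) p) (at-leftAlign n l p)
at-mono (n ∷ ns) (l ∷ ls) (fsuc b) {k} p = trans (cong (at (monoV (n ∷ ns) (l ∷ ls))) (+-assocℕ n (offset ns b) k))
  (trans (at-++ʳ (leftAlign n l) (monoV ns ls) (offset ns b +ℕ k)) (at-mono ns ls b p))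

find-block : ∀ {r} (ns : Vec ℕ r) a → sum ns ≤ a ⊎ ∃₂ λ b k → k < lookup ns b × a ≡ offset ns b +ℕ k
find-block []       a = inj₁ z≤n
find-block (n ∷ ns) a with a <? n
... | yes p = inj₂ (fzero , a , p , refl)
... | no p with find-block ns (a ∸ n)
...   | inj₁ q = inj₁ (subst (n +ℕ sum ns ≤_) (m+[n∸m]≡n n≤a) (+-monoʳ-≤ n q))
  where n≤a = ≮⇒≥ p
...   | inj₂ (b , k , q , e) = inj₂ (fsuc b , k , q ,
        trans (sym (m+[n∸m]≡n (≮⇒≥ p))) (trans (cong (n +ℕ_) e) (sym (+-assocℕ n (offset ns b) k))))

at-≥ : ∀ {n} (e : Vec ℕ n) {a} → n ≤ a → at e a ≡ 0
at-≥ []      p               = refl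
at-≥ (x ∷ e) {suc a} (s≤s p) = at-≥ e p

nth0-≥ : ∀ l {k} → length l ≤ k → nth0 l k ≡ 0
nth0-≥ []      p               = refl
nth0-≥ (x ∷ l) {suc k} (s≤s p) = nth0-≥ l p

mono-support : ∀ {r} (ns : Vec ℕ r) (μs : Vec (List ℕ) r) a → at (monoV ns μs) a ≢ 0 →
  ∃₂ λ b k → k < length (lookup μs b) × a ≡ offset ns b +ℕ k
mono-support ns μs a h with find-block ns a
... | inj₁ p = ⊥-elim (h (at-≥ (monoV ns μs) p))
... | inj₂ (b , k , p , refl) with k <? length (lookup μs b)
...   | yes q = b , k , q , refl
...   | no q  = ⊥-elim (h (trans (at-mono ns μs b p) (nth0-≥ (lookup μs b) (≮⇒≥ q))))

-- The conditions on a filling, column by column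

Cyc : ℕ → ℕ → ℕ → Set
Cyc a b c = (a < b × b < c) ⊎ (b < c × c < a) ⊎ (c < a × a < b)

closedOpen-false : ∀ {p x q} → ¬ (p ≤ x × x < q) → closedOpen _<ᵇ_ p x q ≡ false
closedOpen-false {p} {x} {q} h with x <ᵇ p in e | x <ᵇ q in e'
... | true  | _     = refl
... | false | false = refl
... | false | true  = ⊥-elim (h (<ᵇ-false⁻ {x} {p} e , <ᵇ-true⁻ {x} {q} e'))

closedOpen-false⁻ : ∀ {p x q} → closedOpen _<ᵇ_ p x q ≡ false → ¬ (p ≤ x × x < q)
closedOpen-false⁻ h (p , q) with trans (sym (cong₂ (λ a b → not a ∧ b) (<ᵇ-false p) (<ᵇ-true q))) h
... | ()

openClosed-false : ∀ {p x q} → ¬ (p < x × x ≤ q) → openClosed _<ᵇ_ p x q ≡ false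
openClosed-false {p} {x} {q} h with p <ᵇ x in e | q <ᵇ x in e'
... | false | _     = refl
... | true  | true  = refl
... | true  | false = ⊥-elim (h (<ᵇ-true⁻ {p} {x} e , <ᵇ-false⁻ {q} {x} e'))

openClosed-false⁻ : ∀ {p x q} → openClosed _<ᵇ_ p x q ≡ false → ¬ (p < x × x ≤ q)
openClosed-false⁻ h (p , q) with trans (sym (cong₂ (λ a b → a ∧ not b) (<ᵇ-true p) (<ᵇ-false q))) h
... | ()

-- A left column stepping from bp to ap, a right one from bq to aq
left-higher : ∀ {ap bp bq} → closedOpen _<ᵇ_ ap bq bp ≡ false → ap ≤ bp → bp ≢ bq → ap ≢ bq × ¬ Cyc ap bq bp
left-higher h ap≤bp bp≢bq =
    (λ { refl → closedOpen-false⁻ h (≤-refl , ≤∧≢⇒< ap≤bp (λ e → bp≢bq (sym e))) })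
  , λ { (inj₁ (p , q))        → closedOpen-false⁻ h (<⇒≤ p , q)
      ; (inj₂ (inj₁ (_ , p))) → <⇒≱ p ap≤bp
      ; (inj₂ (inj₂ (p , _))) → <⇒≱ p ap≤bp }

left-higher⁻ : ∀ {ap bp bq} → ap ≢ bq → ¬ Cyc ap bq bp → closedOpen _<ᵇ_ ap bq bp ≡ false
left-higher⁻ p q = closedOpen-false λ (h , h') → q (inj₁ (≤∧≢⇒< h p , h'))

right-higher : ∀ {ap aq bq} → openClosed _<ᵇ_ aq ap bq ≡ false → aq ≤ bq → ap ≢ aq → ap ≢ bq × ¬ Cyc aq ap bq
right-higher h aq≤bq ap≢aq =
    (λ { refl → openClosed-false⁻ h (≤∧≢⇒< aq≤bq (λ e → ap≢aq (sym e)) , ≤-refl) })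
  , λ { (inj₁ (p , q))        → openClosed-false⁻ h (p , <⇒≤ q)
      ; (inj₂ (inj₁ (_ , p))) → <⇒≱ p aq≤bq
      ; (inj₂ (inj₂ (p , _))) → <⇒≱ p aq≤bq }

right-higher⁻ : ∀ {ap aq bq} → ap ≢ bq → ¬ Cyc aq ap bq → openClosed _<ᵇ_ aq ap bq ≡ false
right-higher⁻ p q = openClosed-false λ (h , h') → q (inj₁ (h , ≤∧≢⇒< h' p))

apart-≢⁻ : ∀ {a b} → apart _<ᵇ_ a b ≡ true → a ≢ b
apart-≢⁻ {a} h refl with trans (sym h) (cong₂ _∨_ (<ᵇ-false (≤-refl {a})) (<ᵇ-false (≤-refl {a})))
... | ()

Column : ℕ → Set
Column r = Label r × List (Label r)

labAt : ∀ {r} → Column r → ℕ → Maybe (Label r)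
labAt (b , w) zero    = just b
labAt (b , w) (suc j) = nth w j

labAt-suc : ∀ {r} {b a : Label r} {w} j → labAt (b , a ∷ w) (suc j) ≡ labAt (a , w) j
labAt-suc zero    = refl
labAt-suc (suc j) = refl

ColOK : ∀ {r} → Column r → Set
ColOK p = ∀ j {a b} → labAt p (suc j) ≡ just a → labAt p j ≡ just b → a ≤L b

-- the first column is to the left of the second
record PairOK {r} (p q : Column r) : Set where
  field
    rows    : ∀ j {a b} → labAt p j ≡ just a → labAt q j ≡ just b → a ≢ b
    attacks : ∀ j {a b} → labAt p (suc j) ≡ just a → labAt q j ≡ just b → a ≢ b
    lower   : length (proj₂ q) < length (proj₂ p) → ∀ j {a b c} →
              labAt p (suc j) ≡ just a → labAt p j ≡ just c → labAt q j ≡ just b → ¬ Cyclic a b c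
    higher  : length (proj₂ p) ≤ length (proj₂ q) → ∀ j {a b c} →
              labAt q (suc j) ≡ just a → labAt q j ≡ just c → labAt p (suc j) ≡ just b → ¬ Cyclic a b c
open PairOK

module _ {r : ℕ} {M : ℕ} {λs : Vec (List ℕ) r} {ns : Vec ℕ r} (large : Large M λs ns) where

  private
    c : Label r → ℕ
    c = code ns λs

    Adm : Label r → Set
    Adm = Admissible M λs

  Adms : Column r → Set
  Adms (b , w) = Adm b × All Adm w

  coded : Column r → ℕ × List ℕ
  coded (b , w) = c b , map c w

  private
    ≢-code : ∀ {x y} → Adm x → Adm y → x ≢ y → c x ≢ c y
    ≢-code {x} {y} p q h e = h (code-injective large x y p q e)

    ≢-code⁻ : ∀ {x y} → c x ≢ c y → x ≢ y
    ≢-code⁻ h refl = h refl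

    ≤-code : ∀ {x y} → Adm x → Adm y → x ≤L y → c x ≤ c y
    ≤-code {x} {y} p q (inj₁ h)    = <⇒≤ (code-< large x y p q h)
    ≤-code         p q (inj₂ refl) = ≤-refl

    ≤-code⁻ : ∀ {x y} → Adm x → Adm y → c x ≤ c y → x ≤L y
    ≤-code⁻ {x} {y} p q h with m≤n⇒m<n∨m≡n h
    ... | inj₁ l = inj₁ (code-<⁻ large x y p q l)
    ... | inj₂ e = inj₂ (code-injective large x y p q e)

    cyclic-code : ∀ {x y z} → Adm x → Adm y → Adm z → Cyclic x y z → Cyc (c x) (c y) (c z)
    cyclic-code {x} {y} {z} p q s (inj₁ (h , h'))        = inj₁ (code-< large x y p q h , code-< large y z q s h')
    cyclic-code {x} {y} {z} p q s (inj₂ (inj₁ (h , h'))) = inj₂ (inj₁ (code-< large y z q s h , code-< large z x s p h'))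
    cyclic-code {x} {y} {z} p q s (inj₂ (inj₂ (h , h'))) = inj₂ (inj₂ (code-< large z x s p h , code-< large x y p q h'))

    cyclic-code⁻ : ∀ {x y z} → Adm x → Adm y → Adm z → Cyc (c x) (c y) (c z) → Cyclic x y z
    cyclic-code⁻ {x} {y} {z} p q s (inj₁ (h , h'))        = inj₁ (code-<⁻ large x y p q h , code-<⁻ large y z q s h')
    cyclic-code⁻ {x} {y} {z} p q s (inj₂ (inj₁ (h , h'))) = inj₂ (inj₁ (code-<⁻ large y z q s h , code-<⁻ large z x s p h'))
    cyclic-code⁻ {x} {y} {z} p q s (inj₂ (inj₂ (h , h'))) = inj₂ (inj₂ (code-<⁻ large z x s p h , code-<⁻ large x y p q h'))

    no-cycle : ∀ {x y z} → Adm x → Adm y → Adm z → ¬ Cyc (c x) (c y) (c z) → ¬ Cyclic x y z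
    no-cycle {x} {y} {z} p q s h h' = h (cyclic-code {x} {y} {z} p q s h')

    no-cycle⁻ : ∀ {x y z} → Adm x → Adm y → Adm z → ¬ Cyclic x y z → ¬ Cyc (c x) (c y) (c z)
    no-cycle⁻ {x} {y} {z} p q s h h' = h (cyclic-code⁻ {x} {y} {z} p q s h')

    tail-ok : ∀ (b a : Label r) w → ColOK (b , a ∷ w) → ColOK (a , w)
    tail-ok b a w h j e e' = h (suc j) e (trans (labAt-suc {b = b} j) e')

  descending-ok : ∀ b w → Adms (b , w) → descending (c b) (map c w) ≡ true → ColOK (b , w)
  descending-ok b (a ∷ w) (pb , pa ∷ pw) h zero    refl refl =
    ≤-code⁻ pa pb (<ᵇ-false⁻ {c b} {c a} (not-elim (proj₁ (∧-elim h))))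
  descending-ok b (a ∷ w) (pb , pa ∷ pw) h (suc j) e e' =
    descending-ok a w (pa , pw) (proj₂ (∧-elim {not (c b <ᵇ c a)} h)) j e (trans (sym (labAt-suc {b = b} j)) e')

  ok-descending : ∀ b w → Adms (b , w) → ColOK (b , w) → descending (c b) (map c w) ≡ true
  ok-descending b []      p                h = refl
  ok-descending b (a ∷ w) (pb , pa ∷ pw) h =
    ∧-intro (cong not (<ᵇ-false (≤-code pa pb (h 0 refl refl)))) (ok-descending a w (pa , pw) (tail-ok b a w h))

  -- The half-open tests yield distinct labels on attacking boxes only together with two facts
  -- carried up the columns: labels weakly decrease, and boxes of a common row have different
  -- labels, beginning with the basement.
  okPair-ok : ∀ bp wp bq wq → Adms (bp , wp) → Adms (bq , wq) → ColOK (bp , wp) → ColOK (bq , wq) → bp ≢ bq →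
    okPair (c bq) (map c wq) (c bp) (map c wp) ≡ true → PairOK (bp , wp) (bq , wq)
  okPair-ok bp [] bq wq Ap Aq kp kq d h = record
    { rows    = λ { zero refl refl → d ; (suc j) () _ }
    ; attacks = λ { j () _ }
    ; lower   = λ ()
    ; higher  = λ _ j _ _ () }
  okPair-ok bp (ap ∷ wp) bq [] (pb , pa ∷ pw) (qb , []) kp kq d h = record
    { rows    = λ { zero refl refl → d ; (suc j) _ () }
    ; attacks = λ { zero refl refl → ≢-code⁻ (proj₁ local) ; (suc j) _ () }
    ; lower   = λ { _ zero refl refl refl → no-cycle pa qb pb (proj₂ local) ; _ (suc j) _ _ () }
    ; higher  = λ () }
    where
    local = left-higher (not-elim h) (≤-code pa pb (kp 0 refl refl)) (≢-code pb qb d)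
  okPair-ok bp (ap ∷ wp) bq (aq ∷ wq) (pb , pa ∷ pw) (qb , qa ∷ qw) kp kq d h = record
    { rows    = λ { zero refl refl → d
                  ; (suc j) e e' → rows rest j (trans (sym (labAt-suc {b = bp} j)) e) (trans (sym (labAt-suc {b = bq} j)) e') }
    ; attacks = λ { zero refl refl → ≢-code⁻ attack
                  ; (suc j) e e' → attacks rest j e (trans (sym (labAt-suc {b = bq} j)) e') }
    ; lower   = λ { (s≤s l) zero refl refl refl → no-cycle pa qb pb (low (<ᵇ-true l))
                  ; (s≤s l) (suc j) e e' e'' → lower rest l j e (trans (sym (labAt-suc {b = bp} j)) e') (trans (sym (labAt-suc {b = bq} j)) e'') }
    ; higher  = λ { (s≤s l) zero refl refl refl → no-cycle qa pa qb (high (<ᵇ-false l))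
                  ; (s≤s l) (suc j) e e' e'' → higher rest l j e (trans (sym (labAt-suc {b = bq} j)) e') e'' } }
    where
    t = length (map c wq) <ᵇ length (map c wp)
    h₁ = ∧-elim {pair _<ᵇ_ t (c bq) (c aq) (c bp) (c ap)} h
    h₂ = ∧-elim {apart _<ᵇ_ (c aq) (c ap)} (proj₁ h₁)
    ap≢aq : c ap ≢ c aq
    ap≢aq e = apart-≢⁻ (proj₁ h₂) (sym e)
    left-if : t ≡ true → c ap ≢ c bq × ¬ Cyc (c ap) (c bq) (c bp)
    left-if e = left-higher (not-elim (trans (sym (cong (λ t → if t then not (closedOpen _<ᵇ_ (c ap) (c bq) (c bp)) else not (openClosed _<ᵇ_ (c aq) (c ap) (c bq))) e)) (proj₂ h₂)))
      (≤-code pa pb (kp 0 refl refl)) (≢-code pb qb d)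
    right-if : t ≡ false → c ap ≢ c bq × ¬ Cyc (c aq) (c ap) (c bq)
    right-if e = right-higher (not-elim (trans (sym (cong (λ t → if t then not (closedOpen _<ᵇ_ (c ap) (c bq) (c bp)) else not (openClosed _<ᵇ_ (c aq) (c ap) (c bq))) e)) (proj₂ h₂)))
      (≤-code qa qb (kq 0 refl refl)) ap≢aq
    same-lengths : t ≡ (length wq <ᵇ length wp)
    same-lengths = cong₂ _<ᵇ_ (length-map c wq) (length-map c wp)
    attack : c ap ≢ c bq
    attack = go t refl
      where
      go : ∀ s → t ≡ s → c ap ≢ c bq
      go true  e = proj₁ (left-if e)
      go false e = proj₁ (right-if e)
    low : (length wq <ᵇ length wp) ≡ true → ¬ Cyc (c ap) (c bq) (c bp)
    low e = proj₂ (left-if (trans same-lengths e))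
    high : (length wq <ᵇ length wp) ≡ false → ¬ Cyc (c aq) (c ap) (c bq)
    high e = proj₂ (right-if (trans same-lengths e))
    rest : PairOK (ap , wp) (aq , wq)
    rest = okPair-ok ap wp aq wq (pa , pw) (qa , qw) (tail-ok bp ap wp kp) (tail-ok bq aq wq kq) (≢-code⁻ ap≢aq) (proj₂ h₁)

  ok-okPair : ∀ bp wp bq wq → Adms (bp , wp) → Adms (bq , wq) → PairOK (bp , wp) (bq , wq) →
    okPair (c bq) (map c wq) (c bp) (map c wp) ≡ true
  ok-okPair bp [] bq wq Ap Aq k = refl
  ok-okPair bp (ap ∷ wp) bq [] (pb , pa ∷ pw) (qb , []) k =
    not-intro (left-higher⁻ (≢-code pa qb (attacks k 0 refl refl)) (no-cycle⁻ pa qb pb (lower k (s≤s z≤n) 0 refl refl refl)))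
  ok-okPair bp (ap ∷ wp) bq (aq ∷ wq) (pb , pa ∷ pw) (qb , qa ∷ qw) k =
    ∧-intro (∧-intro (apart-≢ (≢-code pa qa (rows k 1 refl refl))) (go (length (map c wq) <ᵇ length (map c wp)) refl))
            (ok-okPair ap wp aq wq (pa , pw) (qa , qw) rest)
    where
    attack : c ap ≢ c bq
    attack = ≢-code pa qb (attacks k 0 refl refl)
    same-lengths : (length (map c wq) <ᵇ length (map c wp)) ≡ (length wq <ᵇ length wp)
    same-lengths = cong₂ _<ᵇ_ (length-map c wq) (length-map c wp)
    go : ∀ t → (length (map c wq) <ᵇ length (map c wp)) ≡ t →
      (if t then not (closedOpen _<ᵇ_ (c ap) (c bq) (c bp)) else not (openClosed _<ᵇ_ (c aq) (c ap) (c bq))) ≡ true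
    go true  e = not-intro (left-higher⁻ attack (no-cycle⁻ pa qb pb
      (lower k (s≤s (<ᵇ-true⁻ {length wq} {length wp} (trans (sym same-lengths) e))) 0 refl refl refl)))
    go false e = not-intro (right-higher⁻ attack (no-cycle⁻ qa pa qb
      (higher k (s≤s (<ᵇ-false⁻ {length wq} {length wp} (trans (sym same-lengths) e))) 0 refl refl refl)))
    rest : PairOK (ap , wp) (aq , wq)
    rest = record
      { rows    = λ j e e' → rows k (suc j) (trans (labAt-suc {b = bp} j) e) (trans (labAt-suc {b = bq} j) e')
      ; attacks = λ j e e' → attacks k (suc j) e (trans (labAt-suc {b = bq} j) e')
      ; lower   = λ l j e e' e'' → lower k (s≤s l) (suc j) e (trans (labAt-suc {b = bp} j) e') (trans (labAt-suc {b = bq} j) e'')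
      ; higher  = λ l j e e' e'' → higher k (s≤s l) (suc j) e (trans (labAt-suc {b = bq} j) e') e'' }

-- Fillings by cell coordinates and as lists of columns.

nth-map : ∀ {S T : Set} (f : S → T) xs i → nth (map f xs) i ≡ mapᴹ f (nth xs i)
nth-map f []       i       = refl
nth-map f (x ∷ xs) zero    = refl
nth-map f (x ∷ xs) (suc i) = nth-map f xs i

nth-zip⁻ : ∀ {S T : Set} (xs : List S) (ys : List T) i {x y} → nth (zip xs ys) i ≡ just (x , y) →
  nth xs i ≡ just x × nth ys i ≡ just y
nth-zip⁻ (x ∷ xs) (y ∷ ys) zero    refl = refl , refl
nth-zip⁻ (x ∷ xs) (y ∷ ys) (suc i) e    = nth-zip⁻ xs ys i e

nth-zip : ∀ {S T : Set} (xs : List S) (ys : List T) i → length xs ≡ length ys →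
  (nth xs i ≡ nothing × nth ys i ≡ nothing) ⊎
  ∃₂ λ x y → nth xs i ≡ just x × nth ys i ≡ just y × nth (zip xs ys) i ≡ just (x , y)
nth-zip []       []       i       e = inj₁ (refl , refl)
nth-zip (x ∷ xs) (y ∷ ys) zero    e = inj₂ (x , y , refl , refl , refl)
nth-zip (x ∷ xs) (y ∷ ys) (suc i) e = nth-zip xs ys i (suc-injective e)

nth0-map : ∀ {S : Set} (f : S → ℕ) xs i {x} → nth xs i ≡ just x → nth0 (map f xs) i ≡ f x
nth0-map f (x ∷ xs) zero    refl = refl
nth0-map f (x ∷ xs) (suc i) e    = nth0-map f xs i e

All-nth : ∀ {S : Set} {P : S → Set} {xs} → All P xs → ∀ i {x} → nth xs i ≡ just x → P x
All-nth (p ∷ ps) zero    refl = p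
All-nth (p ∷ ps) (suc i) e    = All-nth ps i e

nth-All : ∀ {S : Set} {P : S → Set} xs → (∀ i {x} → nth xs i ≡ just x → P x) → All P xs
nth-All []       h = []
nth-All (x ∷ xs) h = h 0 refl ∷ nth-All xs (λ i → h (suc i))

AllPairs-nth : ∀ {S : Set} {R : S → S → Set} {xs} → AllPairs R xs →
  ∀ i i' {x y} → i < i' → nth xs i ≡ just x → nth xs i' ≡ just y → R x y
AllPairs-nth (p ∷ ps) zero    (suc i') _       refl e = All-nth p i' e
AllPairs-nth (p ∷ ps) (suc i) (suc i') (s≤s l) e e'   = AllPairs-nth ps i i' l e e'

nth-AllPairs : ∀ {S : Set} {R : S → S → Set} xs →
  (∀ i i' {x y} → i < i' → nth xs i ≡ just x → nth xs i' ≡ just y → R x y) → AllPairs R xs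
nth-AllPairs []       h = []
nth-AllPairs (x ∷ xs) h = nth-All xs (λ i → h 0 (suc i) (s≤s z≤n) refl) ∷
  nth-AllPairs xs (λ i i' l → h (suc i) (suc i') (s≤s l))

AllPairs-reverse : ∀ {S : Set} {R : S → S → Set} {xs} → AllPairs R xs → AllPairs (flip R) (reverse xs)
AllPairs-reverse [] = []
AllPairs-reverse {R = R} (_∷_ {x} {xs} p ps) rewrite unfold-reverse x xs =
  AllPairs-++⁺ (AllPairs-reverse ps) ([] ∷ []) (All.map (λ r → r ∷ []) (All-resp-↭ (↭-sym (↭-reverse xs)) p))

okFill-true : ∀ {F} → All (λ (b , w) → descending b w ≡ true) F → AllPairs (λ q p → okCols q p ≡ true) F → okFill F ≡ true
okFill-true []       []       = refl
okFill-true (d ∷ ds) (p ∷ ps) = ∧-intro d (∧-intro (all-true p) (okFill-true ds ps))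

okFill-true⁻ : ∀ F → okFill F ≡ true →
  All (λ (b , w) → descending b w ≡ true) F × AllPairs (λ q p → okCols q p ≡ true) F
okFill-true⁻ []            h = [] , []
okFill-true⁻ ((b , w) ∷ F) h with ∧-elim {descending b w} h
... | d , h' with ∧-elim {all (okCols (b , w)) F} h'
... | p , h'' with okFill-true⁻ F h''
... | ds , ps = d ∷ ds , all-true⁻ F p ∷ ps

module _ {r : ℕ} (λs : Vec (List ℕ) r) (σ : Filling r) where

  columnsOf : List (Column r)
  columnsOf = zip (basement λs) (map (map toLabel) σ)

  module _ (len : length (basement λs) ≡ length σ) where
    private
      len' : length (basement λs) ≡ length (map (map toLabel) σ)
      len' = trans len (sym (length-map (map toLabel) σ))

      starLab-just : ∀ i j {w} → nth σ i ≡ just w → starLab λs σ i (suc j) ≡ nth (map toLabel w) j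
      starLab-just i j {w} e rewrite e with nth w j | nth-map toLabel w j
      ... | just _  | e' = sym e'
      ... | nothing | e' = sym e'

      starLab-nothing : ∀ i j → nth σ i ≡ nothing → starLab λs σ i (suc j) ≡ nothing
      starLab-nothing i j e rewrite e = refl

      mapped : ∀ {S T : Set} (f : S → T) (m : Maybe S) {y} → mapᴹ f m ≡ just y → ∃ λ x → m ≡ just x × y ≡ f x
      mapped f (just x) refl = x , refl , refl

      unmapped : ∀ {S T : Set} (f : S → T) (m : Maybe S) → mapᴹ f m ≡ nothing → m ≡ nothing
      unmapped f nothing e = refl

      word : ∀ i {p} → nth columnsOf i ≡ just p → ∃ λ w → nth σ i ≡ just w × proj₂ p ≡ map toLabel w
      word i {b , v} e = mapped (map toLabel) (nth σ i)
        (trans (sym (nth-map (map toLabel) σ i)) (proj₂ (nth-zip⁻ (basement λs) (map (map toLabel) σ) i e)))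

    starLab-columns : ∀ i j {p} → nth columnsOf i ≡ just p → starLab λs σ i j ≡ labAt p j
    starLab-columns i zero    e = proj₁ (nth-zip⁻ (basement λs) (map (map toLabel) σ) i e)
    starLab-columns i (suc j) e with word i e
    ... | w , e' , refl = starLab-just i j e'

    columns-starLab : ∀ i j {a} → starLab λs σ i j ≡ just a → ∃ λ p → nth columnsOf i ≡ just p × labAt p j ≡ just a
    columns-starLab i j e with nth-zip (basement λs) (map (map toLabel) σ) i len'
    ... | inj₂ (b , w , _ , _ , e') = (b , w) , e' , trans (sym (starLab-columns i j e')) e
    columns-starLab i zero    e | inj₁ (e₁ , _) with trans (sym e₁) e
    ... | ()
    columns-starLab i (suc j) e | inj₁ (_ , e₂)
      with trans (sym (starLab-nothing i j (unmapped (map toLabel) (nth σ i) (trans (sym (nth-map (map toLabel) σ i)) e₂)))) e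
    ... | ()

    column-length : ∀ i {p} → nth columnsOf i ≡ just p → nth0 (map length σ) i ≡ length (proj₂ p)
    column-length i e with word i e
    ... | w , e' , refl = trans (nth0-map length σ i e') (sym (length-map toLabel w))

    InL-columns : InL λs σ → All ColOK columnsOf × AllPairs PairOK columnsOf
    InL-columns (shp , _ , rows , attacks , desc , triples) =
        nth-All columnsOf (λ i e j ea eb → desc i j _ _ (lab i (suc j) e ea) (lab i j e eb))
      , nth-AllPairs columnsOf (λ i i' {p} {q} i<i' e e' → record
          { rows    = λ j ea eb → rows i i' j _ _ (λ { refl → <-irrefl refl i<i' }) (lab i j e ea) (lab i' j e' eb)
          ; attacks = λ j ea eb → attacks i i' j _ _ i<i' (lab i (suc j) e ea) (lab i' j e' eb)
          ; lower   = λ l j ea ec eb → triples i i' j _ _ _ (lab i (suc j) e ea) (lab i j e ec)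
              (inj₁ (i<i' , subst₂ _<_ (height i' e') (height i e) l , lab i' j e' eb))
          ; higher  = λ l j ea ec eb → triples i' i j _ _ _ (lab i' (suc j) e' ea) (lab i' j e' ec)
              (inj₂ (i<i' , subst₂ _≤_ (height i e) (height i' e') l , lab i (suc j) e eb)) })
      where
      lab : ∀ i j {p a} → nth columnsOf i ≡ just p → labAt p j ≡ just a → starLab λs σ i j ≡ just a
      lab i j e ea = trans (starLab-columns i j e) ea
      height : ∀ i {p} → nth columnsOf i ≡ just p → length (proj₂ p) ≡ nth0 (shapeβ λs) i
      height i e = trans (sym (column-length i e)) (cong (λ β → nth0 β i) shp)

    columns-InL : map length σ ≡ shapeβ λs → All (All (λ x → 1 ≤ proj₁ x)) σ →
      All ColOK columnsOf → AllPairs PairOK columnsOf → InL λs σ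
    columns-InL shp pos cols pairs = shp , pos , rows' , attacks' , desc' , triples'
      where
      height : ∀ i {p} → nth columnsOf i ≡ just p → nth0 (shapeβ λs) i ≡ length (proj₂ p)
      height i e = trans (cong (λ β → nth0 β i) (sym shp)) (column-length i e)
      same-column : ∀ {i p q} → nth columnsOf i ≡ just p → nth columnsOf i ≡ just q → p ≡ q
      same-column e e' with trans (sym e) e'
      ... | refl = refl
      pair-ok : ∀ {i i' p q} → i < i' → nth columnsOf i ≡ just p → nth columnsOf i' ≡ just q → PairOK p q
      pair-ok {i} {i'} l e e' = AllPairs-nth pairs i i' l e e'
      rows' : ∀ i i' j a b → i ≢ i' → starLab λs σ i j ≡ just a → starLab λs σ i' j ≡ just b → a ≢ b
      rows' i i' j a b i≢i' ea eb with columns-starLab i j ea | columns-starLab i' j eb | <-cmp i i'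
      ... | p , e , fa | q , e' , fb | tri< l _ _ = PairOK.rows (pair-ok l e e') j fa fb
      ... | p , e , fa | q , e' , fb | tri≈ _ i≡ _ = ⊥-elim (i≢i' i≡)
      ... | p , e , fa | q , e' , fb | tri> _ _ l = λ a≡b → PairOK.rows (pair-ok l e' e) j fb fa (sym a≡b)
      attacks' : ∀ i i' j a b → i < i' → starLab λs σ i (suc j) ≡ just a → starLab λs σ i' j ≡ just b → a ≢ b
      attacks' i i' j a b l ea eb with columns-starLab i (suc j) ea | columns-starLab i' j eb
      ... | p , e , fa | q , e' , fb = PairOK.attacks (pair-ok l e e') j fa fb
      desc' : ∀ i j a b → starLab λs σ i (suc j) ≡ just a → starLab λs σ i j ≡ just b → a ≤L b
      desc' i j a b ea eb with columns-starLab i (suc j) ea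
      ... | p , e , fa = All-nth cols i e j fa (trans (sym (starLab-columns i j e)) eb)
      triples' : ∀ i i' j a b c → starLab λs σ i (suc j) ≡ just a → starLab λs σ i j ≡ just c →
        ((i < i' × nth0 (shapeβ λs) i' < nth0 (shapeβ λs) i × starLab λs σ i' j ≡ just b)
         ⊎ (i' < i × nth0 (shapeβ λs) i' ≤ nth0 (shapeβ λs) i × starLab λs σ i' (suc j) ≡ just b)) →
        ¬ Cyclic a b c
      triples' i i' j a b c ea ec (inj₁ (l , h , eb)) with columns-starLab i (suc j) ea | columns-starLab i' j eb
      ... | p , e , fa | q , e' , fb = PairOK.lower (pair-ok l e e') (subst₂ _<_ (height i' e') (height i e) h) j fa
              (trans (sym (starLab-columns i j e)) ec) fb
      triples' i i' j a b c ea ec (inj₂ (l , h , eb)) with columns-starLab i (suc j) ea | columns-starLab i' (suc j) eb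
      ... | p , e , fa | q , e' , fb = PairOK.higher (pair-ok l e' e) (subst₂ _≤_ (height i' e') (height i e) h) j fa
              (trans (sym (starLab-columns i j e)) ec) fb

module _ {r : ℕ} {M : ℕ} {λs : Vec (List ℕ) r} {ns : Vec ℕ r} (large : Large M λs ns) where
  private
    all-pairs : ∀ {S : Set} {P : S → Set} {R R' : S → S → Set} → (∀ {x y} → P x → P y → R x y → R' x y) →
      ∀ {xs} → All P xs → AllPairs R xs → AllPairs R' xs
    all-pairs f []       []       = []
    all-pairs f (p ∷ ps) (h ∷ hs) = All.zipWith (λ (q , s) → f p q s) (ps , h) ∷ all-pairs f ps hs

  okFill-columns : ∀ {L} → All (Adms large) L → All ColOK L → AllPairs PairOK L →
    okFill (reverse (map (coded large) L)) ≡ true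
  okFill-columns {L} adm cols pairs = okFill-true
    (All-resp-↭ (↭-sym (↭-reverse (map (coded large) L))) (All-map⁺ (All.zipWith (λ { {b , w} (p , k) → ok-descending large b w p k }) (adm , cols))))
    (AllPairs-reverse (AllPairs-map⁺ (all-pairs (λ { {bp , wp} {bq , wq} p q k → ok-okPair large bp wp bq wq p q k }) adm pairs)))

  columns-okFill : ∀ {L} → All (Adms large) L → AllPairs (λ p q → proj₁ p ≢ proj₁ q) L →
    okFill (reverse (map (coded large) L)) ≡ true → All ColOK L × AllPairs PairOK L
  columns-okFill {L} adm dist h with okFill-true⁻ (reverse (map (coded large) L)) h
  ... | ds , ps = cols , all-pairs (λ { {bp , wp} {bq , wq} (p , kp) (q , kq) (k , d) → okPair-ok large bp wp bq wq p q kp kq d k })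
                           (All.zip (adm , cols)) (AllPairs.zip (okp , dist))
    where
    cols : All ColOK L
    cols = All.zipWith (λ { {b , w} (p , d) → descending-ok large b w p d })
      (adm , All-map⁻ (All-resp-↭ (↭-reverse (map (coded large) L)) ds))
    okp : AllPairs (λ p q → okCols (coded large q) (coded large p) ≡ true) L
    okp = AllPairs-map⁻ (subst (AllPairs (λ p q → okCols q p ≡ true)) (reverse-involutive (map (coded large) L)) (AllPairs-reverse ps))

-- Enumeration

Unique-map-local : ∀ {S T : Set} {f : S → T} {xs} → (∀ {x y} → x ∈ xs → y ∈ xs → f x ≡ f y → x ≡ y) →
  Unique xs → Unique (map f xs)
Unique-map-local {xs = []}     inj []       = []
Unique-map-local {xs = x ∷ xs} inj (p ∷ ps) =
  All-map⁺ (All.tabulate λ {y} y∈ e → All.lookup p y∈ (inj (here refl) (there y∈) e)) ∷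
  Unique-map-local (λ p q → inj (there p) (there q)) ps

cons : ∀ {S : Set} → S × List S → List S
cons (x , xs) = x ∷ xs

allWords : ∀ {S : Set} → List S → ℕ → List (List S)
allWords ls zero    = [] ∷ []
allWords ls (suc h) = map cons (cartesianProduct ls (allWords ls h))

allFillings : ∀ {S : Set} → List S → List ℕ → List (List (List S))
allFillings ls []      = [] ∷ []
allFillings ls (h ∷ β) = map cons (cartesianProduct (allWords ls h) (allFillings ls β))

module _ {S : Set} {ls : List S} where
  private
    ∷-inj : ∀ {T : Set} {x y : T × List T} → cons x ≡ cons y → x ≡ y
    ∷-inj refl = refl

  allWords-unique : Unique ls → ∀ h → Unique (allWords ls h)
  allWords-unique u zero    = [] ∷ []
  allWords-unique u (suc h) = Unique-map⁺ ∷-inj (cartesianProduct⁺ u (allWords-unique u h))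

  allFillings-unique : Unique ls → ∀ β → Unique (allFillings ls β)
  allFillings-unique u []      = [] ∷ []
  allFillings-unique u (h ∷ β) = Unique-map⁺ ∷-inj (cartesianProduct⁺ (allWords-unique u h) (allFillings-unique u β))

  ∈-allWords : ∀ {w} → All (_∈ ls) w → w ∈ allWords ls (length w)
  ∈-allWords []       = here refl
  ∈-allWords (p ∷ ps) = ∈-map⁺ cons (∈-cartesianProduct⁺ p (∈-allWords ps))

  ∈-allFillings : ∀ {σ} → All (All (_∈ ls)) σ → σ ∈ allFillings ls (map length σ)
  ∈-allFillings []       = here refl
  ∈-allFillings (p ∷ ps) = ∈-map⁺ cons (∈-cartesianProduct⁺ (∈-allWords p) (∈-allFillings ps))

  ∈-allWords⁻ : ∀ h {w} → w ∈ allWords ls h → length w ≡ h × All (_∈ ls) w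
  ∈-allWords⁻ zero    (here refl) = refl , []
  ∈-allWords⁻ (suc h) p with ∈-map⁻ cons p
  ... | (a , w) , q , refl with ∈-cartesianProduct⁻ ls (allWords ls h) q
  ... | a∈ , w∈ with ∈-allWords⁻ h w∈
  ... | e , ps = cong suc e , a∈ ∷ ps

  ∈-allFillings⁻ : ∀ β {σ} → σ ∈ allFillings ls β → map length σ ≡ β × All (All (_∈ ls)) σ
  ∈-allFillings⁻ []      (here refl) = refl , []
  ∈-allFillings⁻ (h ∷ β) p with ∈-map⁻ cons p
  ... | (w , σ) , q , refl with ∈-cartesianProduct⁻ (allWords ls h) (allFillings ls β) q
  ... | w∈ , σ∈ with ∈-allWords⁻ h w∈ | ∈-allFillings⁻ β σ∈
  ... | e , ps | e' , pss = cong₂ _∷_ e e' , ps ∷ pss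

sumL-++ : ∀ {S : Set} (as bs : List S) f → sumL (as ++ bs) f ≡ sumL as f + sumL bs f
sumL-++ []       bs f = sym (ℤₚ.+-identityˡ _)
sumL-++ (a ∷ as) bs f = trans (cong (_+_ (f a)) (sumL-++ as bs f)) (sym (ℤₚ.+-assoc (f a) _ _))

sumL-map : ∀ {S T : Set} (g : S → T) as f → sumL (map g as) f ≡ sumL as (f ∘ g)
sumL-map g []       f = refl
sumL-map g (a ∷ as) f = cong (_+_ (f (g a))) (sumL-map g as f)

sumL-product : ∀ {S T : Set} (as : List S) (bs : List T) f →
  sumL (cartesianProduct as bs) f ≡ sumL as (λ a → sumL bs (λ b → f (a , b)))
sumL-product []       bs f = refl
sumL-product (a ∷ as) bs f = trans (sumL-++ (map (a ,_) bs) (cartesianProduct as bs) f)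
  (cong₂ _+_ (sumL-map (a ,_) bs f) (sumL-product as bs f))

wordSum-allWords : ∀ {S : Set} (c : S → ℕ) ls h F → wordSum (map c ls) h F ≡ sumL (allWords ls h) (F ∘ map c)
wordSum-allWords c ls zero    F = sym (ℤₚ.+-identityʳ _)
wordSum-allWords c ls (suc h) F = trans (sumL-map c ls _)
  (trans (sumL-cong ls λ a → wordSum-allWords c ls h (F ∘ (c a ∷_)))
         (sym (trans (sumL-map cons (cartesianProduct ls (allWords ls h)) _) (sumL-product ls (allWords ls h) _))))

fillSum-allFillings : ∀ {S : Set} (c : S → ℕ) ls β bs Φ → length β ≡ length bs →
  fillSum (map c ls) (zip β bs) Φ ≡ sumL (allFillings ls β) (λ σ → Φ (zip bs (map (map c) σ)))
fillSum-allFillings c ls []      []       Φ e = sym (ℤₚ.+-identityʳ _)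
fillSum-allFillings c ls (h ∷ β) (b ∷ bs) Φ e =
  trans (wordSum-allWords c ls h _)
 (trans (sumL-cong (allWords ls h) λ w → fillSum-allFillings c ls β bs _ (suc-injective e))
        (sym (trans (sumL-map cons (cartesianProduct (allWords ls h) (allFillings ls β)) _)
                    (sumL-product (allWords ls h) (allFillings ls β) _))))

-- Both `t` and `t'` are indicators of the same `P`, so the sum of one counts what is filtered by
-- the other. In the application `t` belongs to one fixed choice of the n_j and `t'` to an arbitrary
-- large one.
length-filter : ∀ {S : Set} (t t' : S → ℤ) {P : S → Set} as →
  All (λ a → (t a ≡ 1ℤ × P a) ⊎ (t a ≡ 0ℤ × ¬ P a)) as →
  All (λ a → (t' a ≡ 1ℤ × P a) ⊎ (t' a ≡ 0ℤ × ¬ P a)) as →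
  sumL as t' ≡ + length (filter (λ a → t a ℤₚ.≟ 1ℤ) as)
length-filter t t' [] [] [] = refl
length-filter t t' (a ∷ as) (h ∷ hs) (h' ∷ hs') = go h h'
  where
  rest = length-filter t t' as hs hs'
  go : _ → _ → t' a + sumL as t' ≡ + length (filter (λ a → t a ℤₚ.≟ 1ℤ) (a ∷ as))
  go (inj₁ (e , p)) (inj₁ (e' , _)) = trans (cong₂ _+_ e' rest)
    (cong (λ xs → + length xs) (sym (filter-accept (λ a → t a ℤₚ.≟ 1ℤ) {xs = as} e)))
  go (inj₂ (e , p)) (inj₂ (e' , _)) = trans (cong₂ _+_ e' rest) (trans (ℤₚ.+-identityˡ _)
    (cong (λ xs → + length xs) (sym (filter-reject (λ a → t a ℤₚ.≟ 1ℤ) {xs = as} (λ e₁ → 1≢0 (trans (sym e₁) e))))))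
    where
    1≢0 : 1ℤ ≢ 0ℤ
    1≢0 ()
  go (inj₁ (_ , p)) (inj₂ (_ , q)) = ⊥-elim (q p)
  go (inj₂ (_ , q)) (inj₁ (_ , p)) = ⊥-elim (q p)

basement-admissible : ∀ {r r'} M (λs₀ : Vec (List ℕ) r') (h : Fin r → Fin r') (λs : Vec (List ℕ) r) →
  (∀ b {t} → t < length (lookup λs b) → Admissible M λs₀ (omega (h b) t)) →
  All (Admissible M λs₀) (concat (toList (zipWith (λ b l → map (omega b) (upTo (length l))) (tabulate h) λs)))
basement-admissible M λs₀ h []       p = []
basement-admissible M λs₀ h (l ∷ ls) p =
  All-++⁺ (All-map⁺ (All.tabulate λ t∈ → p fzero (bound t∈))) (basement-admissible M λs₀ (h ∘ fsuc) ls (λ b → p (fsuc b)))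
  where
  bound : ∀ {t} → t ∈ upTo (length l) → t < length l
  bound t∈ with ∈-applyUpTo⁻ id t∈
  ... | _ , i<n , refl = i<n

length-baseCodes : ∀ {r} j (ns : Vec ℕ r) λs → length (baseCodes j ns λs) ≡ length (shapeβ λs)
length-baseCodes j []       []       = refl
length-baseCodes j (n ∷ ns) (l ∷ ls) = trans (length-++ (applyUpTo _ (length l)))
  (trans (cong₂ _+ℕ_ (trans (length-applyUpTo _ (length l)) (sym (length-reverse l))) (length-baseCodes (n +ℕ j) ns ls))
         (sym (length-++ (List.reverse l))))

length-basement : ∀ {r} (λs : Vec (List ℕ) r) → length (basement λs) ≡ length (shapeβ λs)
length-basement λs = trans (sym (length-map (code zeros λs) (basement λs)))
  (trans (cong length (sym (baseCodes-basement zeros λs))) (length-baseCodes 0 zeros λs))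
  where zeros = Vec.replicate _ 0

nonzero-All : ∀ {P : Col → Set} {cs} → All P cs → All P (nonzero cs)
nonzero-All []                       = []
nonzero-All (_∷_ {zero  , b} p ps)   = nonzero-All ps
nonzero-All (_∷_ {suc h , b} p ps)   = p ∷ nonzero-All ps

nonzero-AllPairs : ∀ {R : Col → Col → Set} {cs} → AllPairs R cs → AllPairs R (nonzero cs)
nonzero-AllPairs []                     = []
nonzero-AllPairs (_∷_ {zero  , b} p ps) = nonzero-AllPairs ps
nonzero-AllPairs (_∷_ {suc h , b} p ps) = nonzero-All p ∷ nonzero-AllPairs ps

content-++ : ∀ F F' → content (F ++ F') ≡ content F ++ content F'
content-++ []            F' = refl
content-++ ((b , w) ∷ F) F' = trans (cong (w ++_) (content-++ F F')) (sym (++-assoc w (content F) (content F')))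

content-reverse : ∀ F → content (reverse F) ↭ content F
content-reverse []            = ↭-refl
content-reverse ((b , w) ∷ F) = ↭-trans (↭-reflexive (trans (cong content (unfold-reverse (b , w) F))
    (trans (content-++ (reverse F) ((b , w) ∷ [])) (cong (content (reverse F) ++_) (++-identityʳ w)))))
  (↭-trans (↭-++⁺ʳ w (content-reverse F)) (↭-++-comm (content F) w))

map-zip : ∀ {r} {M : ℕ} {λs : Vec (List ℕ) r} {ns} (large : Large M λs ns) bs ws →
  map (coded large) (zip bs ws) ≡ zip (map (code ns λs) bs) (map (map (code ns λs)) ws)
map-zip large []       ws       = refl
map-zip large (b ∷ bs) []       = refl
map-zip large (b ∷ bs) (w ∷ ws) = cong (_ ∷_) (map-zip large bs ws)

map-proj₁-zip : ∀ {S T : Set} (xs : List S) (ys : List T) → length xs ≡ length ys → map proj₁ (zip xs ys) ≡ xs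
map-proj₁-zip []       []       e = refl
map-proj₁-zip (x ∷ xs) (y ∷ ys) e = cong (x ∷_) (map-proj₁-zip xs ys (suc-injective e))

map-proj₂-zip : ∀ {S T : Set} (xs : List S) (ys : List T) → length xs ≡ length ys → map proj₂ (zip xs ys) ≡ ys
map-proj₂-zip []       []       e = refl
map-proj₂-zip (x ∷ xs) (y ∷ ys) e = cong (y ∷_) (map-proj₂-zip xs ys (suc-injective e))

All-zip : ∀ {S T : Set} {P : S → Set} {Q : T → Set} {xs ys} → All P xs → All Q ys → All (λ (x , y) → P x × Q y) (zip xs ys)
All-zip []       qs       = []
All-zip (p ∷ ps) []       = []
All-zip (p ∷ ps) (q ∷ qs) = (p , q) ∷ All-zip ps qs

-- The coefficient as a sum over the fillings with letters up to `M`.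

module _ {r : ℕ} (λs μs : Vec (List ℕ) r) (M : ℕ) (short : ∀ b → length (lookup μs b) ≤ M) where

  alphabet : List (ℕ × Fin r)
  alphabet = cartesianProduct (applyUpTo suc M) (allFin r)

  alphabet-unique : Unique alphabet
  alphabet-unique = cartesianProduct⁺ (applyUpTo⁺₁ suc M (λ i<j _ e → <⇒≢ i<j (suc-injective e))) (allFin⁺ r)

  ∈-alphabet : ∀ {k} b → k < M → (suc k , b) ∈ alphabet
  ∈-alphabet b k<M = ∈-cartesianProduct⁺ (∈-applyUpTo⁺ suc k<M) (∈-allFin b)

  ∈-alphabet⁻ : ∀ {x} → x ∈ alphabet → ∃₂ λ k b → x ≡ (suc k , b) × k < M
  ∈-alphabet⁻ {_ , b} x∈ with ∈-cartesianProduct⁻ (applyUpTo suc M) (allFin r) x∈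
  ... | p , _ with ∈-applyUpTo⁻ suc p
  ... | k , k<M , refl = k , b , refl , k<M

  alphabet-admissible : ∀ {x} → x ∈ alphabet → Admissible M λs (toLabel x)
  alphabet-admissible x∈ with ∈-alphabet⁻ x∈
  ... | k , b , refl , k<M = s≤s z≤n , k<M

  module _ (positive : ∀ b → All (1 ≤_) (lookup λs b)) {ns : Vec ℕ r} (large : Large M λs ns) where

    private
      e : Vec ℕ (sum ns)
      e = monoV ns μs

      c : ℕ × Fin r → ℕ
      c = code ns λs ∘ toLabel

      C : List ℕ
      C = map c alphabet

      toLabel-injective : ∀ {x y : ℕ × Fin r} → toLabel x ≡ toLabel y → x ≡ y
      toLabel-injective refl = refl

      c-injective : ∀ {x y} → x ∈ alphabet → y ∈ alphabet → c x ≡ c y → x ≡ y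
      c-injective p q h = toLabel-injective (code-injective large _ _ (alphabet-admissible p) (alphabet-admissible q) h)

      C-unique : Unique C
      C-unique = Unique-map-local c-injective alphabet-unique

      C-bound : All (_< sum ns) C
      C-bound = All-map⁺ (All.tabulate λ {x} x∈ → code-bound large (toLabel x) (alphabet-admissible x∈))

      fits : ∀ b → M ≤ lookup ns b
      fits b = ≤-trans (m≤m+n M _) (Large.bound large b)

      support : ∀ a → a ∉ C → at e a ≡ 0
      support a a∉ with at e a ≟ 0
      ... | yes p = p
      ... | no p with mono-support ns μs a p
      ... | b , k , k<l , refl = ⊥-elim (a∉ (∈-map⁺ c (∈-alphabet b (<-≤-trans k<l (short b)))))

      at-letter : ∀ {k} b → k < M → at e (c (suc k , b)) ≡ nth0 (lookup μs b) k
      at-letter b k<M = at-mono ns μs b (<-≤-trans k<M (fits b))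

    -- The contribution of σ to the coefficient of the chosen monomial, computed in the finite
    -- alphabet given by `ns`.
    term : Filling r → ℤ
    term σ = okFill F ▹ X* (content F) δ e
      where F = reverse (map (coded large) (columnsOf λs σ))

    coefficient : ∀ (K : KeyFamily) → IsKeyFamily K →
      K (sum ns) (gammaV ns λs) e ≡ sumL (allFillings alphabet (shapeβ λs)) term
    coefficient K isKey = begin
      K (sum ns) γ e                                          ≡⟨ key-𝒢 K isKey k γ bounded e ⟩
      G (upTo (sum ns)) k (columns 0 (toList γ)) e            ≡⟨ sym (G-nonzero (upTo (sum ns)) k (columns-labels 0 (toList γ)) e) ⟩
      G (upTo (sum ns)) k (nonzero (columns 0 (toList γ))) e  ≡⟨ G-fillSum (upTo (sum ns)) k (nonzero-All (columns-heights 0 bounded)) e ⟩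
      fillSum (upTo (sum ns)) (nonzero (columns 0 (toList γ))) Φ ≡⟨ cong (λ cs → fillSum (upTo (sum ns)) cs Φ) shaped ⟩
      fillSum (upTo (sum ns)) (reverse (zip β bs)) Φ
        ≡⟨ fillSum-restrict (restricts C-unique C-bound) (reverse (zip β bs)) Φ vanish ⟩
      fillSum C (reverse (zip β bs)) Φ                        ≡⟨ fillSum-reverse C (zip β bs) Φ ⟩
      fillSum C (zip β bs) (Φ ∘ reverse)
        ≡⟨ fillSum-allFillings c alphabet β bs (Φ ∘ reverse) (trans (sym (length-basement λs)) (sym (length-map _ (basement λs)))) ⟩
      sumL (allFillings alphabet β) (λ σ → Φ (reverse (zip bs (map (map c) σ))))
        ≡⟨ sumL-cong (allFillings alphabet β) (λ σ → cong (Φ ∘ reverse) (sym (recoded σ))) ⟩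
      sumL (allFillings alphabet β) term ∎
      where
      open ≡-Reasoning
      γ  = gammaV ns λs
      β  = shapeβ λs
      bs = map (code ns λs) (basement λs)
      Φ : List (ℕ × List ℕ) → ℤ
      Φ F = okFill F ▹ X* (content F) δ e
      maximal : List ℕ → ℕ
      maximal []      = 0
      maximal (x ∷ α) = x +ℕ maximal α
      -- Any bound on the heights may serve as the number of rows; the sum of all entries is one.
      k = maximal (toList γ)
      below : ∀ α → All (_≤ maximal α) α
      below []      = []
      below (x ∷ α) = m≤m+n x _ ∷ All.map (λ p → ≤-trans p (m≤n+m (maximal α) x)) (below α)
      bounded = below (toList γ)
      shaped : nonzero (columns 0 (toList γ)) ≡ reverse (zip β bs)
      shaped = trans (nonzero-gamma 0 ns λs (λ b → ≤-trans (m≤n+m _ M) (Large.bound large b)) positive)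
        (cong (λ bs → reverse (zip β bs)) (baseCodes-basement ns λs))
      -- A letter outside `C` has exponent 0 in `e`, so a filling that uses it cannot have content
      -- `e`.
      vanish : ∀ F → Any (_∉ C) (content F) → Φ F ≡ 0ℤ
      vanish F h with X*-δ (content F) e
      ... | inj₂ (p , _) = trans (cong (okFill F ▹_) p) (▹-0 (okFill F))
      ... | inj₁ (_ , m) with Any.satisfied (Any-with-∈ h)
        where
        Any-with-∈ : ∀ {as} → Any (_∉ C) as → Any (λ a → a ∈ as × a ∉ C) as
        Any-with-∈ (here p)  = here (here refl , p)
        Any-with-∈ (there p) = there (Any.map (λ (q , s) → there q , s) (Any-with-∈ p))
      ... | a , a∈ , a∉ = ⊥-elim (count-∈ a∈ (trans (m a) (support a a∉)))
      recoded : ∀ σ → map (coded large) (columnsOf λs σ) ≡ zip bs (map (map c) σ)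
      recoded σ = trans (map-zip large (basement λs) (map (map toLabel) σ))
        (cong (zip bs) (trans (sym (map-∘ σ)) (map-cong (λ w → sym (map-∘ w)) σ)))

    private
      Counts : Filling r → Set
      Counts σ = ∀ (j : Fin r) (k : ℕ) → countL σ (suc k) j ≡ nth0 (lookup μs j) k

      same? = ≡-dec {A = ℕ} {B = λ _ → Fin r} _≟_ _≟F_

      count-code : ∀ {x} ws → x ∈ alphabet → All (_∈ alphabet) ws → count (c x) (map c ws) ≡ length (filter (λ y → same? y x) ws)
      count-code []       x∈ []        = refl
      count-code {x} (w ∷ ws) x∈ (w∈ ∷ ps) = go (same? w x)
        where
        go : Dec (w ≡ x) → count (c x) (map c (w ∷ ws)) ≡ length (filter (λ y → same? y x) (w ∷ ws))
        go (yes refl) = trans (count-same (c w) (map c ws)) (trans (cong suc (count-code ws x∈ ps))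
                          (cong length (sym (filter-accept (λ y → same? y x) {xs = ws} refl))))
        go (no p)     = trans (count-other (map c ws) (λ h → p (c-injective w∈ x∈ h))) (trans (count-code ws x∈ ps)
                          (cong length (sym (filter-reject (λ y → same? y x) {xs = ws} p))))

      count-absent : ∀ {x} ws → x ∉ ws → length (filter (λ y → same? y x) ws) ≡ 0
      count-absent []           x∉ = refl
      count-absent {x} (w ∷ ws) x∉ = trans (cong length (filter-reject (λ y → same? y x) {xs = ws} (λ h → x∉ (here (sym h)))))
        (count-absent ws (λ p → x∉ (there p)))

      count-absentℕ : ∀ {a} as → a ∉ as → count a as ≡ 0
      count-absentℕ []       a∉ = refl
      count-absentℕ (b ∷ bs) a∉ = trans (count-other bs (λ h → a∉ (here (sym h)))) (count-absentℕ bs (λ p → a∉ (there p)))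

      matches-counts : ∀ σ → All (_∈ alphabet) (concat σ) → Matches e (map c (concat σ)) → Counts σ
      matches-counts σ l m j k with k <? M
      ... | yes k<M = trans (sym (count-code (concat σ) (∈-alphabet j k<M) l)) (trans (m (c (suc k , j))) (at-letter j k<M))
      ... | no k≮M  = trans (count-absent (concat σ) absent) (sym (nth0-≥ (lookup μs j) (≤-trans (short j) (≮⇒≥ k≮M))))
        where
        absent : (suc k , j) ∉ concat σ
        absent p with ∈-alphabet⁻ (All.lookup l p)
        ... | _ , _ , refl , k<M = k≮M k<M

      counts-matches : ∀ σ → All (_∈ alphabet) (concat σ) → Counts σ → Matches e (map c (concat σ))
      counts-matches σ l h a with a ∈? C
      ... | no a∉ = trans (count-absentℕ (map c (concat σ)) absent) (sym (support a a∉))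
        where
        absent : a ∉ map c (concat σ)
        absent p with ∈-map⁻ c p
        ... | x , x∈ , refl = a∉ (∈-map⁺ c (All.lookup l x∈))
      ... | yes a∈ with ∈-map⁻ c a∈
      ... | x , x∈ , refl with ∈-alphabet⁻ x∈
      ... | k , b , refl , k<M = trans (count-code (concat σ) x∈ l) (trans (h b k) (sym (at-letter b k<M)))

      -- The codes of the basement are the positions of the nonzero columns of γ, which are strictly
      -- ordered.
      base-distinct : AllPairs (λ x y → x ≢ y) (basement λs)
      base-distinct = AllPairs.map (λ p q → <⇒≢ p (cong (code ns λs) q)) (AllPairs-map⁻ (subst (AllPairs _<_) second
          (AllPairs-map₂ (AllPairs-reverse⁻ (subst (AllPairs (λ c d → proj₂ d < proj₂ c)) gamma (nonzero-AllPairs (columns-labels 0 (toList (gammaV ns λs)))))))))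
        where
        bs = map (code ns λs) (basement λs)
        gamma : nonzero (columns 0 (toList (gammaV ns λs))) ≡ reverse (zip (shapeβ λs) bs)
        gamma = trans (nonzero-gamma 0 ns λs (λ b → ≤-trans (m≤n+m _ M) (Large.bound large b)) positive)
          (cong (λ bs → reverse (zip (shapeβ λs) bs)) (baseCodes-basement ns λs))
        second : map proj₂ (zip (shapeβ λs) bs) ≡ bs
        second = map-proj₂-zip (shapeβ λs) bs (trans (sym (length-basement λs)) (sym (length-map _ (basement λs))))
        AllPairs-reverse⁻ : ∀ {S : Set} {R : S → S → Set} {xs} → AllPairs R (reverse xs) → AllPairs (flip R) xs
        AllPairs-reverse⁻ {xs = xs} h = subst (AllPairs _) (reverse-involutive xs) (AllPairs-reverse h)
        AllPairs-map₂ : ∀ {cs : List Col} → AllPairs (λ c d → proj₂ c < proj₂ d) cs → AllPairs _<_ (map proj₂ cs)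
        AllPairs-map₂ h = AllPairs-map⁺ h

    -- The conditions on coded labels and the content amount to `InLμ`, which does not mention `ns`.
    -- So `term` is an indicator of the same set for all large `ns`, and this is why the coefficient
    -- stabilizes.
    term-cases : ∀ {σ} → σ ∈ allFillings alphabet (shapeβ λs) →
      (term σ ≡ 1ℤ × InLμ λs μs σ) ⊎ (term σ ≡ 0ℤ × ¬ InLμ λs μs σ)
    term-cases {σ} σ∈ with ∈-allFillings⁻ (shapeβ λs) σ∈
    ... | shp , ls = go (truth (okFill F))
      where
      L = columnsOf λs σ
      F = reverse (map (coded large) L)
      len : length (basement λs) ≡ length σ
      len = trans (length-basement λs) (trans (cong length (sym shp)) (length-map length σ))
      in-alphabet : All (_∈ alphabet) (concat σ)
      in-alphabet = All-concat⁺ ls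
      admissible : All (Adms large) L
      admissible = All-zip (basement-admissible M λs id λs (λ b p → p))
        (All-map⁺ (All.map (λ ps → All-map⁺ (All.map alphabet-admissible ps)) ls))
      distinct : AllPairs (λ p q → proj₁ p ≢ proj₁ q) L
      distinct = AllPairs-map⁻ (subst (AllPairs _≢_) (sym (map-proj₁-zip (basement λs) (map (map toLabel) σ)
        (trans len (sym (length-map (map toLabel) σ))))) base-distinct)
      pos : All (All (λ x → 1 ≤ proj₁ x)) σ
      pos = All.map (All.map (λ x∈ → proj₁ (alphabet-admissible x∈))) ls
      contents : content F ↭ map c (concat σ)
      contents = ↭-trans (content-reverse (map (coded large) L)) (↭-reflexive
        (trans (cong concat words) (concat-map σ)))
        where
        words : map proj₂ (map (coded large) L) ≡ map (map c) σ
        words = trans (cong (map proj₂) (map-zip large (basement λs) (map (map toLabel) σ)))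
          (trans (map-proj₂-zip (map (code ns λs) (basement λs)) (map (map (code ns λs)) (map (map toLabel) σ))
                   (trans (length-map _ (basement λs)) (trans len (sym (trans (length-map _ (map (map toLabel) σ)) (length-map _ σ))))))
                 (trans (sym (map-∘ σ)) (map-cong (λ w → sym (map-∘ w)) σ)))
      reweigh : X* (content F) δ e ≡ X* (map c (concat σ)) δ e
      reweigh = X*-↭ δ contents e
      go : okFill F ≡ true ⊎ okFill F ≡ false → (term σ ≡ 1ℤ × InLμ λs μs σ) ⊎ (term σ ≡ 0ℤ × ¬ InLμ λs μs σ)
      go (inj₂ no-fill) = inj₂ (cong (_▹ X* (content F) δ e) no-fill , λ (inL , _) →
        absurd (trans (sym (uncurry (okFill-columns large admissible) (InL-columns λs σ len inL))) no-fill))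
        where
        absurd : true ≢ false
        absurd ()
      go (inj₁ fill) with X*-δ (map c (concat σ)) e
      ... | inj₁ (p , m) = inj₁ (trans (cong (_▹ X* (content F) δ e) fill) (trans reweigh p)
            , uncurry (columns-InL λs σ len shp pos) (columns-okFill large admissible distinct fill)
            , matches-counts σ in-alphabet m)
      ... | inj₂ (p , m) = inj₂ (trans (cong (_▹ X* (content F) δ e) fill) (trans reweigh p)
            , λ (_ , h) → m (counts-matches σ in-alphabet h))

  -- A letter k_b occurs only if the k-th part of the b-th partition of `μs` is nonzero; hence k ≤
  -- M, and the finite alphabet contains all letters used.
  ∈-InLμ : ∀ {σ} → InLμ λs μs σ → σ ∈ allFillings alphabet (shapeβ λs)
  ∈-InLμ {σ} ((shp , pos , _) , counts) = subst (λ β → σ ∈ allFillings alphabet β) shp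
    (∈-allFillings (All.tabulate λ {w} w∈ → All.tabulate λ {x} x∈ → letter∈ w∈ x∈))
    where
    letter∈ : ∀ {w x} → w ∈ σ → x ∈ w → x ∈ alphabet
    letter∈ {w} {k₁ , b} w∈ x∈ with All.lookup (All.lookup pos w∈) x∈
    letter∈ {w} {suc k , b} w∈ x∈ | _ with k <? length (lookup μs b)
    ... | yes p = ∈-alphabet b (<-≤-trans p (short b))
    ... | no p  = ⊥-elim (occurs (concat σ) (∈-concat⁺′ x∈ w∈) (trans (counts b k) (nth0-≥ (lookup μs b) (≮⇒≥ p))))
      where
      same = ≡-dec {A = ℕ} {B = λ _ → Fin r} _≟_ _≟F_
      occurs : ∀ ws → (suc k , b) ∈ ws → length (filter (λ y → same y (suc k , b)) ws) ≢ 0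
      occurs (y ∷ ws) y∈ h = go (same y (suc k , b)) y∈
        where
        go : Dec (y ≡ (suc k , b)) → (suc k , b) ∈ y ∷ ws → ⊥
        go (yes q) _           with trans (sym (cong length (filter-accept (λ y → same y (suc k , b)) {xs = ws} q))) h
        ... | ()
        go (no q)  (here q')   = q (sym q')
        go (no q)  (there y∈') = occurs ws y∈'
          (trans (sym (cong length (filter-reject (λ y → same y (suc k , b)) {xs = ws} q))) h)

-- The stable value of the coefficient.

total : ∀ {r} → Vec (List ℕ) r → ℕ
total []       = 0
total (l ∷ ls) = length l +ℕ total ls

length≤total : ∀ {r} (ls : Vec (List ℕ) r) b → length (lookup ls b) ≤ total ls
length≤total (l ∷ ls) fzero    = m≤m+n (length l) (total ls)
length≤total (l ∷ ls) (fsuc b) = ≤-trans (length≤total ls b) (m≤n+m (total ls) (length l))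

AllV-lookup : ∀ {S : Set} {P : S → Set} {r} {v : Vec S r} → AllV P v → ∀ b → P (lookup v b)
AllV-lookup (p ∷ ps) fzero    = p
AllV-lookup (p ∷ ps) (fsuc b) = AllV-lookup ps b

mainTheorem2 : (r : ℕ) (λs μs : Vec (List ℕ) r) →
    AllV Partition λs → AllV Partition μs →
    (K : KeyFamily) → IsKeyFamily K →
    Σ (List (Filling r)) λ xs →
    Unique xs
    × (∀ σ → (σ ∈ xs → InLμ λs μs σ) × (InLμ λs μs σ → σ ∈ xs))
    × ∃ λ N → ∀ (ns : Vec ℕ r) → AllV (N ≤_) ns →
    K (sum ns) (gammaV ns λs) (monoV ns μs) ≡ + length xs
mainTheorem2 r λs μs partλ partμ K isKey =
    xs
  , filter⁺ in-xs? (allFillings-unique (alphabet-unique λs μs M short) (shapeβ λs))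
  , (λ σ → sound , complete)
  -- `M` bounds the letters and `total λs` the number of basement labels of each block, so blocks of
  -- this size have room for both.
  , M +ℕ total λs
  , λ ns big → trans (coefficient λs μs M short positive (large big) K isKey)
      (length-filter (t₀) (term λs μs M short positive (large big)) (allFillings ls (shapeβ λs))
        (All.tabulate (term-cases λs μs M short positive large₀))
        (All.tabulate (term-cases λs μs M short positive (large big))))
  where
  M = total μs
  short : ∀ b → length (lookup μs b) ≤ M
  short = length≤total μs
  positive : ∀ b → All (1 ≤_) (lookup λs b)
  positive b = proj₂ (AllV-lookup partλ b)
  large : ∀ {ns} → AllV (M +ℕ total λs ≤_) ns → Large M λs ns
  large big = mkLarge λ b → ≤-trans (+-mono-≤ ≤-refl (length≤total λs b)) (AllV-lookup big b)
  ns₀ = Vec.replicate r (M +ℕ total λs)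
  all-replicate : ∀ r {x} → AllV (x ≤_) (Vec.replicate r x)
  all-replicate zero    = []
  all-replicate (suc r) = ≤-refl ∷ all-replicate r
  large₀ : Large M λs ns₀
  large₀ = large (all-replicate r)
  t₀ = term λs μs M short positive large₀
  ls = alphabet λs μs M short
  in-xs? = λ σ → t₀ σ ℤₚ.≟ 1ℤ
  xs = filter in-xs? (allFillings ls (shapeβ λs))
  sound : ∀ {σ} → σ ∈ xs → InLμ λs μs σ
  sound {σ} σ∈ with ∈-filter⁻ in-xs? σ∈
  ... | σ∈' , t≡1 with term-cases λs μs M short positive large₀ σ∈'
  ... | inj₁ (_ , h)   = h
  ... | inj₂ (t≡0 , _) with trans (sym t≡1) t≡0
  ... | ()
  complete : ∀ {σ} → InLμ λs μs σ → σ ∈ xs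
  complete {σ} h with ∈-InLμ λs μs M short h
  ... | σ∈ with term-cases λs μs M short positive large₀ σ∈
  ... | inj₁ (t≡1 , _) = ∈-filter⁺ in-xs? σ∈ t≡1
  ... | inj₂ (_ , ¬h)  = ⊥-elim (¬h h)
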